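{- For any nonnegative integer $\gamma$, the operad $\mathsf{DAs}_\gamma$ is the vector space of $\gamma$-alternating Schröder trees. Moreover, for any $\gamma$-alternating Schröder trees $\mathfrak{s}$ and $\mathfrak{t}$, $\mathfrak{s} \circ_i \mathfrak{t}$ is the $\gamma$-alternating Schröder tree obtained by grafting the root of $\mathfrak{t}$ on the $i$th leaf $x$ of $\mathfrak{s}$ and then, if the father $y$ of $x$ and the root $z$ of $\mathfrak{t}$ have a same label, by contracting the edge connecting $y$ and $z$.
   Context: The ground field has characteristic zero; operad means nonsymmetric operad; $[\gamma] = \{1, \dots, \gamma\}$; $a \uparrow a' := \max(a, a')$. $\mathbf{Free}(\mathfrak{G})$ is the free operad on a set $\mathfrak{G}$ of binary generators. A Schröder tree is a planar rooted tree in which every internal node has at least two children (the tree reduced to a leaf is allowed, as the unit). A $\gamma$-alternating Schröder tree is a Schröder tree whose internal nodes are labeled by elements of $[\gamma]$ in such a way that the label of an internal node is different from the labels of its children that are internal nodes. The arity of such a tree is its number of leaves. "The operad is the vector space of..." means that it is isomorphic, as an operad, to the graded vector space spanned by these trees with the given partial compositions. $\mathsf{As}_\gamma$ is the operad $\mathbf{Free}(\{\star_a : a \in [\gamma]\})/\langle \mathfrak{R} \rangle$, where the $\star_a$ are binary generators and $\mathfrak{R}$ is generated by $\star_a \circ_1 \star_{a'} - \star_{a \uparrow a'} \circ_2 \star_{a \uparrow a'}$ and $\star_a \circ_2 \star_{a'} - \star_{a \uparrow a'} \circ_2 \star_{a \uparrow a'}$, $a, a' \in [\gamma]$. $\mathsf{DAs}_\gamma$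 is its Koszul dual, that is, $\mathbf{Free}(\{\star_a : a \in [\gamma]\})/\langle \mathfrak{R}^\perp \rangle$, where $\mathfrak{R}^\perp$ is the annihilator of $\mathfrak{R}$ in $\mathbf{Free}(\{\star_a\})(3)$ for the bilinear form with $\langle x \circ_i y, x' \circ_{i'} y' \rangle = 1$ if $x = x', y = y', i = i' = 1$; $= -1$ if $x = x', y = y', i = i' = 2$; and $0$ otherwise. Equivalently, $\mathsf{DAs}_\gamma$ is presented by $\gamma$ binary generators $\diamond_a$, $a \in [\gamma]$, subject only to the relations $\diamond_a \circ_1 \diamond_a = \diamond_a \circ_2 \diamond_a$, $a \in [\gamma]$. -}

module Defs where

open import Level using (Level; 0ℓ; _⊔_) renaming (suc to lsuc)
open import Algebra.Bundles using (CommutativeMonoid; CommutativeRing)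
open import Algebra.Apartness.Bundles using (HeytingField; HeytingCommutativeRing)
open import Algebra.Module.Bundles using (LeftModule)
open import Algebra.Module.Morphism.Structures using (module LeftModuleMorphisms)
import Algebra.Construct.NaturalChoice.Max as Max
import Algebra.Definitions.RawMonoid as RawMonoidDefs
import Algebra.Properties.AbelianGroup as AbelianGroupProperties
import Algebra.Properties.CommutativeSemigroup as CommutativeSemigroupProperties
import Algebra.Properties.Ring as RingProperties
open import Data.Bool.Base using (if_then_else_; _∧_)
open import Data.Fin.Base as Fin using (Fin; zero; suc; toℕ; splitAt)
import Data.Fin.Properties as Fin
open import Data.List.Base using (List; []; _∷_; _++_; map; length)
open import Data.List.Properties using (length-++)
open import Data.List.Relation.Unary.All using (All; []; _∷_)
open import Data.List.Relation.Unary.All.Properties using (++⁺)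
open import Data.Nat.Base using (ℕ; zero; suc; _+_; _≤_; _<_; z≤n; s≤s)
open import Data.Nat.Properties as ℕ using (module ≤-Reasoning)
open import Data.Product.Base using (_×_; _,_)
open import Data.Sum.Base using (inj₁; inj₂)
open import Relation.Binary.Definitions using (DecidableEquality)
open import Relation.Binary.PropositionalEquality
  using (_≡_; _≢_; refl; sym; trans; cong; cong₂; subst)
import Relation.Binary.Reasoning.Setoid as SetoidReasoning
open import Relation.Nullary using (¬_; yes; no; does; contradiction)
open import Relation.Nullary.Decidable using (map′; _×-dec_; recompute)
open import Relation.Unary using (Pred)

groundRing : ∀ {c ℓ₁ ℓ₂} → HeytingField c ℓ₁ ℓ₂ → CommutativeRing c ℓ₁
groundRing F = HeytingCommutativeRing.commutativeRing (HeytingField.heytingCommutativeRing F)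

CharacteristicZero : ∀ {c ℓ₁ ℓ₂} → HeytingField c ℓ₁ ℓ₂ → Set ℓ₁
CharacteristicZero F = ∀ n → ¬ (suc n ⋅ 1# ≈ 0#)
  where
  open CommutativeRing (groundRing F) using (_≈_; 0#; 1#; +-rawMonoid)
  open RawMonoidDefs +-rawMonoid using () renaming (_×_ to infixr 8 _⋅_)

-- Partial compositions go from arities n and m to arity n + m - 1.  The
-- target arity k is linked to n and m by an irrelevant equation rather than
-- computed, so that the axioms need no transports.  Inputs are numbered
-- from 0.

record RawSetOperad : Set₁ where
  infix 4 _≟_
  field
    Op   : ℕ → Set
    _≟_  : ∀ {n} → DecidableEquality (Op n)
    unit : Op 1
    comp : ∀ {k n m} → .(suc k ≡ n + m) → Op n → Fin n → Op m → Op k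

record IsSetOperad (P : RawSetOperad) : Set where
  open RawSetOperad P
  field
    identityˡ : ∀ {n} .(e : suc n ≡ 1 + n) (i : Fin 1) (x : Op n) →
      comp e unit i x ≡ x
    identityʳ : ∀ {n} .(e : suc n ≡ n + 1) (x : Op n) (i : Fin n) →
      comp e x i unit ≡ x
    sequential : ∀ {n m l k₁ k₂ k}
      .(e₁ : suc k₁ ≡ n + m) .(e₁′ : suc k ≡ k₁ + l)
      .(e₂ : suc k₂ ≡ m + l) .(e₂′ : suc k ≡ n + k₂)
      (x : Op n) (i : Fin n) (y : Op m) (j : Fin m) (z : Op l) (j′ : Fin k₁) →
      toℕ j′ ≡ toℕ i + toℕ j →
      comp e₁′ (comp e₁ x i y) j′ z ≡ comp e₂′ x i (comp e₂ y j z)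
    parallel : ∀ {n m l k₁ k₂ k}
      .(e₁ : suc k₁ ≡ n + m) .(e₁′ : suc k ≡ k₁ + l)
      .(e₂ : suc k₂ ≡ n + l) .(e₂′ : suc k ≡ k₂ + m)
      (x : Op n) (i j : Fin n) (y : Op m) (z : Op l) (i′ : Fin k₁) (j′ : Fin k₂) →
      toℕ i < toℕ j → toℕ i′ ≡ toℕ i → suc (toℕ j′) ≡ toℕ j + l →
      comp e₁′ (comp e₁ x j y) i′ z ≡ comp e₂′ (comp e₂ x i z) j′ y

module _ (G : Set) where

  data BinaryTree : Set where
    leaf : BinaryTree
    node : G → BinaryTree → BinaryTree → BinaryTree

module _ {G : Set} where

  leavesᵇ : BinaryTree G → ℕ
  leavesᵇ leaf         = 1
  leavesᵇ (node _ l r) = leavesᵇ l + leavesᵇ r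

  graft : (s : BinaryTree G) → Fin (leavesᵇ s) → BinaryTree G → BinaryTree G
  graft leaf         i t = t
  graft (node a l r) i t with splitAt (leavesᵇ l) i
  ... | inj₁ j = node a (graft l j t) r
  ... | inj₂ j = node a l (graft r j t)

  node-injective : ∀ {a b : G} {l r l′ r′} → node a l r ≡ node b l′ r′ →
    a ≡ b × l ≡ l′ × r ≡ r′
  node-injective refl = refl , refl , refl

  binaryTree-≟ : DecidableEquality G → DecidableEquality (BinaryTree G)
  binaryTree-≟ _≟_ leaf         leaf            = yes refl
  binaryTree-≟ _≟_ leaf         (node _ _ _)    = no λ ()
  binaryTree-≟ _≟_ (node _ _ _) leaf            = no λ ()
  binaryTree-≟ _≟_ (node a l r) (node b l′ r′)  =
    map′ (λ { (refl , refl , refl) → refl }) node-injective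
      ((a ≟ b) ×-dec (binaryTree-≟ _≟_ l l′ ×-dec binaryTree-≟ _≟_ r r′))

  private
    toℕ-inj₁ : ∀ m {n} (i : Fin (m + n)) {j} → splitAt m i ≡ inj₁ j → toℕ i ≡ toℕ j
    toℕ-inj₁ m {n} i {j} eq =
      trans (cong toℕ (sym (Fin.splitAt⁻¹-↑ˡ {m} {n} {i} {j} eq))) (Fin.toℕ-↑ˡ j n)

    toℕ-inj₂ : ∀ m {n} (i : Fin (m + n)) {j} → splitAt m i ≡ inj₂ j → toℕ i ≡ m + toℕ j
    toℕ-inj₂ m {n} i {j} eq =
      trans (cong toℕ (sym (Fin.splitAt⁻¹-↑ʳ {m} {n} {i} {j} eq))) (Fin.toℕ-↑ʳ m j)

    swap-right : ∀ a b c → (a + b) + c ≡ (a + c) + b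
    swap-right = xy∙z≈xz∙y
      where open CommutativeSemigroupProperties ℕ.+-commutativeSemigroup

  leaves-graft : ∀ s i t → suc (leavesᵇ (graft s i t)) ≡ leavesᵇ s + leavesᵇ t
  leaves-graft leaf         i t = refl
  leaves-graft (node a l r) i t with splitAt (leavesᵇ l) i
  ... | inj₁ j = trans (cong (_+ leavesᵇ r) (leaves-graft l j t))
                       (swap-right (leavesᵇ l) (leavesᵇ t) (leavesᵇ r))
  ... | inj₂ j = trans (sym (ℕ.+-suc (leavesᵇ l) _))
                (trans (cong (leavesᵇ l +_) (leaves-graft r j t))
                       (sym (ℕ.+-assoc (leavesᵇ l) _ _)))

  graft-identityʳ : ∀ s i → graft s i leaf ≡ s
  graft-identityʳ leaf         i = refl
  graft-identityʳ (node a l r) i with splitAt (leavesᵇ l) i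
  ... | inj₁ j = cong (λ x → node a x r) (graft-identityʳ l j)
  ... | inj₂ j = cong (node a l) (graft-identityʳ r j)

  graft-sequential : ∀ s i t j u j′ → toℕ j′ ≡ toℕ i + toℕ j →
    graft (graft s i t) j′ u ≡ graft s i (graft t j u)
  graft-sequential leaf zero t j u j′ p =
    cong (λ x → graft t x u) (Fin.toℕ-injective p)
  graft-sequential (node a l r) i t j u j′ p with splitAt (leavesᵇ l) i in eq
  ... | inj₁ i₁ with splitAt (leavesᵇ (graft l i₁ t)) j′ in eq′
  ...   | inj₁ j₁ = cong (λ x → node a x r) (graft-sequential l i₁ t j u j₁
            (trans (sym (toℕ-inj₁ _ j′ eq′))
            (trans p (cong (_+ toℕ j) (toℕ-inj₁ _ i eq)))))
  ...   | inj₂ j₂ = contradiction (begin-strict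
            suc (toℕ i₁ + toℕ j)                    <⟨ s≤s (ℕ.+-monoʳ-< (toℕ i₁) (Fin.toℕ<n j)) ⟩
            suc (toℕ i₁) + leavesᵇ t                ≤⟨ ℕ.+-monoˡ-≤ (leavesᵇ t) (Fin.toℕ<n i₁) ⟩
            leavesᵇ l + leavesᵇ t                   ≡⟨ leaves-graft l i₁ t ⟨
            suc (leavesᵇ (graft l i₁ t))            ≤⟨ s≤s (ℕ.m≤m+n _ _) ⟩
            suc (leavesᵇ (graft l i₁ t) + toℕ j₂)   ≡⟨ cong suc (toℕ-inj₂ _ j′ eq′) ⟨
            suc (toℕ j′)                            ≡⟨ cong suc p ⟩
            suc (toℕ i + toℕ j)                     ≡⟨ cong (λ x → suc (x + toℕ j)) (toℕ-inj₁ _ i eq) ⟩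
            suc (toℕ i₁ + toℕ j)                    ∎) (ℕ.<-irrefl refl)
    where open ≤-Reasoning
  graft-sequential (node a l r) i t j u j′ p | inj₂ i₂ with splitAt (leavesᵇ l) j′ in eq′
  ...   | inj₁ j₁ = contradiction (begin-strict
            toℕ j₁                          <⟨ Fin.toℕ<n j₁ ⟩
            leavesᵇ l                       ≤⟨ ℕ.m≤m+n _ _ ⟩
            leavesᵇ l + toℕ i₂              ≤⟨ ℕ.m≤m+n _ _ ⟩
            leavesᵇ l + toℕ i₂ + toℕ j      ≡⟨ cong (_+ toℕ j) (toℕ-inj₂ _ i eq) ⟨
            toℕ i + toℕ j                   ≡⟨ p ⟨
            toℕ j′                          ≡⟨ toℕ-inj₁ _ j′ eq′ ⟩
            toℕ j₁                          ∎) (ℕ.<-irrefl refl)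
    where open ≤-Reasoning
  ...   | inj₂ j₂ = cong (node a l) (graft-sequential r i₂ t j u j₂
            (ℕ.+-cancelˡ-≡ (leavesᵇ l) _ _
              (trans (sym (toℕ-inj₂ _ j′ eq′))
              (trans p
              (trans (cong (_+ toℕ j) (toℕ-inj₂ _ i eq))
                     (ℕ.+-assoc (leavesᵇ l) _ _))))))

  graft-parallel : ∀ s i j t u i′ j′ → toℕ i < toℕ j → toℕ i′ ≡ toℕ i →
    suc (toℕ j′) ≡ toℕ j + leavesᵇ u →
    graft (graft s j t) i′ u ≡ graft (graft s i u) j′ t
  graft-parallel leaf zero zero t u i′ j′ () p q
  graft-parallel (node a l r) i j t u i′ j′ i<j p q
    with splitAt (leavesᵇ l) i in eqᵢ | splitAt (leavesᵇ l) j in eqⱼ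
  ... | inj₁ i₁ | inj₁ j₁ with splitAt (leavesᵇ (graft l j₁ t)) i′ in eqᵢ′
                             | splitAt (leavesᵇ (graft l i₁ u)) j′ in eqⱼ′
  ...   | inj₁ i₁′ | inj₁ j₁′ =
    cong (λ x → node a x r) (graft-parallel l i₁ j₁ t u i₁′ j₁′
      (subst₂′ (toℕ-inj₁ _ i eqᵢ) (toℕ-inj₁ _ j eqⱼ) i<j)
      (trans (sym (toℕ-inj₁ _ i′ eqᵢ′)) (trans p (toℕ-inj₁ _ i eqᵢ)))
      (trans (cong suc (sym (toℕ-inj₁ _ j′ eqⱼ′)))
      (trans q (cong (_+ leavesᵇ u) (toℕ-inj₁ _ j eqⱼ)))))
    where
    subst₂′ : ∀ {a b c d} → a ≡ b → c ≡ d → a < c → b < d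
    subst₂′ refl refl h = h
  ...   | inj₁ i₁′ | inj₂ j₂′ = contradiction (begin-strict
            toℕ j₁ + leavesᵇ u                     <⟨ ℕ.+-monoˡ-< (leavesᵇ u) (Fin.toℕ<n j₁) ⟩
            leavesᵇ l + leavesᵇ u                  ≡⟨ leaves-graft l i₁ u ⟨
            suc (leavesᵇ (graft l i₁ u))           ≤⟨ s≤s (ℕ.m≤m+n _ _) ⟩
            suc (leavesᵇ (graft l i₁ u) + toℕ j₂′) ≡⟨ cong suc (toℕ-inj₂ _ j′ eqⱼ′) ⟨
            suc (toℕ j′)                           ≡⟨ q ⟩
            toℕ j + leavesᵇ u                      ≡⟨ cong (_+ leavesᵇ u) (toℕ-inj₁ _ j eqⱼ) ⟩
            toℕ j₁ + leavesᵇ u                     ∎) (ℕ.<-irrefl refl)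
    where open ≤-Reasoning
  ...   | inj₂ i₂′ | _ = contradiction (begin-strict
            suc (toℕ i)                            ≤⟨ i<j ⟩
            toℕ j                                  ≡⟨ toℕ-inj₁ _ j eqⱼ ⟩
            toℕ j₁                                 <⟨ Fin.toℕ<n j₁ ⟩
            leavesᵇ l                              ≤⟨ ℕ.m≤m+n _ _ ⟩
            leavesᵇ l + leavesᵇ t                  ≡⟨ leaves-graft l j₁ t ⟨
            suc (leavesᵇ (graft l j₁ t))           ≤⟨ s≤s (ℕ.m≤m+n _ _) ⟩
            suc (leavesᵇ (graft l j₁ t) + toℕ i₂′) ≡⟨ cong suc (toℕ-inj₂ _ i′ eqᵢ′) ⟨
            suc (toℕ i′)                           ≡⟨ cong suc p ⟩
            suc (toℕ i)                            ∎) (ℕ.<-irrefl refl)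
    where open ≤-Reasoning
  graft-parallel (node a l r) i j t u i′ j′ i<j p q
      | inj₁ i₁ | inj₂ j₂ with splitAt (leavesᵇ l) i′ in eqᵢ′
                             | splitAt (leavesᵇ (graft l i₁ u)) j′ in eqⱼ′
  ...   | inj₁ i₁′ | inj₂ j₂′ =
    cong₂ (λ x y → node a (graft l x u) (graft r y t))
      (Fin.toℕ-injective (trans (sym (toℕ-inj₁ _ i′ eqᵢ′)) (trans p (toℕ-inj₁ _ i eqᵢ))))
      (Fin.toℕ-injective (sym (ℕ.+-cancelˡ-≡ (leavesᵇ l + leavesᵇ u) _ _ (begin-equality
        leavesᵇ l + leavesᵇ u + toℕ j₂′        ≡⟨ cong (_+ toℕ j₂′) (leaves-graft l i₁ u) ⟨
        suc (leavesᵇ (graft l i₁ u) + toℕ j₂′) ≡⟨ cong suc (toℕ-inj₂ _ j′ eqⱼ′) ⟨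
        suc (toℕ j′)                           ≡⟨ q ⟩
        toℕ j + leavesᵇ u                      ≡⟨ cong (_+ leavesᵇ u) (toℕ-inj₂ _ j eqⱼ) ⟩
        leavesᵇ l + toℕ j₂ + leavesᵇ u         ≡⟨ swap-right (leavesᵇ l) _ _ ⟩
        leavesᵇ l + leavesᵇ u + toℕ j₂         ∎))))
    where open ≤-Reasoning
  ...   | inj₁ i₁′ | inj₁ j₁′ = contradiction (begin-strict
            suc (toℕ j₁′)                          ≤⟨ Fin.toℕ<n j₁′ ⟩
            leavesᵇ (graft l i₁ u)                 <⟨ ℕ.n<1+n _ ⟩
            suc (leavesᵇ (graft l i₁ u))           ≡⟨ leaves-graft l i₁ u ⟩
            leavesᵇ l + leavesᵇ u                  ≤⟨ ℕ.+-monoˡ-≤ (leavesᵇ u) (ℕ.m≤m+n (leavesᵇ l) (toℕ j₂)) ⟩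
            leavesᵇ l + toℕ j₂ + leavesᵇ u         ≡⟨ cong (_+ leavesᵇ u) (toℕ-inj₂ _ j eqⱼ) ⟨
            toℕ j + leavesᵇ u                      ≡⟨ q ⟨
            suc (toℕ j′)                           ≡⟨ cong suc (toℕ-inj₁ _ j′ eqⱼ′) ⟩
            suc (toℕ j₁′)                          ∎) (ℕ.<-irrefl refl)
    where open ≤-Reasoning
  ...   | inj₂ i₂′ | _ = contradiction (begin-strict
            toℕ i₁              <⟨ Fin.toℕ<n i₁ ⟩
            leavesᵇ l           ≤⟨ ℕ.m≤m+n _ _ ⟩
            leavesᵇ l + toℕ i₂′ ≡⟨ toℕ-inj₂ _ i′ eqᵢ′ ⟨
            toℕ i′              ≡⟨ p ⟩
            toℕ i               ≡⟨ toℕ-inj₁ _ i eqᵢ ⟩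
            toℕ i₁              ∎) (ℕ.<-irrefl refl)
    where open ≤-Reasoning
  graft-parallel (node a l r) i j t u i′ j′ i<j p q
      | inj₂ i₂ | inj₁ j₁ = contradiction (begin-strict
            toℕ j₁             <⟨ Fin.toℕ<n j₁ ⟩
            leavesᵇ l          ≤⟨ ℕ.m≤m+n _ _ ⟩
            leavesᵇ l + toℕ i₂ ≡⟨ toℕ-inj₂ _ i eqᵢ ⟨
            toℕ i              <⟨ i<j ⟩
            toℕ j              ≡⟨ toℕ-inj₁ _ j eqⱼ ⟩
            toℕ j₁             ∎) (ℕ.<-irrefl refl)
    where open ≤-Reasoning
  graft-parallel (node a l r) i j t u i′ j′ i<j p q
      | inj₂ i₂ | inj₂ j₂ with splitAt (leavesᵇ l) i′ in eqᵢ′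
                             | splitAt (leavesᵇ l) j′ in eqⱼ′
  ...   | inj₂ i₂′ | inj₂ j₂′ =
    cong (node a l) (graft-parallel r i₂ j₂ t u i₂′ j₂′
      (ℕ.+-cancelˡ-< (leavesᵇ l) _ _ (begin-strict
        leavesᵇ l + toℕ i₂ ≡⟨ toℕ-inj₂ _ i eqᵢ ⟨
        toℕ i              <⟨ i<j ⟩
        toℕ j              ≡⟨ toℕ-inj₂ _ j eqⱼ ⟩
        leavesᵇ l + toℕ j₂ ∎))
      (ℕ.+-cancelˡ-≡ (leavesᵇ l) _ _ (begin-equality
        leavesᵇ l + toℕ i₂′ ≡⟨ toℕ-inj₂ _ i′ eqᵢ′ ⟨
        toℕ i′              ≡⟨ p ⟩
        toℕ i               ≡⟨ toℕ-inj₂ _ i eqᵢ ⟩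
        leavesᵇ l + toℕ i₂  ∎))
      (ℕ.+-cancelˡ-≡ (leavesᵇ l) _ _ (begin-equality
        leavesᵇ l + suc (toℕ j₂′)        ≡⟨ ℕ.+-suc (leavesᵇ l) _ ⟩
        suc (leavesᵇ l + toℕ j₂′)        ≡⟨ cong suc (toℕ-inj₂ _ j′ eqⱼ′) ⟨
        suc (toℕ j′)                     ≡⟨ q ⟩
        toℕ j + leavesᵇ u                ≡⟨ cong (_+ leavesᵇ u) (toℕ-inj₂ _ j eqⱼ) ⟩
        leavesᵇ l + toℕ j₂ + leavesᵇ u   ≡⟨ ℕ.+-assoc (leavesᵇ l) _ _ ⟩
        leavesᵇ l + (toℕ j₂ + leavesᵇ u) ∎)))
    where open ≤-Reasoning
  ...   | inj₂ i₂′ | inj₁ j₁′ = contradiction (begin-strict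
            suc (toℕ j₁′)      ≤⟨ Fin.toℕ<n j₁′ ⟩
            leavesᵇ l          ≤⟨ ℕ.m≤m+n _ _ ⟩
            leavesᵇ l + toℕ i₂ ≡⟨ toℕ-inj₂ _ i eqᵢ ⟨
            toℕ i              <⟨ i<j ⟩
            toℕ j              ≤⟨ ℕ.m≤m+n _ _ ⟩
            toℕ j + leavesᵇ u  ≡⟨ q ⟨
            suc (toℕ j′)       ≡⟨ cong suc (toℕ-inj₁ _ j′ eqⱼ′) ⟩
            suc (toℕ j₁′)      ∎) (ℕ.<-irrefl refl)
    where open ≤-Reasoning
  ...   | inj₁ i₁′ | _ = contradiction (begin-strict
            toℕ i₁′            <⟨ Fin.toℕ<n i₁′ ⟩
            leavesᵇ l          ≤⟨ ℕ.m≤m+n _ _ ⟩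
            leavesᵇ l + toℕ i₂ ≡⟨ toℕ-inj₂ _ i eqᵢ ⟨
            toℕ i              ≡⟨ p ⟨
            toℕ i′             ≡⟨ toℕ-inj₁ _ i′ eqᵢ′ ⟩
            toℕ i₁′            ∎) (ℕ.<-irrefl refl)
    where open ≤-Reasoning

record BinaryTreeOfArity (G : Set) (n : ℕ) : Set where
  constructor mkBinaryTree
  field
    tree   : BinaryTree G
    .arity : leavesᵇ tree ≡ n

module _ {G : Set} (_≟_ : DecidableEquality G) where
  open BinaryTreeOfArity

  private
    ext : ∀ {n} {s t : BinaryTreeOfArity G n} → tree s ≡ tree t → s ≡ t
    ext refl = refl

    compArity : ∀ {k n m} (s t : BinaryTree G) .(p : leavesᵇ s ≡ n) (i : Fin n) →
      suc k ≡ n + m → leavesᵇ s ≡ n → leavesᵇ t ≡ m →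
      leavesᵇ (graft s (Fin.cast (sym p) i) t) ≡ k
    compArity s t p i e refl refl =
      ℕ.suc-injective (trans (leaves-graft s _ t) (sym e))

  freeRawSetOperad : RawSetOperad
  freeRawSetOperad = record
    { Op   = BinaryTreeOfArity G
    ; _≟_  = λ s t → map′ ext (cong tree) (binaryTree-≟ _≟_ (tree s) (tree t))
    ; unit = mkBinaryTree leaf refl
    ; comp = λ { e (mkBinaryTree s p) i (mkBinaryTree t q) →
        mkBinaryTree (graft s (Fin.cast (sym p) i) t) (compArity s t p i e p q) }
    }

  freeIsSetOperad : IsSetOperad freeRawSetOperad
  freeIsSetOperad = record
    { identityˡ  = λ _ _ _ → refl
    ; identityʳ  = λ _ x _ → ext (graft-identityʳ (tree x) _)
    ; sequential = λ { _ _ _ _ x i y j z j′ p →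
        ext (graft-sequential (tree x) _ (tree y) _ (tree z) _
          (trans (Fin.toℕ-cast _ j′)
          (trans p (sym (cong₂ _+_ (Fin.toℕ-cast _ i) (Fin.toℕ-cast _ j)))))) }
    ; parallel   = λ { _ _ _ _ x i j y (mkBinaryTree u r) i′ j′ i<j p q →
        ext (graft-parallel (tree x) _ _ (tree y) u _ _
          (lt i j i<j)
          (trans (Fin.toℕ-cast _ i′) (trans p (sym (Fin.toℕ-cast _ i))))
          (trans (cong suc (Fin.toℕ-cast _ j′))
          (trans q (sym (cong₂ _+_ (Fin.toℕ-cast _ j) (recompute (_ ℕ.≟ _) r)))))) }
    }
    where
    lt : ∀ {m n} .{e e′ : m ≡ n} (i j : Fin m) → toℕ i < toℕ j →
      toℕ (Fin.cast e i) < toℕ (Fin.cast e′ j)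
    lt {e = e} {e′} i j h
      rewrite Fin.toℕ-cast e i | Fin.toℕ-cast e′ j = h

  corolla : G → BinaryTreeOfArity G 2
  corolla a = mkBinaryTree (node a leaf leaf) refl

data LabeledTree (A : Set) : Set where
  leaf : LabeledTree A
  node : A → List (LabeledTree A) → LabeledTree A

module _ {A : Set} where

  leaves  : LabeledTree A → ℕ
  leaves* : List (LabeledTree A) → ℕ

  leaves leaf        = 1
  leaves (node _ ts) = leaves* ts

  leaves* []       = 0
  leaves* (t ∷ ts) = leaves t + leaves* ts

  data Schröder : LabeledTree A → Set where
    leaf : Schröder leaf
    node : ∀ {a ts} → 2 ≤ length ts → All Schröder ts → Schröder (node a ts)

  data RootLabelDiffersFrom (a : A) : LabeledTree A → Set where
    leaf : RootLabelDiffersFrom a leaf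
    node : ∀ {b ts} → a ≢ b → RootLabelDiffersFrom a (node b ts)

  data Alternating : LabeledTree A → Set where
    leaf : Alternating leaf
    node : ∀ {a ts} → All (RootLabelDiffersFrom a) ts → All Alternating ts →
           Alternating (node a ts)

  labeledTree-≟  : DecidableEquality A → DecidableEquality (LabeledTree A)
  labeledTree*-≟ : DecidableEquality A → DecidableEquality (List (LabeledTree A))

  labeledTree-≟ _≟_ leaf        leaf        = yes refl
  labeledTree-≟ _≟_ leaf        (node _ _)  = no λ ()
  labeledTree-≟ _≟_ (node _ _)  leaf        = no λ ()
  labeledTree-≟ _≟_ (node a ts) (node b us) =
    map′ (λ { (refl , refl) → refl }) (λ { refl → refl , refl })
      ((a ≟ b) ×-dec labeledTree*-≟ _≟_ ts us)

  labeledTree*-≟ _≟_ []       []       = yes refl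
  labeledTree*-≟ _≟_ []       (_ ∷ _)  = no λ ()
  labeledTree*-≟ _≟_ (_ ∷ _)  []       = no λ ()
  labeledTree*-≟ _≟_ (t ∷ ts) (u ∷ us) =
    map′ (λ { (refl , refl) → refl }) (λ { refl → refl , refl })
      (labeledTree-≟ _≟_ t u ×-dec labeledTree*-≟ _≟_ ts us)

module _ {A : Set} (_≟_ : DecidableEquality A) where

  -- attach a t lists the children that take the place of a leaf x whose
  -- father is labeled a when t is grafted on x: t itself, or the children of
  -- the root of t when the edge above that root is contracted.

  attach : A → LabeledTree A → List (LabeledTree A)
  attach a leaf        = leaf ∷ []
  attach a (node b us) with a ≟ b
  ... | yes _ = us
  ... | no  _ = node b us ∷ []

  graftContract       : (s : LabeledTree A) → Fin (leaves s) → LabeledTree A → LabeledTree A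
  graftContractBelow  : A → (s : LabeledTree A) → Fin (leaves s) → LabeledTree A → List (LabeledTree A)
  graftContractBelow* : A → (ss : List (LabeledTree A)) → Fin (leaves* ss) → LabeledTree A → List (LabeledTree A)

  graftContract leaf        i t = t
  graftContract (node a ss) i t = node a (graftContractBelow* a ss i t)

  graftContractBelow a leaf        i t = attach a t
  graftContractBelow a (node b ss) i t = node b (graftContractBelow* b ss i t) ∷ []

  graftContractBelow* a (s ∷ ss) i t with splitAt (leaves s) i
  ... | inj₁ j = graftContractBelow a s j t ++ ss
  ... | inj₂ j = s ∷ graftContractBelow* a ss j t

  private
    leaves*-++ : ∀ (ts us : List (LabeledTree A)) →
      leaves* (ts ++ us) ≡ leaves* ts + leaves* us
    leaves*-++ []       us = refl
    leaves*-++ (t ∷ ts) us =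
      trans (cong (leaves t +_) (leaves*-++ ts us)) (sym (ℕ.+-assoc (leaves t) _ _))

    leaves*-attach : ∀ a t → leaves* (attach a t) ≡ leaves t
    leaves*-attach a leaf        = refl
    leaves*-attach a (node b us) with a ≟ b
    ... | yes _ = refl
    ... | no  _ = ℕ.+-identityʳ _

    length-attach : ∀ a {t} → Schröder t → 1 ≤ length (attach a t)
    length-attach a leaf = ℕ.≤-refl
    length-attach a (node {b} h _) with a ≟ b
    ... | yes _ = ℕ.<⇒≤ h
    ... | no  _ = ℕ.≤-refl

    Schröder-attach : ∀ a {t} → Schröder t → All Schröder (attach a t)
    Schröder-attach a leaf = leaf ∷ []
    Schröder-attach a (node {b} h hs) with a ≟ b
    ... | yes _ = hs
    ... | no  _ = node h hs ∷ []

    Alternating-attach : ∀ a {t} → Alternating t → All Alternating (attach a t)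
    Alternating-attach a leaf = leaf ∷ []
    Alternating-attach a (node {b} d hs) with a ≟ b
    ... | yes _ = hs
    ... | no  _ = node d hs ∷ []

    Differs-attach : ∀ a {t} → Alternating t → All (RootLabelDiffersFrom a) (attach a t)
    Differs-attach a leaf = leaf ∷ []
    Differs-attach a (node {b} d hs) with a ≟ b
    ... | yes refl = d
    ... | no  a≢b  = node a≢b ∷ []

  leaves-graftContract : ∀ s i t →
    suc (leaves (graftContract s i t)) ≡ leaves s + leaves t
  leaves-graftContractBelow : ∀ a s i t →
    suc (leaves* (graftContractBelow a s i t)) ≡ leaves s + leaves t
  leaves-graftContractBelow* : ∀ a ss i t →
    suc (leaves* (graftContractBelow* a ss i t)) ≡ leaves* ss + leaves t

  leaves-graftContract leaf        i t = refl
  leaves-graftContract (node a ss) i t = leaves-graftContractBelow* a ss i t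

  leaves-graftContractBelow a leaf        i t = cong suc (leaves*-attach a t)
  leaves-graftContractBelow a (node b ss) i t =
    trans (cong suc (ℕ.+-identityʳ _)) (leaves-graftContractBelow* b ss i t)

  leaves-graftContractBelow* a (s ∷ ss) i t with splitAt (leaves s) i
  ... | inj₁ j = trans (cong suc (leaves*-++ (graftContractBelow a s j t) ss))
                (trans (cong (_+ leaves* ss) (leaves-graftContractBelow a s j t))
                       (xy∙z≈xz∙y (leaves s) _ _))
    where open CommutativeSemigroupProperties ℕ.+-commutativeSemigroup
  ... | inj₂ j = trans (sym (ℕ.+-suc (leaves s) _))
                (trans (cong (leaves s +_) (leaves-graftContractBelow* a ss j t))
                       (sym (ℕ.+-assoc (leaves s) _ _)))

  length-graftContractBelow : ∀ a s i {t} → Schröder t →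
    1 ≤ length (graftContractBelow a s i t)
  length-graftContractBelow a leaf        i ht = length-attach a ht
  length-graftContractBelow a (node b ss) i ht = ℕ.≤-refl

  length-graftContractBelow* : ∀ a ss i {t} → Schröder t →
    length ss ≤ length (graftContractBelow* a ss i t)
  length-graftContractBelow* a (s ∷ ss) i {t} ht with splitAt (leaves s) i
  ... | inj₁ j = subst (suc (length ss) ≤_) (sym (length-++ (graftContractBelow a s j t)))
                   (ℕ.+-monoˡ-≤ (length ss) (length-graftContractBelow a s j ht))
  ... | inj₂ j = s≤s (length-graftContractBelow* a ss j ht)

  Schröder-graftContract : ∀ {s} i {t} → Schröder s → Schröder t →
    Schröder (graftContract s i t)
  Schröder-graftContractBelow : ∀ a {s} i {t} → Schröder s → Schröder t →
    All Schröder (graftContractBelow a s i t)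
  Schröder-graftContractBelow* : ∀ a {ss} i {t} → All Schröder ss → Schröder t →
    All Schröder (graftContractBelow* a ss i t)

  Schröder-graftContract i leaf                ht = ht
  Schröder-graftContract i (node {a} {ss} h hs) ht =
    node (ℕ.≤-trans h (length-graftContractBelow* a ss i ht))
         (Schröder-graftContractBelow* a i hs ht)

  Schröder-graftContractBelow a i leaf                ht = Schröder-attach a ht
  Schröder-graftContractBelow a i (node {b} {ss} h hs) ht =
    node (ℕ.≤-trans h (length-graftContractBelow* b ss i ht))
         (Schröder-graftContractBelow* b i hs ht) ∷ []

  Schröder-graftContractBelow* a {s ∷ ss} i (h ∷ hs) ht with splitAt (leaves s) i
  ... | inj₁ j = ++⁺ (Schröder-graftContractBelow a j h ht) hs
  ... | inj₂ j = h ∷ Schröder-graftContractBelow* a j hs ht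

  Differs-graftContractBelow : ∀ a s i {t} → RootLabelDiffersFrom a s → Alternating t →
    All (RootLabelDiffersFrom a) (graftContractBelow a s i t)
  Differs-graftContractBelow a leaf        i d          ht = Differs-attach a ht
  Differs-graftContractBelow a (node b ss) i (node a≢b) ht = node a≢b ∷ []

  Differs-graftContractBelow* : ∀ a ss i {t} → All (RootLabelDiffersFrom a) ss → Alternating t →
    All (RootLabelDiffersFrom a) (graftContractBelow* a ss i t)
  Differs-graftContractBelow* a (s ∷ ss) i (d ∷ ds) ht with splitAt (leaves s) i
  ... | inj₁ j = ++⁺ (Differs-graftContractBelow a s j d ht) ds
  ... | inj₂ j = d ∷ Differs-graftContractBelow* a ss j ds ht

  Alternating-graftContract : ∀ {s} i {t} → Alternating s → Alternating t →
    Alternating (graftContract s i t)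
  Alternating-graftContractBelow : ∀ a {s} i {t} → Alternating s → Alternating t →
    All Alternating (graftContractBelow a s i t)
  Alternating-graftContractBelow* : ∀ a {ss} i {t} → All Alternating ss → Alternating t →
    All Alternating (graftContractBelow* a ss i t)

  Alternating-graftContract i leaf                 ht = ht
  Alternating-graftContract i (node {a} {ss} ds hs) ht =
    node (Differs-graftContractBelow* a ss i ds ht)
         (Alternating-graftContractBelow* a i hs ht)

  Alternating-graftContractBelow a i leaf                 ht = Alternating-attach a ht
  Alternating-graftContractBelow a i (node {b} {ss} ds hs) ht =
    node (Differs-graftContractBelow* b ss i ds ht)
         (Alternating-graftContractBelow* b i hs ht) ∷ []

  Alternating-graftContractBelow* a {s ∷ ss} i (h ∷ hs) ht with splitAt (leaves s) i
  ... | inj₁ j = ++⁺ (Alternating-graftContractBelow a j h ht) hs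
  ... | inj₂ j = h ∷ Alternating-graftContractBelow* a j hs ht

record AlternatingSchröderTree (γ n : ℕ) : Set where
  constructor mkAlternatingSchröderTree
  field
    tree         : LabeledTree (Fin γ)
    .schröder    : Schröder tree
    .alternating : Alternating tree
    .arity       : leaves tree ≡ n

module _ (γ : ℕ) where
  open AlternatingSchröderTree

  private
    ext : ∀ {n} {s t : AlternatingSchröderTree γ n} → tree s ≡ tree t → s ≡ t
    ext refl = refl

    compArity : ∀ {k n m} (s t : LabeledTree (Fin γ)) .(p : leaves s ≡ n) (i : Fin n) →
      suc k ≡ n + m → leaves s ≡ n → leaves t ≡ m →
      leaves (graftContract Fin._≟_ s (Fin.cast (sym p) i) t) ≡ k
    compArity s t p i e refl refl =
      ℕ.suc-injective (trans (leaves-graftContract Fin._≟_ s _ t) (sym e))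

  alternatingSchröderRawSetOperad : RawSetOperad
  alternatingSchröderRawSetOperad = record
    { Op   = AlternatingSchröderTree γ
    ; _≟_  = λ s t → map′ ext (cong tree) (labeledTree-≟ Fin._≟_ (tree s) (tree t))
    ; unit = mkAlternatingSchröderTree leaf leaf leaf refl
    ; comp = λ { e (mkAlternatingSchröderTree s hs as p) i (mkAlternatingSchröderTree t ht at q) →
        mkAlternatingSchröderTree
          (graftContract Fin._≟_ s (Fin.cast (sym p) i) t)
          (Schröder-graftContract Fin._≟_ (Fin.cast (sym p) i) hs ht)
          (Alternating-graftContract Fin._≟_ (Fin.cast (sym p) i) as at)
          (compArity s t p i e p q) }
    }

module Linear {c ℓ} (K : CommutativeRing c ℓ) where

  private
    module K where
      open CommutativeRing K public
      open RingProperties (CommutativeRing.ring K) public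
      open CommutativeSemigroupProperties +-commutativeSemigroup public
        using (interchange)
      open CommutativeSemigroupProperties *-commutativeSemigroup public
        using (x∙yz≈y∙xz)
    open K using (_≈_; 0#; 1#)

  record RawOperad m ℓm : Set (c ⊔ ℓ ⊔ lsuc (m ⊔ ℓm)) where
    field
      space : ℕ → LeftModule K.ring m ℓm

    module Space {n : ℕ} = LeftModule (space n)

    Op : ℕ → Set m
    Op n = LeftModule.Carrierᴹ (space n)

    field
      unit : Op 1
      comp : ∀ {k n m} → .(suc k ≡ n + m) → Op n → Fin n → Op m → Op k

  record IsOperad {m ℓm} (P : RawOperad m ℓm) : Set (c ⊔ ℓ ⊔ m ⊔ ℓm) where
    open RawOperad P
    open Space
    field
      comp-cong : ∀ {k n m} .(e : suc k ≡ n + m) {x x′ : Op n} (i : Fin n) {y y′ : Op m} →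
        x ≈ᴹ x′ → y ≈ᴹ y′ → comp e x i y ≈ᴹ comp e x′ i y′
      comp-+ˡ : ∀ {k n m} .(e : suc k ≡ n + m) (x x′ : Op n) (i : Fin n) (y : Op m) →
        comp e (x +ᴹ x′) i y ≈ᴹ comp e x i y +ᴹ comp e x′ i y
      comp-+ʳ : ∀ {k n m} .(e : suc k ≡ n + m) (x : Op n) (i : Fin n) (y y′ : Op m) →
        comp e x i (y +ᴹ y′) ≈ᴹ comp e x i y +ᴹ comp e x i y′
      comp-*ˡ : ∀ {k n m} .(e : suc k ≡ n + m) a (x : Op n) (i : Fin n) (y : Op m) →
        comp e (a *ₗ x) i y ≈ᴹ a *ₗ comp e x i y
      comp-*ʳ : ∀ {k n m} .(e : suc k ≡ n + m) a (x : Op n) (i : Fin n) (y : Op m) →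
        comp e x i (a *ₗ y) ≈ᴹ a *ₗ comp e x i y
      identityˡ : ∀ {n} .(e : suc n ≡ 1 + n) (i : Fin 1) (x : Op n) →
        comp e unit i x ≈ᴹ x
      identityʳ : ∀ {n} .(e : suc n ≡ n + 1) (x : Op n) (i : Fin n) →
        comp e x i unit ≈ᴹ x
      sequential : ∀ {n m l k₁ k₂ k}
        .(e₁ : suc k₁ ≡ n + m) .(e₁′ : suc k ≡ k₁ + l)
        .(e₂ : suc k₂ ≡ m + l) .(e₂′ : suc k ≡ n + k₂)
        (x : Op n) (i : Fin n) (y : Op m) (j : Fin m) (z : Op l) (j′ : Fin k₁) →
        toℕ j′ ≡ toℕ i + toℕ j →
        comp e₁′ (comp e₁ x i y) j′ z ≈ᴹ comp e₂′ x i (comp e₂ y j z)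
      parallel : ∀ {n m l k₁ k₂ k}
        .(e₁ : suc k₁ ≡ n + m) .(e₁′ : suc k ≡ k₁ + l)
        .(e₂ : suc k₂ ≡ n + l) .(e₂′ : suc k ≡ k₂ + m)
        (x : Op n) (i j : Fin n) (y : Op m) (z : Op l) (i′ : Fin k₁) (j′ : Fin k₂) →
        toℕ i < toℕ j → toℕ i′ ≡ toℕ i → suc (toℕ j′) ≡ toℕ j + l →
        comp e₁′ (comp e₁ x j y) i′ z ≈ᴹ comp e₂′ (comp e₂ x i z) j′ y

  record Operad m ℓm : Set (c ⊔ ℓ ⊔ lsuc (m ⊔ ℓm)) where
    field
      rawOperad : RawOperad m ℓm
      isOperad  : IsOperad rawOperad
    open RawOperad rawOperad public
    open IsOperad isOperad public

  infix 4 _≅_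

  record _≅_ {m ℓm m′ ℓm′} (P : RawOperad m ℓm) (Q : RawOperad m′ ℓm′) :
             Set (c ⊔ m ⊔ ℓm ⊔ m′ ⊔ ℓm′) where
    private
      module P = RawOperad P
      module Q = RawOperad Q
    open Q.Space using (_≈ᴹ_)
    field
      to     : ∀ {n} → P.Op n → Q.Op n
      linear : ∀ n → LeftModuleMorphisms.IsLeftModuleIsomorphism
                 (LeftModule.rawLeftModule (P.space n)) (LeftModule.rawLeftModule (Q.space n)) to
      unit   : to P.unit ≈ᴹ Q.unit
      comp   : ∀ {k n m} .(e : suc k ≡ n + m) (x : P.Op n) (i : Fin n) (y : P.Op m) →
               to (P.comp e x i y) ≈ᴹ Q.comp e (to x) i (to y)

  FormalSum : Set → Set c
  FormalSum X = List (K.Carrier × X)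

  basis : ∀ {X} → X → FormalSum X
  basis x = (1# , x) ∷ []

  scale : ∀ {X} → K.Carrier → FormalSum X → FormalSum X
  scale a = map λ { (b , x) → a K.* b , x }

  sum : ∀ {X} → (X → K.Carrier) → FormalSum X → K.Carrier
  sum F []            = 0#
  sum F ((a , x) ∷ f) = a K.* F x K.+ sum F f

  bilinear : ∀ {X Y Z} → (X → Y → Z) → FormalSum X → FormalSum Y → FormalSum Z
  bilinear H []            g = []
  bilinear H ((a , x) ∷ f) g =
    map (λ { (b , y) → a K.* b , H x y }) g ++ bilinear H f g

  module _ {X : Set} where

    sum-cong : ∀ {F G : X → K.Carrier} → (∀ x → F x ≈ G x) → ∀ f → sum F f ≈ sum G f
    sum-cong h []            = K.refl
    sum-cong h ((a , x) ∷ f) = K.+-cong (K.*-congˡ (h x)) (sum-cong h f)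

    sum-++ : ∀ F (f g : FormalSum X) → sum F (f ++ g) ≈ sum F f K.+ sum F g
    sum-++ F []            g = K.sym (K.+-identityˡ _)
    sum-++ F ((a , x) ∷ f) g =
      K.trans (K.+-congˡ (sum-++ F f g)) (K.sym (K.+-assoc _ _ _))

    sum-scale : ∀ F a (f : FormalSum X) → sum F (scale a f) ≈ a K.* sum F f
    sum-scale F a []            = K.sym (K.zeroʳ a)
    sum-scale F a ((b , x) ∷ f) =
      K.trans (K.+-cong (K.*-assoc _ _ _) (sum-scale F a f)) (K.sym (K.distribˡ _ _ _))

    sum-0 : (f : FormalSum X) → sum (λ _ → 0#) f ≈ 0#
    sum-0 []            = K.refl
    sum-0 ((a , x) ∷ f) = K.trans (K.+-cong (K.zeroʳ a) (sum-0 f)) (K.+-identityˡ _)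

    sum-+ : ∀ F G (f : FormalSum X) → sum (λ x → F x K.+ G x) f ≈ sum F f K.+ sum G f
    sum-+ F G []            = K.sym (K.+-identityˡ _)
    sum-+ F G ((a , x) ∷ f) =
      K.trans (K.+-cong (K.distribˡ a _ _) (sum-+ F G f)) (K.interchange _ _ _ _)

    sum-* : ∀ a F (f : FormalSum X) → sum (λ x → a K.* F x) f ≈ a K.* sum F f
    sum-* a F []            = K.sym (K.zeroʳ a)
    sum-* a F ((b , x) ∷ f) =
      K.trans (K.+-cong (K.x∙yz≈y∙xz b a _) (sum-* a F f)) (K.sym (K.distribˡ _ _ _))

    sum-basis : ∀ F (x : X) → sum F (basis x) ≈ F x
    sum-basis F x = K.trans (K.+-identityʳ _) (K.*-identityˡ _)

  sum-swap : ∀ {X Y : Set} (F : X → Y → K.Carrier) f g →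
    sum (λ x → sum (F x) g) f ≈ sum (λ y → sum (λ x → F x y) f) g
  sum-swap F []            g = K.sym (sum-0 g)
  sum-swap F ((a , x) ∷ f) g = begin
    a K.* sum (F x) g K.+ sum (λ x → sum (F x) g) f
      ≈⟨ K.+-cong (K.sym (sum-* a (F x) g)) (sum-swap F f g) ⟩
    sum (λ y → a K.* F x y) g K.+ sum (λ y → sum (λ x → F x y) f) g
      ≈⟨ sum-+ _ _ g ⟨
    sum (λ y → a K.* F x y K.+ sum (λ x → F x y) f) g ∎
    where open SetoidReasoning K.setoid

  sum-bilinear : ∀ {X Y Z : Set} F (H : X → Y → Z) f g →
    sum F (bilinear H f g) ≈ sum (λ x → sum (λ y → F (H x y)) g) f
  sum-bilinear F H []            g = K.refl
  sum-bilinear F H ((a , x) ∷ f) g =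
    K.trans (sum-++ F (map _ g) (bilinear H f g)) (K.+-cong (row g) (sum-bilinear F H f g))
    where
    row : ∀ g → sum F (map (λ { (b , y) → a K.* b , H x y }) g) ≈ a K.* sum (λ y → F (H x y)) g
    row []            = K.sym (K.zeroʳ a)
    row ((b , y) ∷ g) =
      K.trans (K.+-cong (K.*-assoc _ _ _) (row g)) (K.sym (K.distribˡ _ _ _))

  module FormalSums {X : Set} (_≟_ : DecidableEquality X) where

    δ : X → X → K.Carrier
    δ x y = if does (x ≟ y) then 1# else 0#

    coefficient : FormalSum X → X → K.Carrier
    coefficient f x = sum (δ x) f

    infix 4 _≋_

    record _≋_ (f g : FormalSum X) : Set ℓ where
      constructor mk≋
      field coefficients : ∀ x → coefficient f x ≈ coefficient g x
    open _≋_ public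

    private
      remove : X → FormalSum X → FormalSum X
      remove x []            = []
      remove x ((a , y) ∷ f) with x ≟ y
      ... | yes _ = remove x f
      ... | no  _ = (a , y) ∷ remove x f

      length-remove : ∀ x f → length (remove x f) ≤ length f
      length-remove x []            = z≤n
      length-remove x ((a , y) ∷ f) with x ≟ y
      ... | yes _ = ℕ.m≤n⇒m≤1+n (length-remove x f)
      ... | no  _ = s≤s (length-remove x f)

      length-remove-head : ∀ a x f → length (remove x ((a , x) ∷ f)) ≤ length f
      length-remove-head a x f with x ≟ x
      ... | yes _  = length-remove x f
      ... | no x≢x = contradiction refl x≢x

      sum-remove : ∀ F x (f : FormalSum X) → sum F f ≈ coefficient f x K.* F x K.+ sum F (remove x f)
      sum-remove F x []            = K.sym (K.trans (K.+-congʳ (K.zeroˡ _)) (K.+-identityˡ _))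
      sum-remove F x ((a , y) ∷ f) with x ≟ y
      ... | yes refl = begin
        a K.* F x K.+ sum F f
          ≈⟨ K.+-cong (K.*-congʳ (K.sym (K.*-identityʳ a))) (sum-remove F x f) ⟩
        (a K.* 1#) K.* F x K.+ (coefficient f x K.* F x K.+ sum F (remove x f))
          ≈⟨ K.+-assoc _ _ _ ⟨
        (a K.* 1#) K.* F x K.+ coefficient f x K.* F x K.+ sum F (remove x f)
          ≈⟨ K.+-congʳ (K.distribʳ _ _ _) ⟨
        (a K.* 1# K.+ coefficient f x) K.* F x K.+ sum F (remove x f) ∎
        where open SetoidReasoning K.setoid
      ... | no _ = begin
        a K.* F y K.+ sum F f
          ≈⟨ K.+-congˡ (sum-remove F x f) ⟩
        a K.* F y K.+ (coefficient f x K.* F x K.+ sum F (remove x f))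
          ≈⟨ x∙yz≈y∙xz _ _ _ ⟩
        coefficient f x K.* F x K.+ (a K.* F y K.+ sum F (remove x f))
          ≈⟨ K.+-congʳ (K.*-congʳ (K.trans (K.+-congʳ (K.zeroʳ a)) (K.+-identityˡ _))) ⟨
        (a K.* 0# K.+ coefficient f x) K.* F x K.+ (a K.* F y K.+ sum F (remove x f)) ∎
        where
        open SetoidReasoning K.setoid
        open CommutativeSemigroupProperties K.+-commutativeSemigroup using (x∙yz≈y∙xz)

      sum-vanishes : ∀ n F (f : FormalSum X) → length f ≤ n → (∀ x → coefficient f x ≈ 0#) → sum F f ≈ 0#
      sum-vanishes n       F []                _       z = K.refl
      sum-vanishes (suc n) F f@((a , x) ∷ f′) (s≤s h) z =
        K.trans (without F)
          (sum-vanishes n F (remove x f)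
            (ℕ.≤-trans (length-remove-head a x f′) h)
            (λ y → K.trans (K.sym (without (δ y))) (z y)))
        where
        without : ∀ F → sum F f ≈ sum F (remove x f)
        without F = K.trans (sum-remove F x f)
          (K.trans (K.+-congʳ (K.trans (K.*-congʳ (z x)) (K.zeroˡ _))) (K.+-identityˡ _))

      sum-neg : ∀ F (f : FormalSum X) → sum F (scale (K.- 1#) f) ≈ K.- sum F f
      sum-neg F f = K.trans (sum-scale F (K.- 1#) f) (K.-1*x≈-x _)

    sum-resp-≋ : ∀ F {f g} → f ≋ g → sum F f ≈ sum F g
    sum-resp-≋ F {f} {g} f≋g = K.x∙y⁻¹≈ε⇒x≈y _ _ (begin
      sum F f K.- sum F g                   ≈⟨ K.+-congˡ (sum-neg F g) ⟨
      sum F f K.+ sum F (scale (K.- 1#) g)  ≈⟨ sum-++ F f _ ⟨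
      sum F (f ++ scale (K.- 1#) g)         ≈⟨ sum-vanishes _ F (f ++ scale (K.- 1#) g) ℕ.≤-refl zeros ⟩
      0#                                    ∎)
      where
      open SetoidReasoning K.setoid
      zeros : ∀ x → coefficient (f ++ scale (K.- 1#) g) x ≈ 0#
      zeros x = begin
        coefficient (f ++ scale (K.- 1#) g) x            ≈⟨ sum-++ (δ x) f _ ⟩
        coefficient f x K.+ coefficient (scale (K.- 1#) g) x ≈⟨ K.+-cong (coefficients f≋g x) (sum-neg (δ x) g) ⟩
        coefficient g x K.- coefficient g x              ≈⟨ K.-‿inverseʳ _ ⟩
        0#                                               ∎

    freeModule : LeftModule K.ring c ℓ
    freeModule = record
      { Carrierᴹ = FormalSum X
      ; _≈ᴹ_     = _≋_
      ; _+ᴹ_     = _++_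
      ; _*ₗ_     = scale
      ; 0ᴹ       = []
      ; -ᴹ_      = scale (K.- 1#)
      ; isLeftModule = record
        { isLeftSemimodule = record
          { +ᴹ-isCommutativeMonoid = record
            { isMonoid = record
              { isSemigroup = record
                { isMagma = record
                  { isEquivalence = record
                    { refl  = mk≋ λ _ → K.refl
                    ; sym   = λ p → mk≋ λ x → K.sym (coefficients p x)
                    ; trans = λ p q → mk≋ λ x → K.trans (coefficients p x) (coefficients q x)
                    }
                  ; ∙-cong = λ {f} {f′} {g} {g′} p q → mk≋ λ x →
                      via (sum-++ (δ x) f g) (K.+-cong (coefficients p x) (coefficients q x))
                          (sum-++ (δ x) f′ g′)
                  }
                ; assoc = λ f g h → mk≋ λ x →
                    via (K.trans (sum-++ (δ x) (f ++ g) h) (K.+-congʳ (sum-++ (δ x) f g)))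
                        (K.+-assoc _ _ _)
                        (K.trans (sum-++ (δ x) f (g ++ h)) (K.+-congˡ (sum-++ (δ x) g h)))
                }
              ; identity = (λ f → mk≋ λ _ → K.refl)
                         , (λ f → mk≋ λ x → K.trans (sum-++ (δ x) f []) (K.+-identityʳ _))
              }
            ; comm = λ f g → mk≋ λ x →
                via (sum-++ (δ x) f g) (K.+-comm _ _) (sum-++ (δ x) g f)
            }
          ; isPreleftSemimodule = record
            { *ₗ-cong = λ {a} {b} {f} {g} p q → mk≋ λ x →
                via (sum-scale (δ x) a f) (K.*-cong p (coefficients q x)) (sum-scale (δ x) b g)
            ; *ₗ-zeroˡ = λ f → mk≋ λ x → K.trans (sum-scale (δ x) 0# f) (K.zeroˡ _)
            ; *ₗ-distribʳ = λ f a b → mk≋ λ x →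
                via (sum-scale (δ x) (a K.+ b) f) (K.distribʳ _ _ _)
                    (K.trans (sum-++ (δ x) (scale a f) (scale b f))
                             (K.+-cong (sum-scale (δ x) a f) (sum-scale (δ x) b f)))
            ; *ₗ-identityˡ = λ f → mk≋ λ x → K.trans (sum-scale (δ x) 1# f) (K.*-identityˡ _)
            ; *ₗ-assoc = λ a b f → mk≋ λ x →
                via (sum-scale (δ x) (a K.* b) f) (K.*-assoc _ _ _)
                    (K.trans (sum-scale (δ x) a (scale b f)) (K.*-congˡ (sum-scale (δ x) b f)))
            ; *ₗ-zeroʳ = λ a → mk≋ λ _ → K.refl
            ; *ₗ-distribˡ = λ a f g → mk≋ λ x →
                via (K.trans (sum-scale (δ x) a (f ++ g)) (K.*-congˡ (sum-++ (δ x) f g)))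
                    (K.distribˡ _ _ _)
                    (K.trans (sum-++ (δ x) (scale a f) (scale a g))
                             (K.+-cong (sum-scale (δ x) a f) (sum-scale (δ x) a g)))
            }
          }
        ; -ᴹ‿cong = λ {f} {g} p → mk≋ λ x →
            via (sum-neg (δ x) f) (K.-‿cong (coefficients p x)) (sum-neg (δ x) g)
        ; -ᴹ‿inverse =
            (λ f → mk≋ λ x → K.trans (sum-++ (δ x) (scale (K.- 1#) f) f)
              (K.trans (K.+-congʳ (sum-neg (δ x) f)) (K.-‿inverseˡ _)))
          , (λ f → mk≋ λ x → K.trans (sum-++ (δ x) f (scale (K.- 1#) f))
              (K.trans (K.+-congˡ (sum-neg (δ x) f)) (K.-‿inverseʳ _)))
        }
      }
      where
      via : ∀ {a b d e} → a ≈ b → b ≈ d → e ≈ d → a ≈ e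
      via p q r = K.trans p (K.trans q (K.sym r))

  module _ (S : RawSetOperad) where
    private module S = RawSetOperad S

    linearRawOperad : RawOperad c ℓ
    linearRawOperad = record
      { space = λ n → FormalSums.freeModule (S._≟_ {n})
      ; unit  = basis S.unit
      ; comp  = λ e f i g → bilinear (λ x y → S.comp e x i y) f g
      }

  module _ {S : RawSetOperad} (isSetOperad : IsSetOperad S) where
    private
      module S where
        open RawSetOperad S public
        open IsSetOperad isSetOperad public
      module F {n : ℕ} = FormalSums (S._≟_ {n})
    open F using (_≋_; mk≋; coefficients; δ; sum-resp-≋)
    open SetoidReasoning K.setoid

    linearIsOperad : IsOperad (linearRawOperad S)
    linearIsOperad = record
      { comp-cong = λ e {f} {f′} i {g} {g′} p q → mk≋ λ z → begin
          sum (δ z) (bilinear _ f g)                        ≈⟨ sum-bilinear (δ z) _ f g ⟩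
          sum (λ x → sum (λ y → δ z (S.comp e x i y)) g) f  ≈⟨ sum-cong (λ x → sum-resp-≋ _ q) f ⟩
          sum (λ x → sum (λ y → δ z (S.comp e x i y)) g′) f ≈⟨ sum-resp-≋ _ p ⟩
          sum (λ x → sum (λ y → δ z (S.comp e x i y)) g′) f′ ≈⟨ sum-bilinear (δ z) _ f′ g′ ⟨
          sum (δ z) (bilinear _ f′ g′)                      ∎
      ; comp-+ˡ = λ e f f′ i g → mk≋ λ z → begin
          sum (δ z) (bilinear _ (f ++ f′) g)                ≈⟨ sum-bilinear (δ z) _ (f ++ f′) g ⟩
          sum (λ x → sum (λ y → δ z (S.comp e x i y)) g) (f ++ f′)
            ≈⟨ sum-++ _ f f′ ⟩
          _ ≈⟨ K.+-cong (sum-bilinear (δ z) _ f g) (sum-bilinear (δ z) _ f′ g) ⟨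
          sum (δ z) (bilinear _ f g) K.+ sum (δ z) (bilinear _ f′ g)
            ≈⟨ sum-++ (δ z) (bilinear _ f g) _ ⟨
          _ ∎
      ; comp-+ʳ = λ e f i g g′ → mk≋ λ z → begin
          sum (δ z) (bilinear _ f (g ++ g′))                ≈⟨ sum-bilinear (δ z) _ f (g ++ g′) ⟩
          sum (λ x → sum (λ y → δ z (S.comp e x i y)) (g ++ g′)) f
            ≈⟨ sum-cong (λ x → sum-++ _ g g′) f ⟩
          _ ≈⟨ sum-+ _ _ f ⟩
          _ ≈⟨ K.+-cong (sum-bilinear (δ z) _ f g) (sum-bilinear (δ z) _ f g′) ⟨
          sum (δ z) (bilinear _ f g) K.+ sum (δ z) (bilinear _ f g′)
            ≈⟨ sum-++ (δ z) (bilinear _ f g) _ ⟨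
          _ ∎
      ; comp-*ˡ = λ e a f i g → mk≋ λ z → begin
          sum (δ z) (bilinear _ (scale a f) g)              ≈⟨ sum-bilinear (δ z) _ (scale a f) g ⟩
          sum (λ x → sum (λ y → δ z (S.comp e x i y)) g) (scale a f)
            ≈⟨ sum-scale _ a f ⟩
          _ ≈⟨ K.*-congˡ (sum-bilinear (δ z) _ f g) ⟨
          a K.* sum (δ z) (bilinear _ f g)                  ≈⟨ sum-scale (δ z) a (bilinear _ f g) ⟨
          _ ∎
      ; comp-*ʳ = λ e a f i g → mk≋ λ z → begin
          sum (δ z) (bilinear _ f (scale a g))              ≈⟨ sum-bilinear (δ z) _ f (scale a g) ⟩
          sum (λ x → sum (λ y → δ z (S.comp e x i y)) (scale a g)) f
            ≈⟨ sum-cong (λ x → sum-scale _ a g) f ⟩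
          _ ≈⟨ sum-* a _ f ⟩
          _ ≈⟨ K.*-congˡ (sum-bilinear (δ z) _ f g) ⟨
          a K.* sum (δ z) (bilinear _ f g)                  ≈⟨ sum-scale (δ z) a (bilinear _ f g) ⟨
          _ ∎
      ; identityˡ = λ e i f → mk≋ λ z → begin
          _ ≈⟨ sum-bilinear (δ z) (λ x y → S.comp e x i y) (basis S.unit) f ⟩
          _ ≈⟨ sum-basis (λ x → sum (λ y → δ z (S.comp e x i y)) f) S.unit ⟩
          sum (λ x → δ z (S.comp e S.unit i x)) f
            ≈⟨ sum-cong (λ x → K.reflexive (cong (δ z) (S.identityˡ e i x))) f ⟩
          sum (δ z) f                                       ∎
      ; identityʳ = λ e f i → mk≋ λ z → begin
          _ ≈⟨ sum-bilinear (δ z) (λ x y → S.comp e x i y) f (basis S.unit) ⟩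
          _ ≈⟨ sum-cong (λ x → sum-basis (λ y → δ z (S.comp e x i y)) S.unit) f ⟩
          sum (λ x → δ z (S.comp e x i S.unit)) f
            ≈⟨ sum-cong (λ x → K.reflexive (cong (δ z) (S.identityʳ e x i))) f ⟩
          sum (δ z) f                                       ∎
      ; sequential = λ e₁ e₁′ e₂ e₂′ f i g j h j′ p → mk≋ λ t → begin
          sum (δ t) (bilinear _ (bilinear _ f g) h)
            ≈⟨ sum-bilinear (δ t) _ (bilinear _ f g) h ⟩
          _ ≈⟨ sum-bilinear _ _ f g ⟩
          sum (λ x → sum (λ y → sum (λ z → δ t (S.comp e₁′ (S.comp e₁ x i y) j′ z)) h) g) f
            ≈⟨ sum-cong (λ x → sum-cong (λ y → sum-cong (λ z →
                 K.reflexive (cong (δ t) (S.sequential e₁ e₁′ e₂ e₂′ x i y j z j′ p))) h) g) f ⟩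
          sum (λ x → sum (λ y → sum (λ z → δ t (S.comp e₂′ x i (S.comp e₂ y j z))) h) g) f
            ≈⟨ sum-cong (λ x → sum-bilinear _ _ g h) f ⟨
          _ ≈⟨ sum-bilinear (δ t) _ f (bilinear _ g h) ⟨
          sum (δ t) (bilinear _ f (bilinear _ g h))         ∎
      ; parallel = λ e₁ e₁′ e₂ e₂′ f i j g h i′ j′ i<j p q → mk≋ λ t → begin
          sum (δ t) (bilinear _ (bilinear _ f g) h)
            ≈⟨ sum-bilinear (δ t) _ (bilinear _ f g) h ⟩
          _ ≈⟨ sum-bilinear _ _ f g ⟩
          sum (λ x → sum (λ y → sum (λ z → δ t (S.comp e₁′ (S.comp e₁ x j y) i′ z)) h) g) f
            ≈⟨ sum-cong (λ x → sum-swap _ g h) f ⟩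
          sum (λ x → sum (λ z → sum (λ y → δ t (S.comp e₁′ (S.comp e₁ x j y) i′ z)) g) h) f
            ≈⟨ sum-cong (λ x → sum-cong (λ z → sum-cong (λ y →
                 K.reflexive (cong (δ t) (S.parallel e₁ e₁′ e₂ e₂′ x i j y z i′ j′ i<j p q))) g) h) f ⟩
          sum (λ x → sum (λ z → sum (λ y → δ t (S.comp e₂′ (S.comp e₂ x i z) j′ y)) g) h) f
            ≈⟨ sum-bilinear _ _ f h ⟨
          _ ≈⟨ sum-bilinear (δ t) _ (bilinear _ f h) g ⟨
          sum (δ t) (bilinear _ (bilinear _ f h) g)         ∎
      }

  linearOperad : (S : RawSetOperad) → IsSetOperad S → Operad c ℓ
  linearOperad S isSetOperad = record { isOperad = linearIsOperad isSetOperad }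

  data Span {m ℓm r} (M : LeftModule K.ring m ℓm) (R : Pred (LeftModule.Carrierᴹ M) r) :
            Pred (LeftModule.Carrierᴹ M) (c ⊔ m ⊔ ℓm ⊔ r) where
    generator : ∀ {x} → R x → Span M R x
    resp-≈    : ∀ {x y} → LeftModule._≈ᴹ_ M x y → Span M R x → Span M R y
    0-closed  : Span M R (LeftModule.0ᴹ M)
    +-closed  : ∀ {x y} → Span M R x → Span M R y → Span M R (LeftModule._+ᴹ_ M x y)
    *-closed  : ∀ a {x} → Span M R x → Span M R (LeftModule._*ₗ_ M a x)

  module _ {m ℓm r} (P : RawOperad m ℓm) {d : ℕ} (R : Pred (RawOperad.Op P d) r) where
    open RawOperad P
    open Space

    data Ideal : ∀ {n} → Pred (Op n) (c ⊔ m ⊔ ℓm ⊔ r) where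
      generator : {x : Op d} → R x → Ideal x
      resp-≈    : ∀ {n} {x y : Op n} → x ≈ᴹ y → Ideal x → Ideal y
      0-closed  : ∀ {n} → Ideal {n} 0ᴹ
      +-closed  : ∀ {n} {x y : Op n} → Ideal x → Ideal y → Ideal (x +ᴹ y)
      *-closed  : ∀ {n} a {x : Op n} → Ideal x → Ideal (a *ₗ x)
      compˡ     : ∀ {k n l} .(e : suc k ≡ n + l) {x : Op n} (i : Fin n) (y : Op l) →
                  Ideal x → Ideal (comp e x i y)
      compʳ     : ∀ {k n l} .(e : suc k ≡ n + l) (x : Op n) (i : Fin n) {y : Op l} →
                  Ideal y → Ideal (comp e x i y)

    record CongruentModulo {n} (x y : Op n) : Set (c ⊔ m ⊔ ℓm ⊔ r) where
      constructor mk~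
      field difference : Ideal (x +ᴹ -ᴹ y)

  module _ {m ℓm r} (P : Operad m ℓm) {d : ℕ} (R : Pred (Operad.Op P d) r) where
    private
      module P = Operad P
      module M {n : ℕ} where
        open P.Space {n} public
        open AbelianGroupProperties +ᴹ-abelianGroup public
        open CommutativeSemigroupProperties
          (CommutativeMonoid.commutativeSemigroup +ᴹ-commutativeMonoid) public
          using (interchange)

      open CongruentModulo

      infix 4 _~_

      _~_ : ∀ {n} → P.Op n → P.Op n → Set (c ⊔ m ⊔ ℓm ⊔ r)
      _~_ = CongruentModulo P.rawOperad R

      -1*x≈-x : ∀ {n} (x : P.Op n) → (K.- 1#) M.*ₗ x M.≈ᴹ M.-ᴹ x
      -1*x≈-x x = M.inverseʳ-unique x _ (begin
        x M.+ᴹ (K.- 1#) M.*ₗ x          ≈⟨ M.+ᴹ-congʳ (M.*ₗ-identityˡ x) ⟨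
        1# M.*ₗ x M.+ᴹ (K.- 1#) M.*ₗ x  ≈⟨ M.*ₗ-distribʳ x 1# (K.- 1#) ⟨
        (1# K.- 1#) M.*ₗ x              ≈⟨ M.*ₗ-cong (K.-‿inverseʳ 1#) M.≈ᴹ-refl ⟩
        0# M.*ₗ x                       ≈⟨ M.*ₗ-zeroˡ x ⟩
        M.0ᴹ                            ∎)
        where open SetoidReasoning M.≈ᴹ-setoid

      a*-x≈-a*x : ∀ {n} a (x : P.Op n) → a M.*ₗ (M.-ᴹ x) M.≈ᴹ M.-ᴹ (a M.*ₗ x)
      a*-x≈-a*x a x = M.inverseʳ-unique (a M.*ₗ x) _ (begin
        a M.*ₗ x M.+ᴹ a M.*ₗ (M.-ᴹ x) ≈⟨ M.*ₗ-distribˡ a x (M.-ᴹ x) ⟨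
        a M.*ₗ (x M.+ᴹ M.-ᴹ x)        ≈⟨ M.*ₗ-cong K.refl (M.-ᴹ‿inverseʳ x) ⟩
        a M.*ₗ M.0ᴹ                   ≈⟨ M.*ₗ-zeroʳ a ⟩
        M.0ᴹ                          ∎)
        where open SetoidReasoning M.≈ᴹ-setoid

      comp-‿ˡ : ∀ {k n l} .(e : suc k ≡ n + l) (x : P.Op n) (i : Fin n) (y : P.Op l) →
        P.comp e (M.-ᴹ x) i y M.≈ᴹ M.-ᴹ P.comp e x i y
      comp-‿ˡ e x i y = begin
        P.comp e (M.-ᴹ x) i y              ≈⟨ P.comp-cong e i (-1*x≈-x x) M.≈ᴹ-refl ⟨
        P.comp e ((K.- 1#) M.*ₗ x) i y     ≈⟨ P.comp-*ˡ e (K.- 1#) x i y ⟩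
        (K.- 1#) M.*ₗ P.comp e x i y       ≈⟨ -1*x≈-x _ ⟩
        M.-ᴹ P.comp e x i y                ∎
        where open SetoidReasoning M.≈ᴹ-setoid

      comp-‿ʳ : ∀ {k n l} .(e : suc k ≡ n + l) (x : P.Op n) (i : Fin n) (y : P.Op l) →
        P.comp e x i (M.-ᴹ y) M.≈ᴹ M.-ᴹ P.comp e x i y
      comp-‿ʳ e x i y = begin
        P.comp e x i (M.-ᴹ y)              ≈⟨ P.comp-cong e i M.≈ᴹ-refl (-1*x≈-x y) ⟨
        P.comp e x i ((K.- 1#) M.*ₗ y)     ≈⟨ P.comp-*ʳ e (K.- 1#) x i y ⟩
        (K.- 1#) M.*ₗ P.comp e x i y       ≈⟨ -1*x≈-x _ ⟩
        M.-ᴹ P.comp e x i y                ∎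
        where open SetoidReasoning M.≈ᴹ-setoid

      telescope : ∀ {n} (x y z : P.Op n) →
        (x M.+ᴹ M.-ᴹ y) M.+ᴹ (y M.+ᴹ M.-ᴹ z) M.≈ᴹ x M.+ᴹ M.-ᴹ z
      telescope x y z = begin
        (x M.+ᴹ M.-ᴹ y) M.+ᴹ (y M.+ᴹ M.-ᴹ z)  ≈⟨ M.+ᴹ-assoc _ _ _ ⟩
        x M.+ᴹ (M.-ᴹ y M.+ᴹ (y M.+ᴹ M.-ᴹ z))  ≈⟨ M.+ᴹ-congˡ (M.+ᴹ-assoc _ _ _) ⟨
        x M.+ᴹ ((M.-ᴹ y M.+ᴹ y) M.+ᴹ M.-ᴹ z)  ≈⟨ M.+ᴹ-congˡ (M.+ᴹ-congʳ (M.-ᴹ‿inverseˡ y)) ⟩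
        x M.+ᴹ (M.0ᴹ M.+ᴹ M.-ᴹ z)             ≈⟨ M.+ᴹ-congˡ (M.+ᴹ-identityˡ _) ⟩
        x M.+ᴹ M.-ᴹ z                         ∎
        where open SetoidReasoning M.≈ᴹ-setoid

      fromEq : ∀ {n} {x y : P.Op n} → x M.≈ᴹ y → x ~ y
      fromEq p = mk~ (resp-≈ (M.≈ᴹ-sym (M.≈ᴹ-trans (M.+ᴹ-congʳ p) (M.-ᴹ‿inverseʳ _))) 0-closed)

      ~-trans : ∀ {n} {x y z : P.Op n} → x ~ y → y ~ z → x ~ z
      ~-trans p q = mk~ (resp-≈ (telescope _ _ _) (+-closed (difference p) (difference q)))

      neg-closed : ∀ {n} {x : P.Op n} → Ideal P.rawOperad R x → Ideal P.rawOperad R (M.-ᴹ x)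
      neg-closed p = resp-≈ (-1*x≈-x _) (*-closed (K.- 1#) p)

      ~-sym : ∀ {n} {x y : P.Op n} → x ~ y → y ~ x
      ~-sym {x = x} {y} p = mk~ (resp-≈ (M.≈ᴹ-sym (M.inverseʳ-unique _ _
        (M.≈ᴹ-trans (telescope x y x) (M.-ᴹ‿inverseʳ x)))) (neg-closed (difference p)))

      +-cong~ : ∀ {n} {x x′ y y′ : P.Op n} → x ~ x′ → y ~ y′ → x M.+ᴹ y ~ x′ M.+ᴹ y′
      +-cong~ p q = mk~ (resp-≈
        (M.≈ᴹ-trans (M.interchange _ _ _ _) (M.+ᴹ-congˡ (M.⁻¹-∙-comm _ _)))
        (+-closed (difference p) (difference q)))

      -‿cong~ : ∀ {n} {x y : P.Op n} → x ~ y → M.-ᴹ x ~ M.-ᴹ y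
      -‿cong~ p = mk~ (resp-≈ (M.≈ᴹ-sym (M.⁻¹-∙-comm _ _)) (neg-closed (difference p)))

      *-cong~ : ∀ {n} {a b} {x y : P.Op n} → a ≈ b → x ~ y → a M.*ₗ x ~ b M.*ₗ y
      *-cong~ {a = a} p q = ~-trans
        (mk~ (resp-≈ (M.≈ᴹ-trans (M.*ₗ-distribˡ a _ _) (M.+ᴹ-congˡ (a*-x≈-a*x a _)))
          (*-closed a (difference q))))
        (fromEq (M.*ₗ-cong p M.≈ᴹ-refl))

      comp-cong~ : ∀ {k n l} .(e : suc k ≡ n + l) {x x′ : P.Op n} (i : Fin n) {y y′ : P.Op l} →
        x ~ x′ → y ~ y′ → P.comp e x i y ~ P.comp e x′ i y′
      comp-cong~ e {x} {x′} i {y} {y′} p q = ~-trans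
        (mk~ (resp-≈ (M.≈ᴹ-trans (P.comp-+ˡ e x _ i y) (M.+ᴹ-congˡ (comp-‿ˡ e x′ i y)))
          (compˡ e i y (difference p))))
        (mk~ (resp-≈ (M.≈ᴹ-trans (P.comp-+ʳ e x′ i y _) (M.+ᴹ-congˡ (comp-‿ʳ e x′ i y′)))
          (compʳ e x′ i (difference q))))

      quotientModule : ℕ → LeftModule K.ring m (c ⊔ m ⊔ ℓm ⊔ r)
      quotientModule n = record
        { Carrierᴹ = P.Op n
        ; _≈ᴹ_     = _~_
        ; _+ᴹ_     = M._+ᴹ_
        ; _*ₗ_     = M._*ₗ_
        ; 0ᴹ       = M.0ᴹ
        ; -ᴹ_      = M.-ᴹ_
        ; isLeftModule = record
          { isLeftSemimodule = record
            { +ᴹ-isCommutativeMonoid = record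
              { isMonoid = record
                { isSemigroup = record
                  { isMagma = record
                    { isEquivalence = record
                      { refl = fromEq M.≈ᴹ-refl ; sym = ~-sym ; trans = ~-trans }
                    ; ∙-cong = +-cong~
                    }
                  ; assoc = λ x y z → fromEq (M.+ᴹ-assoc x y z)
                  }
                ; identity = (λ x → fromEq (M.+ᴹ-identityˡ x)) , (λ x → fromEq (M.+ᴹ-identityʳ x))
                }
              ; comm = λ x y → fromEq (M.+ᴹ-comm x y)
              }
            ; isPreleftSemimodule = record
              { *ₗ-cong      = *-cong~
              ; *ₗ-zeroˡ     = λ x → fromEq (M.*ₗ-zeroˡ x)
              ; *ₗ-distribʳ  = λ x a b → fromEq (M.*ₗ-distribʳ x a b)
              ; *ₗ-identityˡ = λ x → fromEq (M.*ₗ-identityˡ x)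
              ; *ₗ-assoc     = λ a b x → fromEq (M.*ₗ-assoc a b x)
              ; *ₗ-zeroʳ     = λ a → fromEq (M.*ₗ-zeroʳ a)
              ; *ₗ-distribˡ  = λ a x y → fromEq (M.*ₗ-distribˡ a x y)
              }
            }
          ; -ᴹ‿cong    = -‿cong~
          ; -ᴹ‿inverse = (λ x → fromEq (M.-ᴹ‿inverseˡ x)) , (λ x → fromEq (M.-ᴹ‿inverseʳ x))
          }
        }

    quotient : Operad m (c ⊔ m ⊔ ℓm ⊔ r)
    quotient = record
      { rawOperad = record { space = quotientModule ; unit = P.unit ; comp = P.comp }
      ; isOperad  = record
        { comp-cong  = comp-cong~
        ; comp-+ˡ    = λ e x x′ i y → fromEq (P.comp-+ˡ e x x′ i y)
        ; comp-+ʳ    = λ e x i y y′ → fromEq (P.comp-+ʳ e x i y y′)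
        ; comp-*ˡ    = λ e a x i y → fromEq (P.comp-*ˡ e a x i y)
        ; comp-*ʳ    = λ e a x i y → fromEq (P.comp-*ʳ e a x i y)
        ; identityˡ  = λ e i x → fromEq (P.identityˡ e i x)
        ; identityʳ  = λ e x i → fromEq (P.identityʳ e x i)
        ; sequential = λ e₁ e₁′ e₂ e₂′ x i y j z j′ p →
            fromEq (P.sequential e₁ e₁′ e₂ e₂′ x i y j z j′ p)
        ; parallel   = λ e₁ e₁′ e₂ e₂′ x i j y z i′ j′ i<j p q →
            fromEq (P.parallel e₁ e₁′ e₂ e₂′ x i j y z i′ j′ i<j p q)
        }
      }

  module BinaryQuadratic {G : Set} (_≟_ : DecidableEquality G) where

    Free : Operad c ℓ
    Free = linearOperad (freeRawSetOperad _≟_) (freeIsSetOperad _≟_)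

    open Operad Free using (Op; comp; space)

    ⋆ : G → Op 2
    ⋆ a = basis (corolla _≟_ a)

    _∘₁_ _∘₂_ : Op 2 → Op 2 → Op 3
    x ∘₁ y = comp refl x zero y
    x ∘₂ y = comp refl x (suc zero) y

    -- In arity 3 the basis trees are node x (node y leaf leaf) leaf, which is
    -- ⋆ x ∘₁ ⋆ y, and node x leaf (node y leaf leaf), which is ⋆ x ∘₂ ⋆ y.

    treePairing : BinaryTree G → BinaryTree G → K.Carrier
    treePairing (node x (node y leaf leaf) leaf) (node x′ (node y′ leaf leaf) leaf) =
      if does (x ≟ x′) ∧ does (y ≟ y′) then 1# else 0#
    treePairing (node x leaf (node y leaf leaf)) (node x′ leaf (node y′ leaf leaf)) =
      if does (x ≟ x′) ∧ does (y ≟ y′) then K.- 1# else 0#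
    treePairing _ _ = 0#

    ⟨_,_⟩ : Op 3 → Op 3 → K.Carrier
    ⟨ f , g ⟩ = sum (λ s → sum (λ t → treePairing (tree s) (tree t)) g) f
      where open BinaryTreeOfArity

    annihilator : ∀ {r} → Pred (Op 3) r → Pred (Op 3) (c ⊔ ℓ ⊔ r)
    annihilator R f = ∀ g → R g → ⟨ f , g ⟩ ≈ 0#

    Presented : ∀ {r} → Pred (Op 3) r → Operad c (c ⊔ ℓ ⊔ r)
    Presented R = quotient Free R

    KoszulDual : ∀ {r} → Pred (Op 3) r → Operad c (c ⊔ ℓ ⊔ r)
    KoszulDual R = Presented (annihilator (Span (space 3) R))

  module _ (γ : ℕ) where
    open BinaryQuadratic (Fin._≟_ {γ})
    open Operad Free using (Op)
    open Operad.Space Free using (_+ᴹ_; -ᴹ_)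
    open Max (Fin.≤-totalOrder γ) using () renaming (_⊔_ to _↑_)

    data AsRelation : Pred (Op 3) 0ℓ where
      relation₁ : ∀ a a′ →
        AsRelation ((⋆ a ∘₁ ⋆ a′) +ᴹ -ᴹ (⋆ (a ↑ a′) ∘₂ ⋆ (a ↑ a′)))
      relation₂ : ∀ a a′ →
        AsRelation ((⋆ a ∘₂ ⋆ a′) +ᴹ -ᴹ (⋆ (a ↑ a′) ∘₂ ⋆ (a ↑ a′)))

    As : Operad c (c ⊔ ℓ)
    As = Presented AsRelation

    DAs : Operad c (c ⊔ ℓ)
    DAs = KoszulDual AsRelation

    alternatingSchröderRawOperad : RawOperad c ℓ
    alternatingSchröderRawOperad = linearRawOperad (alternatingSchröderRawSetOperad γ)

{-# OPTIONS --safe #-}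
module Submission where

-- Put ◇ₐ = Σ_{b ≤ a} ⋆_b, so that ⋆ₐ = ◇ₐ − ◇ₐ₋₁.  In arity 3 the annihilator
-- of the relations of As is spanned by the associators of the ◇ₐ, so DAs is
-- the linearization of the set operad of binary trees modulo associativity of
-- each label.  Every class of that congruence contains exactly one expansion of
-- an alternating Schröder tree into right combs: contracting all the edges
-- whose two ends have the same label is a morphism of set operads that
-- identifies associative trees, and expansion is a section of it.  Hence
-- ⋆ₐ ↦ corollaₐ − corollaₐ₋₁ extends to an operad morphism Φ on DAs whose
-- inverse Ψ evaluates expansions at the ◇ₐ.

open import Defs
open import Level using (_⊔_)
open import Algebra.Apartness.Bundles using (HeytingField)
open import Algebra.Bundles using (AbelianGroup; CommutativeRing)
import Algebra.Construct.NaturalChoice.Max as Max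
open import Algebra.Module.Bundles using (LeftModule)
open import Algebra.Morphism.Structures using (module GroupMorphisms)
import Algebra.Properties.AbelianGroup as AbelianGroupProperties
import Algebra.Properties.Ring as RingProperties
open import Data.Bool.Base using (if_then_else_)
open import Data.Fin.Base as Fin using (Fin; zero; suc; toℕ; splitAt; inject₁; _↑ˡ_; _↑ʳ_)
import Data.Fin.Properties as Fin
open import Data.List.Base using (List; []; _∷_; _++_; length)
open import Data.List.Properties using (++-assoc; ++-identityʳ)
open import Data.List.Relation.Unary.All using (All; []; _∷_)
open import Data.List.Relation.Unary.All.Properties using (++⁺)
open import Data.Nat.Base using (ℕ; zero; suc; _+_; _≤_; z≤n; s≤s)
open import Data.Nat.Properties as ℕ using ()
open import Data.Product.Base using (_×_; _,_; ∃)
open import Data.Sum.Base using (_⊎_; inj₁; inj₂)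
open import Function.Base using (_∘_; id)
open import Function.Bundles using (mk⇔)
open import Relation.Binary.Definitions using (DecidableEquality)
open import Relation.Binary.PropositionalEquality
  using (_≡_; refl; sym; trans; cong; cong₂; subst; module ≡-Reasoning)
import Relation.Binary.Reasoning.Setoid as SetoidReasoning
open import Relation.Nullary using (¬_; Dec; yes; no; does; contradiction)
open import Relation.Nullary.Decidable using (recompute; _×-dec_; dec-true; dec-false; does-⇔)

-- The maximum in the relations of As is what singles out the ◇ₐ. The indicator of x ≤ b times the
-- indicator of y ≤ b is the indicator of x ↑ y ≤ b, so the coefficient of ⋆ₓ ∘ᵢ ⋆ᵧ in ◇_b ∘ᵢ ◇_b
-- depends on x ↑ y alone, which is just what the relations demand of an annihilating element. Such
-- an element is determined by γ numbers, its coefficients at ⋆ₘ ∘₂ ⋆ₘ, and Möbius inversion on the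
-- chain [γ] turns these numbers into coordinates along the associators. The two morphisms rest on
-- opposite halves of this description: Φ descends to DAs because the associators span the
-- annihilator, and Ψ respects composition because they belong to it. Injectivity and surjectivity
-- of Φ both come from the explicit inverse. The obstacle is that expansion respects composition
-- only modulo associativity. Hence Ψ is a morphism only after projection to the quotient, and
-- linear extension is set up relative to such a projection.

splitAt-toℕ : ∀ m {n} (i : Fin (m + n)) →
  (∃ λ (j : Fin m) → toℕ i ≡ toℕ j) ⊎ (∃ λ (j : Fin n) → toℕ i ≡ m + toℕ j)
splitAt-toℕ m {n} i with splitAt m i in eq
... | inj₁ j = inj₁ (j , trans (cong toℕ (sym (Fin.splitAt⁻¹-↑ˡ {m} {n} {i} {j} eq))) (Fin.toℕ-↑ˡ j n))
... | inj₂ j = inj₂ (j , trans (cong toℕ (sym (Fin.splitAt⁻¹-↑ʳ {m} {n} {i} {j} eq))) (Fin.toℕ-↑ʳ m j))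

-- Positions of leaves are compared through `toℕ` from here on: one position inhabits `Fin` of
-- several numbers that are equal only propositionally.
splitAt-left : ∀ {m n} (i : Fin (m + n)) (j : Fin m) → toℕ i ≡ toℕ j → splitAt m i ≡ inj₁ j
splitAt-left {m} {n} i j p =
  trans (cong (splitAt m) (Fin.toℕ-injective (trans p (sym (Fin.toℕ-↑ˡ j n))))) (Fin.splitAt-↑ˡ m j n)

splitAt-right : ∀ {m n} (i : Fin (m + n)) (j : Fin n) → toℕ i ≡ m + toℕ j → splitAt m i ≡ inj₂ j
splitAt-right {m} {n} i j p =
  trans (cong (splitAt m) (Fin.toℕ-injective (trans p (sym (Fin.toℕ-↑ʳ m j))))) (Fin.splitAt-↑ʳ m n j)

-- Binary trees modulo associativity of each label, and expansion into right combs.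

module _ {G : Set} where

  graft-left : ∀ a (l r : BinaryTree G) t i j → toℕ i ≡ toℕ j →
    graft (node a l r) i t ≡ node a (graft l j t) r
  graft-left a l r t i j p rewrite splitAt-left i j p = refl

  graft-right : ∀ a (l r : BinaryTree G) t i j → toℕ i ≡ leavesᵇ l + toℕ j →
    graft (node a l r) i t ≡ node a l (graft r j t)
  graft-right a l r t i j p rewrite splitAt-right i j p = refl

  infix 4 _∼_

  -- The quotient by this congruence is never formed. The relation serves to replace a tree by the
  -- expansion of its contraction inside an evaluation at associative elements.
  data _∼_ : BinaryTree G → BinaryTree G → Set where
    assoc  : ∀ {a x y z} → node a (node a x y) z ∼ node a x (node a y z)
    node   : ∀ {a l l′ r r′} → l ∼ l′ → r ∼ r′ → node a l r ∼ node a l′ r′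
    ∼-refl : ∀ {t} → t ∼ t
    ∼-sym  : ∀ {s t} → s ∼ t → t ∼ s
    ∼-trans : ∀ {s t u} → s ∼ t → t ∼ u → s ∼ u

  ∼-reflexive : ∀ {s t : BinaryTree G} → s ≡ t → s ∼ t
  ∼-reflexive refl = ∼-refl

  leaves-∼ : ∀ {s t : BinaryTree G} → s ∼ t → leavesᵇ s ≡ leavesᵇ t
  leaves-∼ (assoc {x = x})  = ℕ.+-assoc (leavesᵇ x) _ _
  leaves-∼ (node p q)       = cong₂ _+_ (leaves-∼ p) (leaves-∼ q)
  leaves-∼ ∼-refl           = refl
  leaves-∼ (∼-sym p)        = sym (leaves-∼ p)
  leaves-∼ (∼-trans p q)    = trans (leaves-∼ p) (leaves-∼ q)

  -- The empty list gets a junk value: nodes of Schröder trees have children.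
  rightComb : G → List (BinaryTree G) → BinaryTree G
  rightComb a []              = leaf
  rightComb a (t ∷ [])        = t
  rightComb a (t ∷ ts@(_ ∷ _)) = node a t (rightComb a ts)

  -- Each element of `ss` before the last costs one use of associativity, read from right to left.
  -- An empty list would bring in the junk leaf and change the arity.
  rightComb-++ : ∀ a ss ts → 1 ≤ length ss → 1 ≤ length ts →
    rightComb a (ss ++ ts) ∼ node a (rightComb a ss) (rightComb a ts)
  rightComb-++ a (s ∷ [])     (t ∷ ts) _ _ = ∼-refl
  rightComb-++ a (s ∷ ss@(_ ∷ _)) ts   _ h =
    ∼-trans (node ∼-refl (rightComb-++ a ss ts (s≤s z≤n) h)) (∼-sym assoc)

  expand  : LabeledTree G → BinaryTree G
  expand* : List (LabeledTree G) → List (BinaryTree G)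

  expand leaf        = leaf
  expand (node a ts) = rightComb a (expand* ts)

  expand* []       = []
  expand* (t ∷ ts) = expand t ∷ expand* ts

  expand*-++ : ∀ ss ts → expand* (ss ++ ts) ≡ expand* ss ++ expand* ts
  expand*-++ []       ts = refl
  expand*-++ (s ∷ ss) ts = cong (expand s ∷_) (expand*-++ ss ts)

  length-expand* : ∀ ts → length (expand* ts) ≡ length ts
  length-expand* []       = refl
  length-expand* (t ∷ ts) = cong suc (length-expand* ts)

  leaves*-++ : ∀ (ts us : List (LabeledTree G)) → leaves* (ts ++ us) ≡ leaves* ts + leaves* us
  leaves*-++ []       us = refl
  leaves*-++ (t ∷ ts) us =
    trans (cong (leaves t +_) (leaves*-++ ts us)) (sym (ℕ.+-assoc (leaves t) _ _))

-- Contraction of the edges whose two ends have the same label.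

module Contraction {A : Set} (_≟_ : DecidableEquality A) where

  -- Works from the leaves upward. The contracted subtrees are already alternating, so splicing in
  -- the children of their roots by `attach` creates no new edge to contract.
  contract : BinaryTree A → LabeledTree A
  contract leaf         = leaf
  contract (node a l r) = node a (attach _≟_ a (contract l) ++ attach _≟_ a (contract r))

  -- Grafting `t` on a bare leaf below `a` is by definition `attach a t`. The facts on `attach` used
  -- below are therefore those on `graftContractBelow` at `leaf`.
  leaves*-attach : ∀ a t → leaves* (attach _≟_ a t) ≡ leaves t
  leaves*-attach a t = ℕ.suc-injective (leaves-graftContractBelow _≟_ a leaf zero t)

  leaves-contract : ∀ t → leaves (contract t) ≡ leavesᵇ t
  leaves-contract leaf         = refl
  leaves-contract (node a l r) = trans (leaves*-++ (attach _≟_ a (contract l)) _)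
    (cong₂ _+_ (trans (leaves*-attach a (contract l)) (leaves-contract l))
               (trans (leaves*-attach a (contract r)) (leaves-contract r)))

  Schröder-contract : ∀ t → Schröder (contract t)
  Schröder-contract leaf         = leaf
  Schröder-contract (node a l r) =
    node (two (attach _≟_ a (contract l)) (attach _≟_ a (contract r))
              (length-graftContractBelow _≟_ a leaf zero (Schröder-contract l))
              (length-graftContractBelow _≟_ a leaf zero (Schröder-contract r)))
         (++⁺ (Schröder-graftContractBelow _≟_ a zero leaf (Schröder-contract l))
              (Schröder-graftContractBelow _≟_ a zero leaf (Schröder-contract r)))
    where
    two : ∀ (ss ts : List (LabeledTree A)) → 1 ≤ length ss → 1 ≤ length ts → 2 ≤ length (ss ++ ts)
    two (_ ∷ [])    (_ ∷ _) _ _ = s≤s (s≤s z≤n)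
    two (_ ∷ _ ∷ _) _       _ _ = s≤s (s≤s z≤n)

  Alternating-contract : ∀ t → Alternating (contract t)
  Alternating-contract leaf         = leaf
  Alternating-contract (node a l r) =
    node (++⁺ (Differs-graftContractBelow _≟_ a leaf zero leaf (Alternating-contract l))
              (Differs-graftContractBelow _≟_ a leaf zero leaf (Alternating-contract r)))
         (++⁺ (Alternating-graftContractBelow _≟_ a zero leaf (Alternating-contract l))
              (Alternating-graftContractBelow _≟_ a zero leaf (Alternating-contract r)))

  below*-here : ∀ a s ss t i j → toℕ i ≡ toℕ j →
    graftContractBelow* _≟_ a (s ∷ ss) i t ≡ graftContractBelow _≟_ a s j t ++ ss
  below*-here a s ss t i j p rewrite splitAt-left i j p = refl

  below*-there : ∀ a s ss t i j → toℕ i ≡ leaves s + toℕ j →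
    graftContractBelow* _≟_ a (s ∷ ss) i t ≡ s ∷ graftContractBelow* _≟_ a ss j t
  below*-there a s ss t i j p rewrite splitAt-right i j p = refl

  below*-++ˡ : ∀ a ss us t i j → toℕ i ≡ toℕ j →
    graftContractBelow* _≟_ a (ss ++ us) i t ≡ graftContractBelow* _≟_ a ss j t ++ us
  below*-++ˡ a (s ∷ ss) us t i j p with splitAt-toℕ (leaves s) j
  ... | inj₁ (k , q) = begin
    graftContractBelow* _≟_ a (s ∷ ss ++ us) i t         ≡⟨ below*-here a s (ss ++ us) t i k (trans p q) ⟩
    graftContractBelow _≟_ a s k t ++ ss ++ us           ≡⟨ ++-assoc (graftContractBelow _≟_ a s k t) ss us ⟨
    (graftContractBelow _≟_ a s k t ++ ss) ++ us         ≡⟨ cong (_++ us) (below*-here a s ss t j k q) ⟨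
    graftContractBelow* _≟_ a (s ∷ ss) j t ++ us         ∎
    where open ≡-Reasoning
  ... | inj₂ (k , q) = begin
    graftContractBelow* _≟_ a (s ∷ ss ++ us) i t         ≡⟨ below*-there a s (ss ++ us) t i k′
                                                              (trans p (trans q (cong (leaves s +_) (sym eq)))) ⟩
    s ∷ graftContractBelow* _≟_ a (ss ++ us) k′ t        ≡⟨ cong (s ∷_) (below*-++ˡ a ss us t k′ k eq) ⟩
    s ∷ graftContractBelow* _≟_ a ss k t ++ us           ≡⟨ cong (_++ us) (below*-there a s ss t j k q) ⟨
    graftContractBelow* _≟_ a (s ∷ ss) j t ++ us         ∎
    where
    open ≡-Reasoning
    k′ = Fin.cast (sym (leaves*-++ ss us)) (k ↑ˡ leaves* us)
    eq : toℕ k′ ≡ toℕ k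
    eq = trans (Fin.toℕ-cast _ (k ↑ˡ leaves* us)) (Fin.toℕ-↑ˡ k _)

  below*-++ʳ : ∀ a ss us t i j → toℕ i ≡ leaves* ss + toℕ j →
    graftContractBelow* _≟_ a (ss ++ us) i t ≡ ss ++ graftContractBelow* _≟_ a us j t
  below*-++ʳ a []       us t i j p = cong (λ k → graftContractBelow* _≟_ a us k t) (Fin.toℕ-injective p)
  below*-++ʳ a (s ∷ ss) us t i j p =
    trans (below*-there a s (ss ++ us) t i k
            (trans p (trans (ℕ.+-assoc (leaves s) _ _) (cong (leaves s +_) (sym eq)))))
          (cong (s ∷_) (below*-++ʳ a ss us t k j eq))
    where
    k = Fin.cast (sym (leaves*-++ ss us)) (leaves* ss ↑ʳ j)
    eq : toℕ k ≡ leaves* ss + toℕ j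
    eq = trans (Fin.toℕ-cast _ (leaves* ss ↑ʳ j)) (Fin.toℕ-↑ʳ (leaves* ss) j)

  -- Grafting keeps the root label of a tree other than a leaf, so the edge above `s` is contracted
  -- after grafting exactly when it is contracted before. At a leaf both sides are `attach a t`.
  attach-graftContract : ∀ a s t i j → toℕ i ≡ toℕ j →
    attach _≟_ a (graftContract _≟_ s i t) ≡ graftContractBelow* _≟_ a (attach _≟_ a s) j t
  attach-graftContract a leaf t i zero p = sym (++-identityʳ _)
  attach-graftContract a (node b ss) t i j p with a ≟ b
  ... | yes refl = cong (λ k → graftContractBelow* _≟_ a ss k t) (Fin.toℕ-injective p)
  ... | no _     = sym (below*-here a (node b ss) [] t j i (sym p))

  contract-graft : ∀ s t i j → toℕ i ≡ toℕ j →
    contract (graft s i t) ≡ graftContract _≟_ (contract s) j (contract t)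
  contract-graft leaf         t i j p = refl
  contract-graft (node a l r) t i j p with splitAt-toℕ (leavesᵇ l) i
  ... | inj₁ (k , q) = begin
    contract (graft (node a l r) i t)
      ≡⟨ cong contract (graft-left a l r t i k q) ⟩
    node a (attach _≟_ a (contract (graft l k t)) ++ attach _≟_ a (contract r))
      ≡⟨ cong (λ x → node a (attach _≟_ a x ++ _)) (contract-graft l t k k₁ (sym (Fin.toℕ-cast _ k))) ⟩
    node a (attach _≟_ a (graftContract _≟_ (contract l) k₁ (contract t)) ++ attach _≟_ a (contract r))
      ≡⟨ cong (λ x → node a (x ++ _))
           (attach-graftContract a (contract l) (contract t) k₁ k₂ (sym (Fin.toℕ-cast _ k₁))) ⟩
    node a (graftContractBelow* _≟_ a (attach _≟_ a (contract l)) k₂ (contract t) ++ attach _≟_ a (contract r))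
      ≡⟨ cong (node a) (below*-++ˡ a (attach _≟_ a (contract l)) _ (contract t) j k₂
           (trans (sym p) (trans q (sym (trans (Fin.toℕ-cast _ k₁) (Fin.toℕ-cast _ k)))))) ⟨
    graftContract _≟_ (contract (node a l r)) j (contract t) ∎
    where
    open ≡-Reasoning
    k₁ = Fin.cast (sym (leaves-contract l)) k
    k₂ = Fin.cast (sym (leaves*-attach a (contract l))) k₁
  ... | inj₂ (k , q) = begin
    contract (graft (node a l r) i t)
      ≡⟨ cong contract (graft-right a l r t i k q) ⟩
    node a (attach _≟_ a (contract l) ++ attach _≟_ a (contract (graft r k t)))
      ≡⟨ cong (λ x → node a (_ ++ attach _≟_ a x)) (contract-graft r t k k₁ (sym (Fin.toℕ-cast _ k))) ⟩
    node a (attach _≟_ a (contract l) ++ attach _≟_ a (graftContract _≟_ (contract r) k₁ (contract t)))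
      ≡⟨ cong (λ x → node a (attach _≟_ a (contract l) ++ x))
           (attach-graftContract a (contract r) (contract t) k₁ k₂ (sym (Fin.toℕ-cast _ k₁))) ⟩
    node a (attach _≟_ a (contract l) ++ graftContractBelow* _≟_ a (attach _≟_ a (contract r)) k₂ (contract t))
      ≡⟨ cong (node a) (below*-++ʳ a (attach _≟_ a (contract l)) _ (contract t) j k₂
           (trans (sym p) (trans q (cong₂ _+_
             (sym (trans (leaves*-attach a (contract l)) (leaves-contract l)))
             (sym (trans (Fin.toℕ-cast _ k₁) (Fin.toℕ-cast _ k))))))) ⟨
    graftContract _≟_ (contract (node a l r)) j (contract t) ∎
    where
    open ≡-Reasoning
    k₁ = Fin.cast (sym (leaves-contract r)) k
    k₂ = Fin.cast (sym (leaves*-attach a (contract r))) k₁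

  attach-differs : ∀ a {t} → RootLabelDiffersFrom a t → attach _≟_ a t ≡ t ∷ []
  attach-differs a leaf = refl
  attach-differs a (node {b} a≢b) with a ≟ b
  ... | yes a≡b = contradiction a≡b a≢b
  ... | no _    = refl

  attach-same : ∀ a ts → attach _≟_ a (node a ts) ≡ ts
  attach-same a ts with a ≟ a
  ... | yes _  = refl
  ... | no a≢a = contradiction refl a≢a

  contract-expand  : ∀ {t} → Schröder t → Alternating t → contract (expand t) ≡ t
  -- Describes the tail of a comb seen from its father, labeled `a`. The inner comb nodes carry `a`
  -- as well and dissolve by `attach-same`; the children have other root labels and survive by
  -- `attach-differs`.
  contract-expand* : ∀ {a t ts} → All Schröder (t ∷ ts) → All Alternating (t ∷ ts) →
    All (RootLabelDiffersFrom a) (t ∷ ts) →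
    attach _≟_ a (contract (rightComb a (expand* (t ∷ ts)))) ≡ t ∷ ts

  contract-expand leaf leaf = refl
  contract-expand {node a (t ∷ u ∷ us)} (node _ (h ∷ hs)) (node (d ∷ ds) (g ∷ gs)) =
    cong (node a) (cong₂ _++_
      (trans (cong (attach _≟_ a) (contract-expand h g)) (attach-differs a d))
      (contract-expand* hs gs ds))
  contract-expand {node a []}       (node () _)
  contract-expand {node a (_ ∷ [])} (node (s≤s ()) _)

  contract-expand* {a} {ts = []}     (h ∷ _)  (g ∷ _)  (d ∷ _)  =
    trans (cong (attach _≟_ a) (contract-expand h g)) (attach-differs a d)
  contract-expand* {a} {t} {u ∷ us} (h ∷ hs) (g ∷ gs) (d ∷ ds) = trans (attach-same a _) (cong₂ _++_
      (trans (cong (attach _≟_ a) (contract-expand h g)) (attach-differs a d))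
      (contract-expand* hs gs ds))

  rightComb-attach : ∀ a t → rightComb a (expand* (attach _≟_ a t)) ≡ expand t
  rightComb-attach a leaf        = refl
  rightComb-attach a (node b ts) with a ≟ b
  ... | yes refl = refl
  ... | no _     = refl

  -- Contraction concatenates the children found on the two sides, so expansion yields one long
  -- comb. `rightComb-++` cuts it in two again, and `rightComb-attach` recognizes each half as the
  -- expansion of a contracted subtree.
  expand-contract : ∀ t → expand (contract t) ∼ t
  expand-contract leaf         = ∼-refl
  expand-contract (node a l r) =
    ∼-trans (∼-reflexive (cong (rightComb a) (expand*-++ (attach _≟_ a (contract l)) _)))
    (∼-trans (rightComb-++ a (expand* (attach _≟_ a (contract l))) _ (nonempty l) (nonempty r))
    (node (∼-trans (∼-reflexive (rightComb-attach a (contract l))) (expand-contract l))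
          (∼-trans (∼-reflexive (rightComb-attach a (contract r))) (expand-contract r))))
    where
    nonempty : ∀ t → 1 ≤ length (expand* (attach _≟_ a (contract t)))
    nonempty t = subst (1 ≤_) (sym (length-expand* (attach _≟_ a (contract t))))
      (length-graftContractBelow _≟_ a leaf zero (Schröder-contract t))

-- The axioms descend along a surjective morphism, which saves proving them for
-- graftContract directly.
module _ {S T : RawSetOperad} (isSetOperad : IsSetOperad S) where
  private
    module S where
      open RawSetOperad S public
      open IsSetOperad isSetOperad public
    module T = RawSetOperad T

  transferIsSetOperad :
    (f : ∀ {n} → S.Op n → T.Op n) (g : ∀ {n} → T.Op n → S.Op n) →
    (∀ {n} (x : T.Op n) → f (g x) ≡ x) →
    f S.unit ≡ T.unit →
    (∀ {k n m} .(e : suc k ≡ n + m) (x : S.Op n) (i : Fin n) (y : S.Op m) →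
      f (S.comp e x i y) ≡ T.comp e (f x) i (f y)) →
    IsSetOperad T
  transferIsSetOperad f g fg f-unit f-comp = record
    { identityˡ  = λ e i x → begin
        T.comp e T.unit i x                ≡⟨ cong₂ (λ u v → T.comp e u i v) f-unit (fg x) ⟨
        T.comp e (f S.unit) i (f (g x))    ≡⟨ f-comp e _ i _ ⟨
        f (S.comp e S.unit i (g x))        ≡⟨ cong f (S.identityˡ e i (g x)) ⟩
        f (g x)                            ≡⟨ fg x ⟩
        x                                  ∎
    ; identityʳ  = λ e x i → begin
        T.comp e x i T.unit                ≡⟨ cong₂ (λ u v → T.comp e u i v) (fg x) f-unit ⟨
        T.comp e (f (g x)) i (f S.unit)    ≡⟨ f-comp e _ i _ ⟨
        f (S.comp e (g x) i S.unit)        ≡⟨ cong f (S.identityʳ e (g x) i) ⟩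
        f (g x)                            ≡⟨ fg x ⟩
        x                                  ∎
    ; sequential = λ e₁ e₁′ e₂ e₂′ x i y j z j′ p → begin
        T.comp e₁′ (T.comp e₁ x i y) j′ z
          ≡⟨ cong₂ (λ u v → T.comp e₁′ u j′ v) (lifted e₁ x i y) (fg z) ⟨
        T.comp e₁′ (f (S.comp e₁ (g x) i (g y))) j′ (f (g z))
          ≡⟨ f-comp e₁′ _ j′ _ ⟨
        f (S.comp e₁′ (S.comp e₁ (g x) i (g y)) j′ (g z))
          ≡⟨ cong f (S.sequential e₁ e₁′ e₂ e₂′ (g x) i (g y) j (g z) j′ p) ⟩
        f (S.comp e₂′ (g x) i (S.comp e₂ (g y) j (g z)))
          ≡⟨ f-comp e₂′ _ i _ ⟩
        T.comp e₂′ (f (g x)) i (f (S.comp e₂ (g y) j (g z)))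
          ≡⟨ cong₂ (λ u v → T.comp e₂′ u i v) (fg x) (lifted e₂ y j z) ⟩
        T.comp e₂′ x i (T.comp e₂ y j z) ∎
    ; parallel   = λ e₁ e₁′ e₂ e₂′ x i j y z i′ j′ i<j p q → begin
        T.comp e₁′ (T.comp e₁ x j y) i′ z
          ≡⟨ cong₂ (λ u v → T.comp e₁′ u i′ v) (lifted e₁ x j y) (fg z) ⟨
        T.comp e₁′ (f (S.comp e₁ (g x) j (g y))) i′ (f (g z))
          ≡⟨ f-comp e₁′ _ i′ _ ⟨
        f (S.comp e₁′ (S.comp e₁ (g x) j (g y)) i′ (g z))
          ≡⟨ cong f (S.parallel e₁ e₁′ e₂ e₂′ (g x) i j (g y) (g z) i′ j′ i<j p q) ⟩
        f (S.comp e₂′ (S.comp e₂ (g x) i (g z)) j′ (g y))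
          ≡⟨ f-comp e₂′ _ j′ _ ⟩
        T.comp e₂′ (f (S.comp e₂ (g x) i (g z))) j′ (f (g y))
          ≡⟨ cong₂ (λ u v → T.comp e₂′ u j′ v) (lifted e₂ x i z) (fg y) ⟩
        T.comp e₂′ (T.comp e₂ x i z) j′ y ∎
    }
    where
    open ≡-Reasoning
    lifted : ∀ {k n m} .(e : suc k ≡ n + m) (x : T.Op n) (i : Fin n) (y : T.Op m) →
      f (S.comp e (g x) i (g y)) ≡ T.comp e x i y
    lifted e x i y = trans (f-comp e _ i _) (cong₂ (λ u v → T.comp e u i v) (fg x) (fg y))

-- The set operad of alternating Schröder trees as a retract of binary trees.

module AlternatingSchröder (γ : ℕ) where
  open Contraction (Fin._≟_ {γ})
  open AlternatingSchröderTree using (tree)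
  private
    module B = RawSetOperad (freeRawSetOperad (Fin._≟_ {γ}))
    module T = RawSetOperad (alternatingSchröderRawSetOperad γ)

    ext : ∀ {n} {s t : AlternatingSchröderTree γ n} → tree s ≡ tree t → s ≡ t
    ext refl = refl

  contractTree : ∀ {n} → BinaryTreeOfArity (Fin γ) n → AlternatingSchröderTree γ n
  contractTree (mkBinaryTree t p) = mkAlternatingSchröderTree
    (contract t) (Schröder-contract t) (Alternating-contract t) (trans (leaves-contract t) p)

  expandTree : ∀ {n} → AlternatingSchröderTree γ n → BinaryTreeOfArity (Fin γ) n
  expandTree (mkAlternatingSchröderTree t h g p) = mkBinaryTree (expand t)
    (trans (sym (leaves-contract (expand t))) (trans (cong leaves (contract-expand h g)) p))

  contractTree-expandTree : ∀ {n} (t : AlternatingSchröderTree γ n) → contractTree (expandTree t) ≡ t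
  contractTree-expandTree (mkAlternatingSchröderTree t h g p) =
    ext (recompute (labeledTree-≟ Fin._≟_ _ _) (contract-expand h g))

  contractTree-comp : ∀ {k n m} .(e : suc k ≡ n + m) (s : B.Op n) (i : Fin n) (t : B.Op m) →
    contractTree (B.comp e s i t) ≡ T.comp e (contractTree s) i (contractTree t)
  contractTree-comp e (mkBinaryTree s p) i (mkBinaryTree t q) =
    ext (contract-graft s t _ _ (trans (Fin.toℕ-cast _ i) (sym (Fin.toℕ-cast _ i))))

  alternatingSchröderIsSetOperad : IsSetOperad (alternatingSchröderRawSetOperad γ)
  alternatingSchröderIsSetOperad = transferIsSetOperad (freeIsSetOperad Fin._≟_)
    contractTree expandTree contractTree-expandTree refl contractTree-comp

  -- Both composites are the node labeled `a` with three leaves, being contractions of the two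
  -- binary trees with three leaves and all labels `a`.
  contractTree-associative : ∀ a → let x = contractTree (corolla Fin._≟_ a) in
    T.comp {3} refl x zero x ≡ T.comp refl x (suc zero) x
  contractTree-associative a = trans (sym (contractTree-comp refl c zero c))
    (trans (ext (cong (node a) (trans (cong (_++ leaf ∷ []) (attach-same a _))
                                      (cong (leaf ∷_) (sym (attach-same a _))))))
           (contractTree-comp refl c (suc zero) c))
    where c = corolla Fin._≟_ a

-- Möbius inversion on a finite chain, in an abelian group.

module PrefixSums {a ℓ} (A : AbelianGroup a ℓ) where
  open AbelianGroup A
  open AbelianGroupProperties A
  open SetoidReasoning setoid
  private module ≈ = AbelianGroup A

  prefixSum : ∀ {n} → (Fin n → Carrier) → Fin n → Carrier
  prefixSum F zero    = F zero
  prefixSum F (suc i) = F (suc i) ∙ prefixSum (F ∘ inject₁) i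

  -- At `zero` the missing predecessor counts as `ε`, which makes this the two-sided inverse of
  -- `prefixSum`.
  difference : ∀ {n} → (Fin n → Carrier) → Fin n → Carrier
  difference F zero    = F zero
  difference F (suc i) = F (suc i) ∙ F (inject₁ i) ⁻¹

  prefixSum-cong : ∀ {n} {F G : Fin n → Carrier} → (∀ i → F i ≈ G i) →
    ∀ i → prefixSum F i ≈ prefixSum G i
  prefixSum-cong h zero    = h zero
  prefixSum-cong h (suc i) = ∙-cong (h (suc i)) (prefixSum-cong (h ∘ inject₁) i)

  difference-cong : ∀ {n} {F G : Fin n → Carrier} → (∀ i → F i ≈ G i) →
    ∀ i → difference F i ≈ difference G i
  difference-cong h zero    = h zero
  difference-cong h (suc i) = ∙-cong (h (suc i)) (⁻¹-cong (h (inject₁ i)))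

  difference-ε : ∀ {n} {F : Fin n → Carrier} → (∀ i → F i ≈ ε) → ∀ i → difference F i ≈ ε
  difference-ε h zero    = h zero
  difference-ε h (suc i) = ≈.trans (∙-cong (h (suc i)) (⁻¹-cong (h (inject₁ i)))) (inverseʳ ε)

  prefixSum-inject₁ : ∀ {n} (F : Fin (suc n) → Carrier) i →
    prefixSum F (inject₁ i) ≈ prefixSum (F ∘ inject₁) i
  prefixSum-inject₁ F zero    = ≈.refl
  prefixSum-inject₁ F (suc i) = ∙-congˡ (prefixSum-inject₁ (F ∘ inject₁) i)

  difference-inject₁ : ∀ {n} (F : Fin (suc n) → Carrier) i →
    difference F (inject₁ i) ≈ difference (F ∘ inject₁) i
  difference-inject₁ F zero    = ≈.refl
  difference-inject₁ F (suc i) = ≈.refl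

  difference-prefixSum : ∀ {n} (F : Fin n → Carrier) i → difference (prefixSum F) i ≈ F i
  difference-prefixSum F zero    = ≈.refl
  difference-prefixSum F (suc i) = begin
    (F (suc i) ∙ prefixSum (F ∘ inject₁) i) ∙ prefixSum F (inject₁ i) ⁻¹
      ≈⟨ ∙-congˡ (⁻¹-cong (prefixSum-inject₁ F i)) ⟩
    (F (suc i) ∙ prefixSum (F ∘ inject₁) i) ∙ prefixSum (F ∘ inject₁) i ⁻¹
      ≈⟨ //-rightDividesʳ _ _ ⟩
    F (suc i) ∎

  prefixSum-difference : ∀ {n} (F : Fin n → Carrier) i → prefixSum (difference F) i ≈ F i
  prefixSum-difference F zero    = ≈.refl
  prefixSum-difference F (suc i) = begin
    (F (suc i) ∙ F (inject₁ i) ⁻¹) ∙ prefixSum (difference F ∘ inject₁) i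
      ≈⟨ ∙-congˡ (≈.trans (prefixSum-cong (difference-inject₁ F) i) (prefixSum-difference (F ∘ inject₁) i)) ⟩
    (F (suc i) ∙ F (inject₁ i) ⁻¹) ∙ F (inject₁ i)
      ≈⟨ //-rightDividesˡ _ _ ⟩
    F (suc i) ∎

IsAdditive : ∀ {a ℓ b ℓ′} (A : AbelianGroup a ℓ) (B : AbelianGroup b ℓ′) →
  (AbelianGroup.Carrier A → AbelianGroup.Carrier B) → Set (a ⊔ ℓ ⊔ ℓ′)
IsAdditive A B = GroupMorphisms.IsGroupHomomorphism (AbelianGroup.rawGroup A) (AbelianGroup.rawGroup B)

module _ {a ℓ b ℓ′} (A : AbelianGroup a ℓ) (B : AbelianGroup b ℓ′) where
  private
    module A = AbelianGroup A
    module B = AbelianGroup B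
  open B using (_≈_)
  open PrefixSums
  open GroupMorphisms A.rawGroup B.rawGroup using (IsGroupHomomorphism)
  open AbelianGroupProperties B using (identityʳ-unique; inverseˡ-unique)

  additive⇒isGroupHomomorphism : (h : A.Carrier → B.Carrier) →
    (∀ {x y} → x A.≈ y → h x ≈ h y) → (∀ x y → h (x A.∙ y) ≈ h x B.∙ h y) →
    IsGroupHomomorphism h
  additive⇒isGroupHomomorphism h h-cong h-∙ = record
    { isMonoidHomomorphism = record
      { isMagmaHomomorphism = record
        { isRelHomomorphism = record { cong = h-cong }
        ; homo              = h-∙
        }
      ; ε-homo = h-ε
      }
    ; ⁻¹-homo = λ x → inverseˡ-unique _ _
        (B.trans (B.sym (h-∙ _ _)) (B.trans (h-cong (A.inverseˡ x)) h-ε))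
    }
    where
    h-ε : h A.ε ≈ B.ε
    h-ε = identityʳ-unique _ _ (B.trans (B.sym (h-∙ _ _)) (h-cong (A.identityˡ A.ε)))

  module _ {h : A.Carrier → B.Carrier} (isHomo : IsGroupHomomorphism h) where
    open IsGroupHomomorphism isHomo

    prefixSum-homo : ∀ {n} (F : Fin n → A.Carrier) i → h (prefixSum A F i) ≈ prefixSum B (h ∘ F) i
    prefixSum-homo F zero    = B.refl
    prefixSum-homo F (suc i) = B.trans (homo _ _) (B.∙-congˡ (prefixSum-homo (F ∘ inject₁) i))

    difference-homo : ∀ {n} (F : Fin n → A.Carrier) i → h (difference A F i) ≈ difference B (h ∘ F) i
    difference-homo F zero    = B.refl
    difference-homo F (suc i) = B.trans (homo _ _) (B.∙-congˡ (⁻¹-homo _))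

-- Operad homomorphisms out of quotients and out of linearized set operads.

module LinearExtension {c ℓ} (R : CommutativeRing c ℓ) where
  open Linear R
  private module K = CommutativeRing R
  open K using (_≈_; 0#; 1#)

  record Homomorphism {m ℓm m′ ℓm′} (P : RawOperad m ℓm) (Q : RawOperad m′ ℓm′) :
                      Set (c ⊔ m ⊔ ℓm ⊔ m′ ⊔ ℓm′) where
    private
      module P = RawOperad P
      module Q = RawOperad Q
    open P.Space using () renaming (_≈ᴹ_ to _≈₁_; _+ᴹ_ to _+₁_; _*ₗ_ to _*₁_)
    open Q.Space using (_≈ᴹ_; _+ᴹ_; _*ₗ_)
    field
      to        : ∀ {n} → P.Op n → Q.Op n
      to-cong   : ∀ {n} {x y : P.Op n} → x ≈₁ y → to x ≈ᴹ to y
      +-homo    : ∀ {n} (x y : P.Op n) → to (x +₁ y) ≈ᴹ to x +ᴹ to y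
      *-homo    : ∀ {n} a (x : P.Op n) → to (a *₁ x) ≈ᴹ a *ₗ to x
      unit-homo : to P.unit ≈ᴹ Q.unit
      comp-homo : ∀ {k n m} .(e : suc k ≡ n + m) (x : P.Op n) (i : Fin n) (y : P.Op m) →
                  to (P.comp e x i y) ≈ᴹ Q.comp e (to x) i (to y)

    isGroupHomomorphism : ∀ n →
      IsAdditive (LeftModule.+ᴹ-abelianGroup (P.space n)) (LeftModule.+ᴹ-abelianGroup (Q.space n)) to
    isGroupHomomorphism n = additive⇒isGroupHomomorphism
      (LeftModule.+ᴹ-abelianGroup (P.space n)) (LeftModule.+ᴹ-abelianGroup (Q.space n)) to to-cong +-homo

  open Homomorphism

  idᴴ : ∀ {m ℓm} (P : Operad m ℓm) → Homomorphism (Operad.rawOperad P) (Operad.rawOperad P)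
  idᴴ P = record
    { to        = id
    ; to-cong   = id
    ; +-homo    = λ _ _ → P.Space.≈ᴹ-refl
    ; *-homo    = λ _ _ → P.Space.≈ᴹ-refl
    ; unit-homo = P.Space.≈ᴹ-refl
    ; comp-homo = λ _ _ _ _ → P.Space.≈ᴹ-refl
    }
    where module P = Operad P

  module _ {m ℓm r} (P : Operad m ℓm) {d : ℕ} (Rel : Operad.Op P d → Set r) where
    private
      module P = Operad P
      module Q = Operad (quotient P Rel)
      open P.Space using (-ᴹ‿inverseʳ; ≈ᴹ-sym; ≈ᴹ-trans; +ᴹ-congʳ)

    -- A quotient keeps the carrier and coarsens the equality, so the projection is the identity
    -- function and only `to-cong` has content.
    projection : Homomorphism P.rawOperad Q.rawOperad
    projection = record
      { to        = id
      ; to-cong   = λ p → mk~ (resp-≈ (≈ᴹ-sym (≈ᴹ-trans (+ᴹ-congʳ p) (-ᴹ‿inverseʳ _))) 0-closed)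
      ; +-homo    = λ _ _ → Q.Space.≈ᴹ-refl
      ; *-homo    = λ _ _ → Q.Space.≈ᴹ-refl
      ; unit-homo = Q.Space.≈ᴹ-refl
      ; comp-homo = λ _ _ _ _ → Q.Space.≈ᴹ-refl
      }

    module _ {m′ ℓm′} (T : Operad m′ ℓm′) (h : Homomorphism P.rawOperad (Operad.rawOperad T))
             (h-Rel : ∀ {x} → Rel x → Operad.Space._≈ᴹ_ T (to h x) (Operad.Space.0ᴹ T)) where
      private
        module T = Operad T
        module M {n : ℕ} where
          open T.Space {n} public
          open AbelianGroupProperties +ᴹ-abelianGroup public

      comp-0ˡ : ∀ {k n l} .(e : suc k ≡ n + l) (i : Fin n) (y : T.Op l) →
        T.comp e M.0ᴹ i y M.≈ᴹ M.0ᴹ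
      comp-0ˡ e i y = M.≈ᴹ-trans (T.comp-cong e i (M.≈ᴹ-sym (M.*ₗ-zeroˡ M.0ᴹ)) M.≈ᴹ-refl)
        (M.≈ᴹ-trans (T.comp-*ˡ e 0# M.0ᴹ i y) (M.*ₗ-zeroˡ _))

      comp-0ʳ : ∀ {k n l} .(e : suc k ≡ n + l) (x : T.Op n) (i : Fin n) →
        T.comp e x i (M.0ᴹ {l}) M.≈ᴹ M.0ᴹ
      comp-0ʳ e x i = M.≈ᴹ-trans (T.comp-cong e i M.≈ᴹ-refl (M.≈ᴹ-sym (M.*ₗ-zeroˡ M.0ᴹ)))
        (M.≈ᴹ-trans (T.comp-*ʳ e 0# x i M.0ᴹ) (M.*ₗ-zeroˡ _))

      -- The kernel of a homomorphism is closed under every rule that generates the ideal; for the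
      -- two composition rules this needs that composing with zero gives zero.
      vanishes-on-Ideal : ∀ {n} {x : P.Op n} → Ideal P.rawOperad Rel x → to h x M.≈ᴹ M.0ᴹ
      vanishes-on-Ideal (generator r)  = h-Rel r
      vanishes-on-Ideal (resp-≈ p x)   = M.≈ᴹ-trans (to-cong h (≈ᴹ-sym p)) (vanishes-on-Ideal x)
      vanishes-on-Ideal 0-closed       = GroupMorphisms.IsGroupHomomorphism.ε-homo (isGroupHomomorphism h _)
      vanishes-on-Ideal (+-closed x y) = M.≈ᴹ-trans (+-homo h _ _)
        (M.≈ᴹ-trans (M.+ᴹ-cong (vanishes-on-Ideal x) (vanishes-on-Ideal y)) (M.+ᴹ-identityˡ _))
      vanishes-on-Ideal (*-closed a x) = M.≈ᴹ-trans (*-homo h a _)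
        (M.≈ᴹ-trans (M.*ₗ-cong K.refl (vanishes-on-Ideal x)) (M.*ₗ-zeroʳ a))
      vanishes-on-Ideal (compˡ e i y x) = M.≈ᴹ-trans (comp-homo h e _ i y)
        (M.≈ᴹ-trans (T.comp-cong e i (vanishes-on-Ideal x) M.≈ᴹ-refl) (comp-0ˡ e i _))
      vanishes-on-Ideal (compʳ e x i y) = M.≈ᴹ-trans (comp-homo h e x i _)
        (M.≈ᴹ-trans (T.comp-cong e i M.≈ᴹ-refl (vanishes-on-Ideal y)) (comp-0ʳ e _ i))

      fromQuotient : Homomorphism Q.rawOperad T.rawOperad
      fromQuotient = record
        { to        = to h
        ; to-cong   = λ {_} {x} {y} p → M.x∙y⁻¹≈ε⇒x≈y _ _
            (M.≈ᴹ-trans (M.+ᴹ-congˡ (M.≈ᴹ-sym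
              (GroupMorphisms.IsGroupHomomorphism.⁻¹-homo (isGroupHomomorphism h _) y)))
            (M.≈ᴹ-trans (M.≈ᴹ-sym (+-homo h x _)) (vanishes-on-Ideal (CongruentModulo.difference p))))
        ; +-homo    = +-homo h
        ; *-homo    = *-homo h
        ; unit-homo = unit-homo h
        ; comp-homo = comp-homo h
        }

  bind : ∀ {X Y : Set} → (X → FormalSum Y) → FormalSum X → FormalSum Y
  bind F []            = []
  bind F ((a , x) ∷ f) = scale a (F x) ++ bind F f

  -- Testing against a functional `G` turns each of the following identities between formal sums
  -- into an identity between iterated sums of scalars.
  sum-bind : ∀ {X Y : Set} G (F : X → FormalSum Y) f → sum G (bind F f) ≈ sum (λ x → sum G (F x)) f
  sum-bind G F []            = K.refl
  sum-bind G F ((a , x) ∷ f) =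
    K.trans (sum-++ G (scale a (F x)) _) (K.+-cong (sum-scale G a (F x)) (sum-bind G F f))

  module _ {X Y : Set} (_≟ˣ_ : DecidableEquality X) (_≟_ : DecidableEquality Y) where
    open FormalSums _≟_
    open SetoidReasoning K.setoid

    bind-resp-≋ : ∀ (F : X → FormalSum Y) {f g} → FormalSums._≋_ _≟ˣ_ f g → bind F f ≋ bind F g
    bind-resp-≋ F {f} {g} p = mk≋ λ z → begin
      coefficient (bind F f) z            ≈⟨ sum-bind (δ z) F f ⟩
      sum (λ x → coefficient (F x) z) f   ≈⟨ FormalSums.sum-resp-≋ _≟ˣ_ _ p ⟩
      sum (λ x → coefficient (F x) z) g   ≈⟨ sum-bind (δ z) F g ⟨
      coefficient (bind F g) z            ∎

  module _ {X : Set} (_≟_ : DecidableEquality X) where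
    open FormalSums _≟_
    open SetoidReasoning K.setoid

    bind-cong : ∀ {Y : Set} {F G : Y → FormalSum X} → (∀ y → F y ≋ G y) → ∀ f → bind F f ≋ bind G f
    bind-cong {F = F} {G} h f = mk≋ λ z → begin
      coefficient (bind F f) z            ≈⟨ sum-bind (δ z) F f ⟩
      sum (λ x → coefficient (F x) z) f   ≈⟨ sum-cong (λ x → coefficients (h x) z) f ⟩
      sum (λ x → coefficient (G x) z) f   ≈⟨ sum-bind (δ z) G f ⟨
      coefficient (bind G f) z            ∎

    bind-basis : ∀ {Y : Set} (F : Y → FormalSum X) y → bind F (basis y) ≋ F y
    bind-basis F y = mk≋ λ z → K.trans (sum-bind (δ z) F (basis y)) (sum-basis (λ x → sum (δ z) (F x)) y)

    bind-identity : ∀ f → bind basis f ≋ f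
    bind-identity f = mk≋ λ z → K.trans (sum-bind (δ z) basis f) (sum-cong (sum-basis (δ z)) f)

    bind-assoc : ∀ {Y Z : Set} (F : Y → FormalSum X) (G : Z → FormalSum Y) f →
      bind F (bind G f) ≋ bind (λ z → bind F (G z)) f
    bind-assoc F G f = mk≋ λ z → begin
      sum (δ z) (bind F (bind G f))                  ≈⟨ sum-bind (δ z) F (bind G f) ⟩
      sum (λ x → sum (δ z) (F x)) (bind G f)         ≈⟨ sum-bind _ G f ⟩
      sum (λ y → sum (λ x → sum (δ z) (F x)) (G y)) f ≈⟨ sum-cong (λ y → sum-bind (δ z) F (G y)) f ⟨
      sum (λ y → sum (δ z) (bind F (G y))) f         ≈⟨ sum-bind (δ z) _ f ⟨
      sum (δ z) (bind (λ z → bind F (G z)) f)        ∎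

    bilinear-basis : ∀ {Y Z : Set} (H : Y → Z → X) y z → bilinear H (basis y) (basis z) ≋ basis (H y z)
    bilinear-basis H y z = mk≋ λ x → begin
      sum (δ x) (bilinear H (basis y) (basis z))          ≈⟨ sum-bilinear (δ x) H (basis y) (basis z) ⟩
      sum (λ u → sum (λ v → δ x (H u v)) (basis z)) (basis y)
        ≈⟨ sum-basis (λ u → sum (λ v → δ x (H u v)) (basis z)) y ⟩
      sum (λ v → δ x (H y v)) (basis z)                   ≈⟨ sum-basis (λ v → δ x (H y v)) z ⟩
      δ x (H y z)                                         ≈⟨ sum-basis (δ x) (H y z) ⟨
      sum (δ x) (basis (H y z))                           ∎

    bind-bilinear : ∀ {U V W : Set} (F : W → FormalSum X) (H : U → V → W) f g →
      bind F (bilinear H f g) ≋ bind (λ u → bind (λ v → F (H u v)) g) f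
    bind-bilinear F H f g = mk≋ λ z → begin
      sum (δ z) (bind F (bilinear H f g))                      ≈⟨ sum-bind (δ z) F (bilinear H f g) ⟩
      sum (λ w → sum (δ z) (F w)) (bilinear H f g)             ≈⟨ sum-bilinear _ H f g ⟩
      sum (λ u → sum (λ v → sum (δ z) (F (H u v))) g) f        ≈⟨ sum-cong (λ u → sum-bind (δ z) _ g) f ⟨
      sum (λ u → sum (δ z) (bind (λ v → F (H u v)) g)) f       ≈⟨ sum-bind (δ z) _ f ⟨
      sum (δ z) (bind (λ u → bind (λ v → F (H u v)) g) f)      ∎

    bilinear-bind : ∀ {U V U′ V′ : Set} (H : U′ → V′ → X) (F : U → FormalSum U′) (G : V → FormalSum V′)
      f g →
      bilinear H (bind F f) (bind G g) ≋ bind (λ u → bind (λ v → bilinear H (F u) (G v)) g) f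
    bilinear-bind H F G f g = mk≋ λ z → begin
      sum (δ z) (bilinear H (bind F f) (bind G g))
        ≈⟨ sum-bilinear (δ z) H (bind F f) (bind G g) ⟩
      sum (λ u′ → sum (λ v′ → δ z (H u′ v′)) (bind G g)) (bind F f)
        ≈⟨ sum-bind _ F f ⟩
      sum (λ u → sum (λ u′ → sum (λ v′ → δ z (H u′ v′)) (bind G g)) (F u)) f
        ≈⟨ sum-cong (λ u → sum-cong (λ u′ → sum-bind _ G g) (F u)) f ⟩
      sum (λ u → sum (λ u′ → sum (λ v → sum (λ v′ → δ z (H u′ v′)) (G v)) g) (F u)) f
        ≈⟨ sum-cong (λ u → sum-swap _ (F u) g) f ⟩
      sum (λ u → sum (λ v → sum (λ u′ → sum (λ v′ → δ z (H u′ v′)) (G v)) (F u)) g) f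
        ≈⟨ sum-cong (λ u → sum-cong (λ v → sum-bilinear (δ z) H (F u) (G v)) g) f ⟨
      sum (λ u → sum (λ v → sum (δ z) (bilinear H (F u) (G v))) g) f
        ≈⟨ sum-cong (λ u → sum-bind (δ z) _ g) f ⟨
      sum (λ u → sum (δ z) (bind (λ v → bilinear H (F u) (G v)) g)) f
        ≈⟨ sum-bind (δ z) _ f ⟨
      sum (δ z) (bind (λ u → bind (λ v → bilinear H (F u) (G v)) g) f) ∎

  -- π is either the identity or a projection to a quotient; compatibility of F
  -- with the operad structure is needed only after applying π.
  module _ (T : RawSetOperad) {m ℓm} (Q : Operad m ℓm)
           (π : Homomorphism (linearRawOperad T) (Operad.rawOperad Q)) where
    private
      module T = RawSetOperad T
      module Q = Operad Q
      module M {n : ℕ} where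
        open Q.Space {n} public
      module F {n : ℕ} = LeftModule (RawOperad.space (linearRawOperad T) n)

    -- The values of `F` and `G` may agree only in the quotient, where coefficients are not defined.
    -- The argument therefore goes term by term through the linearity of `π`.
    image-bind-cong : ∀ {X : Set} {n} {F G : X → FormalSum (T.Op n)} →
      (∀ x → to π (F x) M.≈ᴹ to π (G x)) → ∀ f → to π (bind F f) M.≈ᴹ to π (bind G f)
    image-bind-cong h []            = M.≈ᴹ-refl
    image-bind-cong h ((a , x) ∷ f) =
      M.≈ᴹ-trans (+-homo π _ _) (M.≈ᴹ-trans
        (M.+ᴹ-cong
          (M.≈ᴹ-trans (*-homo π a _) (M.≈ᴹ-trans (M.*ₗ-cong K.refl (h x)) (M.≈ᴹ-sym (*-homo π a _))))
          (image-bind-cong h f))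
        (M.≈ᴹ-sym (+-homo π _ _)))

    module _ (S : RawSetOperad) where
      private module S = RawSetOperad S

      bindHomomorphism : (F : ∀ {n} → S.Op n → FormalSum (T.Op n)) →
        to π (F S.unit) M.≈ᴹ Q.unit →
        (∀ {k n m} .(e : suc k ≡ n + m) (x : S.Op n) (i : Fin n) (y : S.Op m) →
          to π (F (S.comp e x i y)) M.≈ᴹ Q.comp e (to π (F x)) i (to π (F y))) →
        Homomorphism (linearRawOperad S) Q.rawOperad
      bindHomomorphism F F-unit F-comp = record
        { to        = λ f → to π (bind F f)
        ; to-cong   = λ p → to-cong π (bind-resp-≋ S._≟_ T._≟_ F p)
        ; +-homo    = λ f g → M.≈ᴹ-trans
            (to-cong π (FormalSums.mk≋ λ z → K.trans (sum-bind _ F (f ++ g))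
              (K.trans (sum-++ _ f g) (K.trans (K.sym (K.+-cong (sum-bind _ F f) (sum-bind _ F g)))
                (K.sym (sum-++ _ (bind F f) (bind F g)))))))
            (+-homo π _ _)
        ; *-homo    = λ a f → M.≈ᴹ-trans
            (to-cong π (FormalSums.mk≋ λ z → K.trans (sum-bind _ F (scale a f))
              (K.trans (sum-scale _ a f) (K.trans (K.*-congˡ (K.sym (sum-bind _ F f)))
                (K.sym (sum-scale _ a (bind F f)))))))
            (*-homo π a _)
        ; unit-homo = M.≈ᴹ-trans (to-cong π (bind-basis T._≟_ F S.unit)) F-unit
        ; comp-homo = λ e f i g → M.≈ᴹ-trans
            (to-cong π (bind-bilinear T._≟_ F _ f g)) (M.≈ᴹ-trans
            (image-bind-cong (λ x → image-bind-cong (λ y →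
              M.≈ᴹ-trans (F-comp e x i y) (M.≈ᴹ-sym (comp-homo π e (F x) i (F y)))) g) f) (M.≈ᴹ-trans
            (to-cong π (F.≈ᴹ-sym (bilinear-bind T._≟_ _ F F f g)))
            (comp-homo π e (bind F f) i (bind F g))))
        }

  -- Evaluation of binary trees in an operad, and its invariance under associativity.

  module Evaluation {G : Set} {m ℓm} (Q : Operad m ℓm) (q : G → Operad.Op Q 2) where
    private
      module Q = Operad Q
      module M {n : ℕ} where
        open Q.Space {n} public

    -- The arity is a separate index, known to be leavesᵇ t only irrelevantly, so
    -- that no transport along arity equations appears.
    eval : (t : BinaryTree G) → ∀ {n} → .(leavesᵇ t ≡ n) → Q.Op n
    eval leaf {zero}        ()
    eval leaf {suc zero}    p = Q.unit
    eval leaf {suc (suc _)} ()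
    eval (node a l r) p =
      -- The right subtree goes in first: input `zero` then keeps its position, and the intermediate
      -- arity `suc (leavesᵇ r)` holds by computation.
      Q.comp (cong suc (trans (sym p) (ℕ.+-comm (leavesᵇ l) _)))
        (Q.comp refl (q a) (suc zero) (eval r refl)) zero (eval l refl)

    eval-node : ∀ {n n₁ n₂} a l r .(p : leavesᵇ l + leavesᵇ r ≡ n)
      .(p₁ : leavesᵇ l ≡ n₁) .(p₂ : leavesᵇ r ≡ n₂) .(e : suc n ≡ suc n₂ + n₁) →
      eval (node a l r) {n} p ≡ Q.comp e (Q.comp refl (q a) (suc zero) (eval r p₂)) zero (eval l p₁)
    eval-node {n₁ = n₁} {n₂} a l r p p₁ p₂ e
      with recompute (leavesᵇ l ℕ.≟ n₁) p₁ | recompute (leavesᵇ r ℕ.≟ n₂) p₂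
    ... | refl | refl = refl

    eval-cong : ∀ {s t n} → s ≡ t → .(p : leavesᵇ s ≡ n) .(p′ : leavesᵇ t ≡ n) → eval s p ≡ eval t p′
    eval-cong refl _ _ = refl

    -- Grafting into the left subtree is one use of the sequential axiom. Grafting into the right
    -- one uses it inside the inner composite, and then the parallel axiom to exchange `t` with the
    -- left subtree, which is composed last.
    eval-graft : ∀ s t {n m k} .(p : leavesᵇ s ≡ n) .(p′ : leavesᵇ t ≡ m) .(e : suc k ≡ n + m)
      (j : Fin (leavesᵇ s)) (i : Fin n) .(p″ : leavesᵇ (graft s j t) ≡ k) → toℕ j ≡ toℕ i →
      eval (graft s j t) p″ M.≈ᴹ Q.comp e (eval s p) i (eval t p′)
    eval-graft leaf t {suc zero} {m} {k} p p′ e zero zero p″ _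
      with recompute (m ℕ.≟ k) (trans (sym p′) p″)
    ... | refl = M.≈ᴹ-sym (Q.identityˡ e zero (eval t p′))
    eval-graft (node a l r) t {n} {m} {k} p p′ e j i p″ eq with splitAt-toℕ (leavesᵇ l) j
    ... | inj₁ (j₁ , eq₁) = begin
      eval (graft (node a l r) j t) p″
        ≈⟨ M.≈ᴹ-reflexive (eval-cong (graft-left a l r t j j₁ eq₁) p″
             (trans (cong leavesᵇ (sym (graft-left a l r t j j₁ eq₁))) p″)) ⟩
      eval (node a (graft l j₁ t) r) (trans (cong leavesᵇ (sym (graft-left a l r t j j₁ eq₁))) p″)
        ≈⟨ Q.comp-cong _ zero M.≈ᴹ-refl (eval-graft l t refl p′ (e₁ p′) j₁ j₁ refl refl) ⟩
      Q.comp _ X zero (Q.comp (e₁ p′) (eval l refl) j₁ (eval t p′))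
        ≈⟨ Q.sequential _ e (e₁ p′) _ X zero (eval l refl) j₁ (eval t p′) i (trans (sym eq) eq₁) ⟨
      Q.comp e (eval (node a l r) p) i (eval t p′) ∎
      where
      open SetoidReasoning M.≈ᴹ-setoid
      X = Q.comp refl (q a) (suc zero) (eval r refl)
      e₁ : leavesᵇ t ≡ m → suc (leavesᵇ (graft l j₁ t)) ≡ leavesᵇ l + m
      e₁ p′ = trans (leaves-graft l j₁ t) (cong (leavesᵇ l +_) p′)
    ... | inj₂ (j₂ , eq₂) = begin
      eval (graft (node a l r) j t) p″
        ≈⟨ M.≈ᴹ-reflexive (eval-cong (graft-right a l r t j j₂ eq₂) p″
             (trans (cong leavesᵇ (sym (graft-right a l r t j j₂ eq₂))) p″)) ⟩
      eval (node a l (graft r j₂ t)) (trans (cong leavesᵇ (sym (graft-right a l r t j j₂ eq₂))) p″)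
        ≈⟨ Q.comp-cong _ zero (Q.comp-cong refl (suc zero) M.≈ᴹ-refl
             (eval-graft r t refl p′ (e₂ p′) j₂ j₂ refl refl)) M.≈ᴹ-refl ⟩
      Q.comp _ (Q.comp refl (q a) (suc zero) (Q.comp (e₂ p′) (eval r refl) j₂ (eval t p′))) zero (eval l refl)
        -- Leaf `j₂` of `r` is input `suc j₂` while input `zero` is still open, and becomes input
        -- `i` once `l` fills the latter.
        ≈⟨ Q.comp-cong _ zero (Q.sequential refl (e₁ p′) (e₂ p′) refl
             (q a) (suc zero) (eval r refl) j₂ (eval t p′) (suc j₂) refl) M.≈ᴹ-refl ⟨
      Q.comp _ (Q.comp (e₁ p′) X (suc j₂) (eval t p′)) zero (eval l refl)
        ≈⟨ Q.parallel (e₁ p′) _ _ e X zero (suc j₂) (eval t p′) (eval l refl) zero i (s≤s z≤n) refl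
             (cong suc (trans (sym eq) (trans eq₂ (ℕ.+-comm (leavesᵇ l) _)))) ⟩
      Q.comp e (eval (node a l r) p) i (eval t p′) ∎
      where
      open SetoidReasoning M.≈ᴹ-setoid
      X = Q.comp refl (q a) (suc zero) (eval r refl)
      e₂ : leavesᵇ t ≡ m → suc (leavesᵇ (graft r j₂ t)) ≡ leavesᵇ r + m
      e₂ p′ = trans (leaves-graft r j₂ t) (cong (leavesᵇ r +_) p′)
      e₁ : leavesᵇ t ≡ m → suc (suc (leavesᵇ (graft r j₂ t))) ≡ suc (leavesᵇ r) + m
      e₁ p′ = cong suc (e₂ p′)

    evaluate : ∀ {n} → BinaryTreeOfArity G n → Q.Op n
    evaluate (mkBinaryTree t p) = eval t p

    module _ (_≟_ : DecidableEquality G) where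
      private module B = RawSetOperad (freeRawSetOperad _≟_)

      evaluate-comp : ∀ {k n m} .(e : suc k ≡ n + m) (s : B.Op n) (i : Fin n) (t : B.Op m) →
        evaluate (B.comp e s i t) M.≈ᴹ Q.comp e (evaluate s) i (evaluate t)
      evaluate-comp e (mkBinaryTree s p) i (mkBinaryTree t q) =
        eval-graft s t p q e (Fin.cast (sym p) i) i _ (Fin.toℕ-cast _ i)

    eval-corolla : ∀ a → eval (node a leaf leaf) refl M.≈ᴹ q a
    eval-corolla a = M.≈ᴹ-trans (Q.identityʳ refl _ zero) (Q.identityʳ refl (q a) (suc zero))

    module _ (associative : ∀ a → Q.comp {3} refl (q a) zero (q a) M.≈ᴹ Q.comp refl (q a) (suc zero) (q a)) where

      -- In the case `assoc` both sides arise from a tree with three leaves by grafting `x`, `y` and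
      -- `z` on them, so associativity of `q a` in arity 3 is enough.
      eval-∼ : ∀ {s t} → s ∼ t → ∀ {n} .(p : leavesᵇ s ≡ n) .(p′ : leavesᵇ t ≡ n) →
        eval s p M.≈ᴹ eval t p′
      eval-∼ (assoc {a} {x} {y} {z}) {n} p p′ = begin
        eval (node a (node a x y) z) p
          ≈⟨ decompose (node a (node a leaf leaf) leaf) refl (suc (suc zero)) (suc zero) zero refl refl refl p ⟩
        threefold p (eval (node a (node a leaf leaf) leaf) refl)
          ≈⟨ Q.comp-cong _ zero (Q.comp-cong _ (suc zero)
               (Q.comp-cong _ (suc (suc zero)) three M.≈ᴹ-refl) M.≈ᴹ-refl) M.≈ᴹ-refl ⟩
        threefold p (eval (node a leaf (node a leaf leaf)) refl)
          ≈⟨ decompose (node a leaf (node a leaf leaf)) refl (suc (suc zero)) (suc zero) zero refl refl refl p′ ⟨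
        eval (node a x (node a y z)) p′ ∎
        where
        open SetoidReasoning M.≈ᴹ-setoid
        corollas : ∀ j i → toℕ j ≡ toℕ i → .(p : leavesᵇ (graft (node a leaf leaf) j (node a leaf leaf)) ≡ 3) →
          eval (graft (node a leaf leaf) j (node a leaf leaf)) p M.≈ᴹ Q.comp refl (q a) i (q a)
        corollas j i eq p = M.≈ᴹ-trans (eval-graft (node a leaf leaf) (node a leaf leaf) refl refl refl j i p eq)
          (Q.comp-cong refl i (eval-corolla a) (eval-corolla a))
        three : eval (node a (node a leaf leaf) leaf) refl M.≈ᴹ eval (node a leaf (node a leaf leaf)) refl
        three = M.≈ᴹ-trans (corollas zero zero refl refl)
          (M.≈ᴹ-trans (associative a) (M.≈ᴹ-sym (corollas (suc zero) (suc zero) refl refl)))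
        arity : (leavesᵇ x + leavesᵇ y) + leavesᵇ z ≡ n → suc n ≡ suc (leavesᵇ z + leavesᵇ y) + leavesᵇ x
        arity p = cong suc (trans (sym p)
          (trans (ℕ.+-assoc (leavesᵇ x) _ _) (trans (ℕ.+-comm (leavesᵇ x) _)
            (cong (_+ leavesᵇ x) (ℕ.+-comm (leavesᵇ y) _)))))
        -- The inputs 2, 1, 0 are filled in this order, so that no grafting shifts a position still
        -- to be filled.
        threefold : .((leavesᵇ x + leavesᵇ y) + leavesᵇ z ≡ n) → Q.Op 3 → Q.Op n
        threefold p u = Q.comp (arity p)
          (Q.comp {suc (leavesᵇ z + leavesᵇ y)} refl
            (Q.comp {suc (suc (leavesᵇ z))} refl u (suc (suc zero)) (eval z refl))
            (suc zero) (eval y refl))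
          zero (eval x refl)
        decompose : ∀ u (p₀ : leavesᵇ u ≡ 3) (j₁ : Fin (leavesᵇ u)) (j₂ : Fin (leavesᵇ (graft u j₁ z)))
          (j₃ : Fin (leavesᵇ (graft (graft u j₁ z) j₂ y))) →
          toℕ j₁ ≡ 2 → toℕ j₂ ≡ 1 → toℕ j₃ ≡ 0 →
          .(p″ : leavesᵇ (graft (graft (graft u j₁ z) j₂ y) j₃ x) ≡ n) →
          eval (graft (graft (graft u j₁ z) j₂ y) j₃ x) p″ M.≈ᴹ threefold p (eval u p₀)
        decompose u p₀ j₁ j₂ j₃ eq₁ eq₂ eq₃ p″ =
          M.≈ᴹ-trans (eval-graft (graft (graft u j₁ z) j₂ y) x p₂ refl (arity p) j₃ zero p″ eq₃)
            (Q.comp-cong _ zero (M.≈ᴹ-trans (eval-graft (graft u j₁ z) y p₁ refl refl j₂ (suc zero) p₂ eq₂)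
              (Q.comp-cong _ (suc zero) (eval-graft u z p₀ refl refl j₁ (suc (suc zero)) p₁ eq₁) M.≈ᴹ-refl)) M.≈ᴹ-refl)
          where
          p₁ : leavesᵇ (graft u j₁ z) ≡ suc (suc (leavesᵇ z))
          p₁ = ℕ.suc-injective (trans (leaves-graft u j₁ z) (cong (_+ leavesᵇ z) p₀))
          p₂ : leavesᵇ (graft (graft u j₁ z) j₂ y) ≡ suc (leavesᵇ z + leavesᵇ y)
          p₂ = ℕ.suc-injective (trans (leaves-graft (graft u j₁ z) j₂ y) (cong (_+ leavesᵇ y) p₁))
      eval-∼ (node {a} {l} {l′} {r} {r′} h h′) {n} p p′ = begin
        eval (node a l r) p
          ≈⟨ Q.comp-cong _ zero (Q.comp-cong refl (suc zero) M.≈ᴹ-refl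
               (eval-∼ h′ refl (sym (leaves-∼ h′)))) (eval-∼ h refl (sym (leaves-∼ h))) ⟩
        Q.comp (e p) (Q.comp refl (q a) (suc zero) (eval r′ (sym (leaves-∼ h′)))) zero (eval l′ (sym (leaves-∼ h)))
          ≈⟨ M.≈ᴹ-reflexive (eval-node a l′ r′ p′ (sym (leaves-∼ h)) (sym (leaves-∼ h′)) (e p)) ⟨
        eval (node a l′ r′) p′ ∎
        where
        open SetoidReasoning M.≈ᴹ-setoid
        e : leavesᵇ l + leavesᵇ r ≡ n → suc n ≡ suc (leavesᵇ r) + leavesᵇ l
        e p = cong suc (trans (sym p) (ℕ.+-comm (leavesᵇ l) _))
      eval-∼ ∼-refl        p q = M.≈ᴹ-refl
      eval-∼ (∼-sym h)     p q = M.≈ᴹ-sym (eval-∼ h q p)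
      eval-∼ (∼-trans {s} {t} h h′) p q =
        M.≈ᴹ-trans (eval-∼ h p (trans (sym (leaves-∼ h)) p)) (eval-∼ h′ (trans (sym (leaves-∼ h)) p) q)

  module _ {G : Set} {m ℓm m′ ℓm′} (P : Operad m ℓm) (Q : Operad m′ ℓm′)
           (h : Homomorphism (Operad.rawOperad P) (Operad.rawOperad Q))
           (p : G → Operad.Op P 2) (q : G → Operad.Op Q 2)
           (h-p : ∀ a → Operad.Space._≈ᴹ_ Q (to h (p a)) (q a)) where
    private
      module Q = Operad Q
      module M {n : ℕ} where
        open Q.Space {n} public
      module EP = Evaluation P p
      module EQ = Evaluation Q q

    eval-natural : ∀ t {n} .(e : leavesᵇ t ≡ n) → to h (EP.eval t e) M.≈ᴹ EQ.eval t e
    eval-natural leaf {suc zero} e = unit-homo h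
    eval-natural (node a l r)    e =
      M.≈ᴹ-trans (comp-homo h _ _ zero _) (Q.comp-cong _ zero
        (M.≈ᴹ-trans (comp-homo h refl _ (suc zero) _)
          (Q.comp-cong refl (suc zero) (h-p a) (eval-natural r refl)))
        (eval-natural l refl))

  module _ {G : Set} (_≟_ : DecidableEquality G) {T : RawSetOperad} (isSetOperad : IsSetOperad T) where
    private
      module B = RawSetOperad (freeRawSetOperad _≟_)
      module T = RawSetOperad T
      module Q = Operad (linearOperad T isSetOperad)
      module M {n : ℕ} where
        open Q.Space {n} public

    -- Serves for two morphisms `f`. With the identity, a basis tree of `Free` is its own evaluation
    -- at the generators; with contraction, evaluation at the corollas of Schröder trees contracts.
    eval-basis : (f : ∀ {n} → B.Op n → T.Op n) → f B.unit ≡ T.unit →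
      (∀ {k n m} .(e : suc k ≡ n + m) (x : B.Op n) (i : Fin n) (y : B.Op m) →
        f (B.comp e x i y) ≡ T.comp e (f x) i (f y)) →
      ∀ t {n} .(e : leavesᵇ t ≡ n) →
      Evaluation.eval (linearOperad T isSetOperad) (λ a → basis (f (corolla _≟_ a))) t e M.≈ᴹ
      basis (f (mkBinaryTree t e))
    eval-basis f f-unit f-comp leaf {suc zero} e = M.≈ᴹ-reflexive (cong basis (sym f-unit))
    eval-basis f f-unit f-comp (node a l r) {n} e = begin
      Q.comp _ (Q.comp refl (basis x) (suc zero) (ev r refl)) zero (ev l refl)
        ≈⟨ Q.comp-cong _ zero (Q.comp-cong refl (suc zero) (M.≈ᴹ-refl {x = basis x}) (eval-basis f f-unit f-comp r refl))
             (eval-basis f f-unit f-comp l refl) ⟩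
      Q.comp _ (Q.comp refl (basis x) (suc zero) (basis (f r′))) zero (basis (f l′))
        ≈⟨ Q.comp-cong _ zero (bilinear-basis T._≟_ (λ x y → T.comp refl x (suc zero) y) x (f r′)) M.≈ᴹ-refl ⟩
      Q.comp (e′ e) (basis (T.comp refl x (suc zero) (f r′))) zero (basis (f l′))
        ≈⟨ bilinear-basis T._≟_ (λ x y → T.comp (e′ e) x zero y) _ (f l′) ⟩
      basis (T.comp (e′ e) (T.comp refl x (suc zero) (f r′)) zero (f l′))
        ≡⟨ cong basis (trans (f-comp (e′ e) _ zero l′)
             (cong (λ y → T.comp (e′ e) y zero (f l′)) (f-comp refl (corolla _≟_ a) (suc zero) r′))) ⟨
      basis (f (mkBinaryTree (node a l r) e)) ∎
      where
      open SetoidReasoning M.≈ᴹ-setoid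
      ev = Evaluation.eval (linearOperad T isSetOperad) (λ a → basis (f (corolla _≟_ a)))
      x = f (corolla _≟_ a)
      l′ = mkBinaryTree l refl
      r′ = mkBinaryTree r refl
      e′ : leavesᵇ l + leavesᵇ r ≡ n → suc n ≡ suc (leavesᵇ r) + leavesᵇ l
      e′ e = cong suc (trans (sym e) (ℕ.+-comm (leavesᵇ l) _))

-- Classification of the binary trees with three leaves.

module _ {G : Set} where
  leftTree rightTree : G → G → BinaryTreeOfArity G 3
  leftTree  x y = mkBinaryTree (node x (node y leaf leaf) leaf) refl
  rightTree x y = mkBinaryTree (node x leaf (node y leaf leaf)) refl

  data Shape : BinaryTreeOfArity G 3 → Set where
    left  : ∀ x y → Shape (leftTree x y)
    right : ∀ x y → Shape (rightTree x y)

  leaves-positive : (t : BinaryTree G) → ∃ λ n → leavesᵇ t ≡ suc n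
  leaves-positive leaf         = 0 , refl
  leaves-positive (node a l r) with leaves-positive l
  ... | n , p rewrite p = _ , refl

  data TwoLeaves : BinaryTree G → Set where
    twoLeaves : ∀ y → TwoLeaves (node y leaf leaf)

  leaves≡1 : (t : BinaryTree G) → leavesᵇ t ≡ 1 → t ≡ leaf
  leaves≡1 leaf         p = refl
  leaves≡1 (node a l r) p with leaves-positive l | leaves-positive r
  ... | m , q | n , q′ =
    contradiction (ℕ.suc-injective (trans (sym (cong₂ _+_ q q′)) p)) (ℕ.m+1+n≢0 m)

  leaves≡2 : (t : BinaryTree G) → leavesᵇ t ≡ 2 → TwoLeaves t
  leaves≡2 (node a l r) p with leaves-positive l | leaves-positive r
  ... | zero  , q | n , q′ with leaves≡1 l q | leaves≡1 r (ℕ.suc-injective (trans (cong (_+ leavesᵇ r) (sym q)) p))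
  ...   | refl | refl = twoLeaves a
  leaves≡2 (node a l r) p | suc m , q | n , q′ =
    contradiction (ℕ.suc-injective (ℕ.suc-injective (trans (sym (cong₂ _+_ q q′)) p))) (ℕ.m+1+n≢0 m)

  shape : ∀ t → Shape t
  shape (mkBinaryTree t p) = go t (recompute (_ ℕ.≟ 3) p)
    where
    go : ∀ t (p : leavesᵇ t ≡ 3) → Shape (mkBinaryTree t p)
    go (node a l r) p with leaves-positive l | leaves-positive r
    ... | zero , q | _ with leaves≡1 l q | leaves≡2 r (ℕ.suc-injective (trans (cong (_+ leavesᵇ r) (sym q)) p))
    ...   | refl | twoLeaves y = right a y
    go (node a l r) p | suc zero , q | _
      with leaves≡2 l q | leaves≡1 r (ℕ.suc-injective (ℕ.suc-injective (trans (cong (_+ leavesᵇ r) (sym q)) p)))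
    ...   | twoLeaves y | refl = left a y
    go (node a l r) p | suc (suc m) , q | n , q′ =
      contradiction (ℕ.suc-injective (ℕ.suc-injective (ℕ.suc-injective (trans (sym (cong₂ _+_ q q′)) p))))
        (ℕ.m+1+n≢0 m)

  rightTree-injective : ∀ {x y u v} → rightTree x y ≡ rightTree u v → x ≡ u × y ≡ v
  rightTree-injective refl = refl , refl

  leftTree-injective : ∀ {x y u v} → leftTree x y ≡ leftTree u v → x ≡ u × y ≡ v
  leftTree-injective refl = refl , refl

-- The prefix sums of the generators and the annihilator of the relations of As.

module DualAssociative {c ℓ} (R : CommutativeRing c ℓ) (γ : ℕ) where
  open Linear R
  open LinearExtension R
  open Homomorphism
  open BinaryQuadratic (Fin._≟_ {γ})
  open AlternatingSchröder γ
  open Max (Fin.≤-totalOrder γ) using (x≤x⊔y; x≤y⊔x; ⊔-lub; ⊔-idem) renaming (_⊔_ to _↑_)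
  private
    module K where
      open CommutativeRing R public
      open RingProperties (CommutativeRing.ring R) public
    module B = RawSetOperad (freeRawSetOperad (Fin._≟_ {γ}))
    module T = RawSetOperad (alternatingSchröderRawSetOperad γ)
  open K using (_≈_; 0#; 1#)
  module PK = PrefixSums K.+-abelianGroup

  indicator : ∀ {p} {P : Set p} → Dec P → K.Carrier
  indicator p? = if does p? then 1# else 0#

  indicator-⇔ : ∀ {p q} {P : Set p} {Q : Set q} (p? : Dec P) (q? : Dec Q) → (P → Q) → (Q → P) →
    indicator p? ≡ indicator q?
  indicator-⇔ p? q? f g = cong (if_then 1# else 0#) (does-⇔ (mk⇔ f g) p? q?)

  indicator-no : ∀ {p} {P : Set p} (p? : Dec P) → ¬ P → indicator p? ≡ 0#
  indicator-no p? ¬p = cong (if_then 1# else 0#) (dec-false p? ¬p)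

  indicator-× : ∀ {p q} {P : Set p} {Q : Set q} (p? : Dec P) (q? : Dec Q) →
    indicator (p? ×-dec q?) ≈ indicator p? K.* indicator q?
  indicator-× (yes _) q? = K.sym (K.*-identityˡ _)
  indicator-× (no  _) q? = K.sym (K.zeroˡ _)

  indicator-⊎ : ∀ {p q r} {P : Set p} {Q : Set q} {R : Set r} (p? : Dec P) (q? : Dec Q) (r? : Dec R) →
    (P → ¬ Q) → (P → R) → (Q → R) → (¬ P → R → Q) →
    indicator p? K.+ indicator q? ≈ indicator r?
  indicator-⊎ (yes p) q? r? disjoint f _ _ = K.trans
    (K.+-congˡ (K.reflexive (indicator-no q? (disjoint p))))
    (K.trans (K.+-identityʳ 1#) (K.reflexive (cong (if_then 1# else 0#) (sym (dec-true r? (f p))))))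
  indicator-⊎ (no ¬p) q? r? _ _ g h =
    K.trans (K.+-identityˡ _) (K.reflexive (indicator-⇔ q? r? g (h ¬p)))

  -- Here `m` is a natural number because the recursion shrinks `n`, possibly until `m` is no longer
  -- an element of `Fin n`.
  prefixSum-indicator : ∀ {n} m (b : Fin n) →
    PK.prefixSum (λ y → indicator (m ℕ.≟ toℕ y)) b ≈ indicator (m ℕ.≤? toℕ b)
  prefixSum-indicator m zero    = K.reflexive (indicator-⇔ (m ℕ.≟ 0) (m ℕ.≤? 0) ℕ.≤-reflexive ℕ.n≤0⇒n≡0)
  prefixSum-indicator m (suc i) = K.trans
    (K.+-congˡ (K.trans
      (PK.prefixSum-cong (λ y → K.reflexive (cong (λ k → indicator (m ℕ.≟ k)) (Fin.toℕ-inject₁ y))) i)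
      (prefixSum-indicator m i)))
    (indicator-⊎ (m ℕ.≟ suc (toℕ i)) (m ℕ.≤? toℕ i) (m ℕ.≤? suc (toℕ i))
      (λ { refl → ℕ.1+n≰n }) ℕ.≤-reflexive ℕ.m≤n⇒m≤1+n
      (λ m≢1+i m≤1+i → ℕ.≤-pred (ℕ.≤∧≢⇒< m≤1+i m≢1+i)))

  -- The coefficient of `⋆ m` in `◇ b`: 1 if `m ≤ b`, and 0 otherwise. As a prefix sum it can later
  -- be inverted by `difference-prefixSum`.
  below : Fin γ → Fin γ → K.Carrier
  below m = PK.prefixSum (λ y → indicator (m Fin.≟ y))

  below≈indicator : ∀ m b → below m b ≈ indicator (toℕ m ℕ.≤? toℕ b)
  below≈indicator m b = K.trans
    (PK.prefixSum-cong (λ y → K.reflexive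
      (indicator-⇔ (m Fin.≟ y) (toℕ m ℕ.≟ toℕ y) (cong toℕ) Fin.toℕ-injective)) b)
    (prefixSum-indicator (toℕ m) b)

  -- The universal property of the maximum, and the origin of `◇`: it makes the coefficients of
  -- `◇ b ∘₁ ◇ b` and `◇ b ∘₂ ◇ b` functions of `x ↑ y`.
  below-* : ∀ x y b → below x b K.* below y b ≈ below (x ↑ y) b
  below-* x y b = begin
    below x b K.* below y b
      ≈⟨ K.*-cong (below≈indicator x b) (below≈indicator y b) ⟩
    indicator (toℕ x ℕ.≤? toℕ b) K.* indicator (toℕ y ℕ.≤? toℕ b)
      ≈⟨ indicator-× (toℕ x ℕ.≤? toℕ b) (toℕ y ℕ.≤? toℕ b) ⟨
    indicator ((toℕ x ℕ.≤? toℕ b) ×-dec (toℕ y ℕ.≤? toℕ b))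
      ≡⟨ indicator-⇔ ((toℕ x ℕ.≤? toℕ b) ×-dec (toℕ y ℕ.≤? toℕ b)) (toℕ (x ↑ y) ℕ.≤? toℕ b)
           (λ { (p , q) → ⊔-lub {b} {x} {y} p q })
           (λ h → ℕ.≤-trans (x≤x⊔y x y) h , ℕ.≤-trans (x≤y⊔x x y) h) ⟩
    indicator (toℕ (x ↑ y) ℕ.≤? toℕ b)
      ≈⟨ below≈indicator (x ↑ y) b ⟨
    below (x ↑ y) b ∎
    where open SetoidReasoning K.setoid

  *-isAdditive : ∀ a → IsAdditive K.+-abelianGroup K.+-abelianGroup (a K.*_)
  *-isAdditive a = additive⇒isGroupHomomorphism K.+-abelianGroup K.+-abelianGroup
    (a K.*_) K.*-congˡ (K.distribˡ a)

  module _ {n : ℕ} where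
    open FormalSums (B._≟_ {n}) public
      using (δ; _≋_; mk≋; coefficients; coefficient; sum-resp-≋)

  Freeᵍ : ℕ → AbelianGroup c ℓ
  Freeᵍ n = LeftModule.+ᴹ-abelianGroup (Operad.space Free n)

  sum-isAdditive : ∀ {n} (F : B.Op n → K.Carrier) → IsAdditive (Freeᵍ n) K.+-abelianGroup (sum F)
  sum-isAdditive F = additive⇒isGroupHomomorphism (Freeᵍ _) K.+-abelianGroup (sum F) (sum-resp-≋ F) (sum-++ F)

  module F2 = PrefixSums (Freeᵍ 2)
  module F3 = PrefixSums (Freeᵍ 3)
  open Operad.Space Free using (_+ᴹ_; -ᴹ_)

  ◇ : Fin γ → Operad.Op Free 2
  ◇ = F2.prefixSum ⋆

  sum-◇ : ∀ F b → sum F (◇ b) ≈ PK.prefixSum (λ y → F (corolla Fin._≟_ y)) b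
  sum-◇ F b = K.trans (prefixSum-homo (Freeᵍ 2) K.+-abelianGroup (sum-isAdditive F) ⋆ b)
    (PK.prefixSum-cong (λ y → sum-basis F (corolla Fin._≟_ y)) b)

  -- The factor `a` is 1 when `F` reads coefficients at trees of the shape built by `H`, and 0 when
  -- it reads them at the other shape.
  sum-◇◇ : ∀ (F : B.Op 3 → K.Carrier) (H : B.Op 2 → B.Op 2 → B.Op 3) a x y b →
    (∀ u v → F (H (corolla Fin._≟_ u) (corolla Fin._≟_ v)) ≈
             a K.* (indicator (x Fin.≟ u) K.* indicator (y Fin.≟ v))) →
    sum F (bilinear H (◇ b) (◇ b)) ≈ a K.* below (x ↑ y) b
  sum-◇◇ F H a x y b h = begin
    sum F (bilinear H (◇ b) (◇ b))
      ≈⟨ sum-bilinear F H (◇ b) (◇ b) ⟩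
    sum (λ s → sum (λ t → F (H s t)) (◇ b)) (◇ b)
      ≈⟨ sum-◇ _ b ⟩
    PK.prefixSum (λ u → sum (λ t → F (H (corolla Fin._≟_ u) t)) (◇ b)) b
      ≈⟨ PK.prefixSum-cong (λ u → inner u) b ⟩
    PK.prefixSum (λ u → (a K.* below y b) K.* indicator (x Fin.≟ u)) b
      ≈⟨ prefixSum-homo K.+-abelianGroup K.+-abelianGroup (*-isAdditive _) _ b ⟨
    (a K.* below y b) K.* below x b
      ≈⟨ K.trans (K.*-assoc _ _ _) (K.*-congˡ (K.trans (K.*-comm _ _) (below-* x y b))) ⟩
    a K.* below (x ↑ y) b ∎
    where
    open SetoidReasoning K.setoid
    inner : ∀ u → sum (λ t → F (H (corolla Fin._≟_ u) t)) (◇ b) ≈ (a K.* below y b) K.* indicator (x Fin.≟ u)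
    inner u = begin
      sum (λ t → F (H (corolla Fin._≟_ u) t)) (◇ b)
        ≈⟨ sum-◇ _ b ⟩
      PK.prefixSum (λ v → F (H (corolla Fin._≟_ u) (corolla Fin._≟_ v))) b
        ≈⟨ PK.prefixSum-cong (λ v → K.trans (h u v) (K.sym (K.*-assoc _ _ _))) b ⟩
      PK.prefixSum (λ v → (a K.* indicator (x Fin.≟ u)) K.* indicator (y Fin.≟ v)) b
        ≈⟨ prefixSum-homo K.+-abelianGroup K.+-abelianGroup (*-isAdditive _) _ b ⟨
      (a K.* indicator (x Fin.≟ u)) K.* below y b
        ≈⟨ K.trans (K.*-assoc _ _ _) (K.trans (K.*-congˡ (K.*-comm _ _)) (K.sym (K.*-assoc _ _ _))) ⟩
      (a K.* below y b) K.* indicator (x Fin.≟ u) ∎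

  δ-left : ∀ x y u v → δ (leftTree x y) (leftTree u v) ≡ indicator ((x Fin.≟ u) ×-dec (y Fin.≟ v))
  δ-left x y u v = indicator-⇔ (leftTree x y B.≟ leftTree u v) ((x Fin.≟ u) ×-dec (y Fin.≟ v))
    leftTree-injective (λ { (refl , refl) → refl })

  δ-right : ∀ x y u v → δ (rightTree x y) (rightTree u v) ≡ indicator ((x Fin.≟ u) ×-dec (y Fin.≟ v))
  δ-right x y u v = indicator-⇔ (rightTree x y B.≟ rightTree u v) ((x Fin.≟ u) ×-dec (y Fin.≟ v))
    rightTree-injective (λ { (refl , refl) → refl })

  δ-left-right : ∀ x y u v → δ (leftTree x y) (rightTree u v) ≡ 0#
  δ-left-right x y u v = indicator-no (leftTree x y B.≟ rightTree u v) λ ()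

  δ-right-left : ∀ x y u v → δ (rightTree x y) (leftTree u v) ≡ 0#
  δ-right-left x y u v = indicator-no (rightTree x y B.≟ leftTree u v) λ ()

  -- This choice of sign makes the coefficient at `rightTree m m` equal to `below m b` itself.
  associator : Fin γ → Operad.Op Free 3
  associator b = (◇ b ∘₂ ◇ b) +ᴹ -ᴹ (◇ b ∘₁ ◇ b)

  sum-difference : ∀ {n} (F : B.Op n → K.Carrier) f g → sum F (f +ᴹ -ᴹ g) ≈ sum F f K.- sum F g
  sum-difference F f g = K.trans (sum-++ F f _)
    (K.+-congˡ (K.trans (sum-scale F (K.- 1#) g) (K.-1*x≈-x _)))

  coefficient-associator-left : ∀ x y b →
    coefficient (associator b) (leftTree x y) ≈ (K.- 1#) K.* below (x ↑ y) b
  coefficient-associator-left x y b = K.trans (sum-difference _ (◇ b ∘₂ ◇ b) (◇ b ∘₁ ◇ b)) (K.trans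
    (K.+-cong
      (K.trans (sum-◇◇ (δ (leftTree x y)) _ 0# x y b (λ u v →
        K.trans (K.reflexive (δ-left-right x y u v)) (K.sym (K.zeroˡ _)))) (K.zeroˡ _))
      (K.-‿cong (K.trans (sum-◇◇ (δ (leftTree x y)) _ 1# x y b (λ u v →
        K.trans (K.reflexive (δ-left x y u v))
          (K.trans (indicator-× (x Fin.≟ u) (y Fin.≟ v)) (K.sym (K.*-identityˡ _))))) (K.*-identityˡ _))))
    (K.trans (K.+-identityˡ _) (K.sym (K.-1*x≈-x _))))

  -- The factor 1 is written out to share with the left case, where it is -1, the form that
  -- `coefficient-associatorPart` expects.
  coefficient-associator-right : ∀ x y b →
    coefficient (associator b) (rightTree x y) ≈ 1# K.* below (x ↑ y) b
  coefficient-associator-right x y b = K.trans (sum-difference _ (◇ b ∘₂ ◇ b) (◇ b ∘₁ ◇ b)) (K.trans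
    (K.+-cong
      (sum-◇◇ (δ (rightTree x y)) _ 1# x y b (λ u v →
        K.trans (K.reflexive (δ-right x y u v))
          (K.trans (indicator-× (x Fin.≟ u) (y Fin.≟ v)) (K.sym (K.*-identityˡ _)))))
      (K.trans (K.-‿cong (K.trans (sum-◇◇ (δ (rightTree x y)) _ 0# x y b (λ u v →
        K.trans (K.reflexive (δ-right-left x y u v)) (K.sym (K.zeroˡ _)))) (K.zeroˡ _))) K.-0#≈0#))
    (K.+-identityʳ _))

  open BinaryTreeOfArity using (tree)

  -- The trees with three leaves are orthogonal, of square 1 on the left and -1 on the right.
  -- Pairing with one of them thus reads off a coefficient up to this sign.
  treePairing-left : ∀ x y s → treePairing (tree s) (tree (leftTree x y)) ≈ δ (leftTree x y) s
  treePairing-left x y s with shape s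
  ... | left u v  = K.reflexive (trans
    (indicator-⇔ ((u Fin.≟ x) ×-dec (v Fin.≟ y)) ((x Fin.≟ u) ×-dec (y Fin.≟ v))
      (λ { (p , q) → sym p , sym q }) (λ { (p , q) → sym p , sym q }))
    (sym (δ-left x y u v)))
  ... | right u v = K.reflexive (sym (δ-left-right x y u v))

  treePairing-right : ∀ x y s → treePairing (tree s) (tree (rightTree x y)) ≈ K.- δ (rightTree x y) s
  treePairing-right x y s with shape s
  ... | left u v  = K.trans (K.sym K.-0#≈0#) (K.-‿cong (K.reflexive (sym (δ-right-left x y u v))))
  ... | right u v = K.trans (negated ((u Fin.≟ x) ×-dec (v Fin.≟ y))) (K.-‿cong (K.reflexive (trans
    (indicator-⇔ ((u Fin.≟ x) ×-dec (v Fin.≟ y)) ((x Fin.≟ u) ×-dec (y Fin.≟ v))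
      (λ { (p , q) → sym p , sym q }) (λ { (p , q) → sym p , sym q }))
    (sym (δ-right x y u v)))))
    where
    negated : ∀ {p} {P : Set p} (p? : Dec P) → (if does p? then K.- 1# else 0#) ≈ K.- indicator p?
    negated (yes _) = K.refl
    negated (no _)  = K.sym K.-0#≈0#

  sum-⋆∘⋆ : ∀ F (H : B.Op 2 → B.Op 2 → B.Op 3) x y →
    sum F (bilinear H (⋆ x) (⋆ y)) ≈ F (H (corolla Fin._≟_ x) (corolla Fin._≟_ y))
  sum-⋆∘⋆ F H x y = K.trans (sum-resp-≋ F (bilinear-basis B._≟_ H _ _)) (sum-basis F _)

  sum-neg-δ : ∀ {n} t (f : FormalSum (B.Op n)) → sum (λ s → K.- δ t s) f ≈ K.- coefficient f t
  sum-neg-δ t f = K.trans (sum-cong (λ s → K.sym (K.-1*x≈-x (δ t s))) f)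
    (K.trans (sum-* (K.- 1#) (δ t) f) (K.-1*x≈-x _))

  pairing-⋆∘₁⋆ : ∀ f x y →
    sum (λ s → sum (λ t → treePairing (tree s) (tree t)) (⋆ x ∘₁ ⋆ y)) f ≈ coefficient f (leftTree x y)
  pairing-⋆∘₁⋆ f x y = sum-cong (λ s → K.trans
    (sum-⋆∘⋆ (λ t → treePairing (tree s) (tree t)) (λ s t → B.comp refl s zero t) x y)
    (treePairing-left x y s)) f

  pairing-⋆∘₂⋆ : ∀ f x y →
    sum (λ s → sum (λ t → treePairing (tree s) (tree t)) (⋆ x ∘₂ ⋆ y)) f ≈ K.- coefficient f (rightTree x y)
  pairing-⋆∘₂⋆ f x y = K.trans
    (sum-cong (λ s → K.trans
      (sum-⋆∘⋆ (λ t → treePairing (tree s) (tree t)) (λ s t → B.comp refl s (suc zero) t) x y)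
      (treePairing-right x y s)) f)
    (sum-neg-δ (rightTree x y) f)

  pairing-+ : ∀ f g h → ⟨ f , g +ᴹ h ⟩ ≈ ⟨ f , g ⟩ K.+ ⟨ f , h ⟩
  pairing-+ f g h = K.trans (sum-cong (λ s → sum-++ _ g h) f) (sum-+ _ _ f)

  pairing-* : ∀ f a g → ⟨ f , scale a g ⟩ ≈ a K.* ⟨ f , g ⟩
  pairing-* f a g = K.trans (sum-cong (λ s → sum-scale _ a g) f) (sum-* a _ f)

  pairing-difference : ∀ f g h → ⟨ f , g +ᴹ -ᴹ h ⟩ ≈ ⟨ f , g ⟩ K.- ⟨ f , h ⟩
  pairing-difference f g h = K.trans (pairing-+ f g _)
    (K.+-congˡ (K.trans (pairing-* f (K.- 1#) h) (K.-1*x≈-x _)))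

  -- The minus sign of the relation cancels the -1 of the form on right trees. With
  -- `pairing-relation₂`, an annihilating `f` has coefficient `c` at `rightTree x y` and `- c` at
  -- `leftTree x y`, where `c` is its coefficient at the diagonal tree of `x ↑ y`.
  pairing-relation₁ : ∀ f x y → ⟨ f , (⋆ x ∘₁ ⋆ y) +ᴹ -ᴹ (⋆ (x ↑ y) ∘₂ ⋆ (x ↑ y)) ⟩ ≈
    coefficient f (leftTree x y) K.+ coefficient f (rightTree (x ↑ y) (x ↑ y))
  pairing-relation₁ f x y = K.trans (pairing-difference f (⋆ x ∘₁ ⋆ y) (⋆ (x ↑ y) ∘₂ ⋆ (x ↑ y)))
    (K.+-cong (pairing-⋆∘₁⋆ f x y)
      (K.trans (K.-‿cong (pairing-⋆∘₂⋆ f (x ↑ y) (x ↑ y))) (K.-‿involutive _)))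

  pairing-relation₂ : ∀ f x y → ⟨ f , (⋆ x ∘₂ ⋆ y) +ᴹ -ᴹ (⋆ (x ↑ y) ∘₂ ⋆ (x ↑ y)) ⟩ ≈
    K.- coefficient f (rightTree x y) K.+ coefficient f (rightTree (x ↑ y) (x ↑ y))
  pairing-relation₂ f x y = K.trans (pairing-difference f (⋆ x ∘₂ ⋆ y) (⋆ (x ↑ y) ∘₂ ⋆ (x ↑ y)))
    (K.+-cong (pairing-⋆∘₂⋆ f x y)
      (K.trans (K.-‿cong (pairing-⋆∘₂⋆ f (x ↑ y) (x ↑ y))) (K.-‿involutive _)))

  coefficient-associator-diagonal : ∀ x y b →
    coefficient (associator b) (rightTree (x ↑ y) (x ↑ y)) ≈ below (x ↑ y) b
  coefficient-associator-diagonal x y b = K.trans (coefficient-associator-right (x ↑ y) (x ↑ y) b)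
    (K.trans (K.*-identityˡ _) (K.reflexive (cong (λ m → below m b) (⊔-idem (x ↑ y)))))

  dualRelation : Operad.Op Free 3 → Set _
  dualRelation = annihilator (Span (Operad.space Free 3) (AsRelation γ))

  associator-dualRelation : ∀ b → dualRelation (associator b)
  associator-dualRelation b _ (generator (relation₁ x y)) = begin
    ⟨ associator b , (⋆ x ∘₁ ⋆ y) +ᴹ -ᴹ (⋆ (x ↑ y) ∘₂ ⋆ (x ↑ y)) ⟩
      ≈⟨ pairing-relation₁ (associator b) x y ⟩
    coefficient (associator b) (leftTree x y) K.+ coefficient (associator b) (rightTree (x ↑ y) (x ↑ y))
      ≈⟨ K.+-cong (K.trans (coefficient-associator-left x y b) (K.-1*x≈-x _)) (coefficient-associator-diagonal x y b) ⟩
    K.- below (x ↑ y) b K.+ below (x ↑ y) b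
      ≈⟨ K.-‿inverseˡ _ ⟩
    0# ∎
    where open SetoidReasoning K.setoid
  associator-dualRelation b _ (generator (relation₂ x y)) = begin
    ⟨ associator b , (⋆ x ∘₂ ⋆ y) +ᴹ -ᴹ (⋆ (x ↑ y) ∘₂ ⋆ (x ↑ y)) ⟩
      ≈⟨ pairing-relation₂ (associator b) x y ⟩
    K.- coefficient (associator b) (rightTree x y) K.+ coefficient (associator b) (rightTree (x ↑ y) (x ↑ y))
      ≈⟨ K.+-cong (K.-‿cong (K.trans (coefficient-associator-right x y b) (K.*-identityˡ _)))
           (coefficient-associator-diagonal x y b) ⟩
    K.- below (x ↑ y) b K.+ below (x ↑ y) b
      ≈⟨ K.-‿inverseˡ _ ⟩
    0# ∎
    where open SetoidReasoning K.setoid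
  associator-dualRelation b _ (resp-≈ {x} {y} p g) = K.trans
    (sum-cong (λ s → sum-resp-≋ (λ t → treePairing (tree s) (tree t)) {y} {x} (Operad.Space.≈ᴹ-sym Free p))
      (associator b))
    (associator-dualRelation b x g)
  associator-dualRelation b _ 0-closed = sum-0 (associator b)
  associator-dualRelation b _ (+-closed {x} {y} g h) = K.trans (pairing-+ (associator b) x y)
    (K.trans (K.+-cong (associator-dualRelation b x g) (associator-dualRelation b y h)) (K.+-identityˡ 0#))
  associator-dualRelation b _ (*-closed a {x} g) = K.trans (pairing-* (associator b) a x)
    (K.trans (K.*-congˡ (associator-dualRelation b x g)) (K.zeroʳ a))

  -- For f in the annihilator, the coefficient of rightTree u u in f is the
  -- coordinate of f along difference associator u.
  associatorPart : B.Op 3 → FormalSum (B.Op 3)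
  associatorPart s with shape s
  ... | left _ _  = []
  ... | right u v with u Fin.≟ v
  ...   | yes _ = F3.difference associator u
  ...   | no _  = []

  -- Taking differences in `b` undoes the prefix sum `below m` and leaves the indicator of `m = u`.
  -- The differences of associators are thus dual to the coefficients at the trees `rightTree m m`.
  coefficient-associatorPart : ∀ m a t → (∀ b → coefficient (associator b) t ≈ a K.* below m b) →
    ∀ s → coefficient (associatorPart s) t ≈ a K.* δ (rightTree m m) s
  coefficient-associatorPart m a t h s with shape s
  ... | left u v = K.sym (K.trans (K.*-congˡ (K.reflexive (δ-right-left m m u v))) (K.zeroʳ a))
  ... | right u v with u Fin.≟ v
  ...   | no u≢v = K.sym (K.trans (K.*-congˡ (K.reflexive (trans (δ-right m m u v)
            (indicator-no ((m Fin.≟ u) ×-dec (m Fin.≟ v)) λ { (p , q) → u≢v (trans (sym p) q) })))) (K.zeroʳ a))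
  ...   | yes refl = begin
    coefficient (F3.difference associator u) t
      ≈⟨ difference-homo (Freeᵍ 3) K.+-abelianGroup (sum-isAdditive (δ t)) associator u ⟩
    PK.difference (λ b → coefficient (associator b) t) u
      ≈⟨ PK.difference-cong h u ⟩
    PK.difference (λ b → a K.* below m b) u
      ≈⟨ difference-homo K.+-abelianGroup K.+-abelianGroup (*-isAdditive a) (below m) u ⟨
    a K.* PK.difference (below m) u
      ≈⟨ K.*-congˡ (PK.difference-prefixSum _ u) ⟩
    a K.* indicator (m Fin.≟ u)
      ≈⟨ K.*-congˡ (K.reflexive (trans (δ-right m m u u)
           (indicator-⇔ ((m Fin.≟ u) ×-dec (m Fin.≟ u)) (m Fin.≟ u) (λ { (p , _) → p }) (λ p → p , p)))) ⟨
    a K.* δ (rightTree m m) (rightTree u u) ∎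
    where open SetoidReasoning K.setoid

  -- The spanning half. Both sides have their coefficients at `x`, `y` fixed up to sign by the one
  -- at the diagonal tree of `x ↑ y`: the left side by the relations, the right side by `below-*`.
  -- On diagonal trees they agree by duality.
  bind-associatorPart : ∀ {f} → dualRelation f → f ≋ bind associatorPart f
  bind-associatorPart {f} f⊥ = mk≋ λ t → coefficients′ t (shape t)
    where
    open SetoidReasoning K.setoid
    part : ∀ m a t → (∀ b → coefficient (associator b) t ≈ a K.* below m b) →
      coefficient (bind associatorPart f) t ≈ a K.* coefficient f (rightTree m m)
    part m a t h = begin
      coefficient (bind associatorPart f) t           ≈⟨ sum-bind (δ t) associatorPart f ⟩
      sum (λ s → coefficient (associatorPart s) t) f  ≈⟨ sum-cong (coefficient-associatorPart m a t h) f ⟩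
      sum (λ s → a K.* δ (rightTree m m) s) f         ≈⟨ sum-* a _ f ⟩
      a K.* coefficient f (rightTree m m)             ∎
    coefficients′ : ∀ t → Shape t → coefficient f t ≈ coefficient (bind associatorPart f) t
    coefficients′ _ (left x y) = begin
      coefficient f (leftTree x y)
        ≈⟨ K.+-inverseˡ-unique _ _ (K.trans (K.sym (pairing-relation₁ f x y)) (f⊥ _ (generator (relation₁ x y)))) ⟩
      K.- coefficient f (rightTree (x ↑ y) (x ↑ y))
        ≈⟨ K.-1*x≈-x _ ⟨
      (K.- 1#) K.* coefficient f (rightTree (x ↑ y) (x ↑ y))
        ≈⟨ part (x ↑ y) (K.- 1#) (leftTree x y) (coefficient-associator-left x y) ⟨
      coefficient (bind associatorPart f) (leftTree x y) ∎
    coefficients′ _ (right x y) = begin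
      coefficient f (rightTree x y)
        ≈⟨ K.-‿involutive _ ⟨
      K.- (K.- coefficient f (rightTree x y))
        ≈⟨ K.+-inverseʳ-unique _ _ (K.trans (K.sym (pairing-relation₂ f x y)) (f⊥ _ (generator (relation₂ x y)))) ⟨
      coefficient f (rightTree (x ↑ y) (x ↑ y))
        ≈⟨ K.*-identityˡ _ ⟨
      1# K.* coefficient f (rightTree (x ↑ y) (x ↑ y))
        ≈⟨ part (x ↑ y) 1# (rightTree x y) (coefficient-associator-right x y) ⟨
      coefficient (bind associatorPart f) (rightTree x y) ∎

  -- The mutually inverse morphisms between DAs and alternating Schröder trees.

  AS : Operad c ℓ
  AS = linearOperad (alternatingSchröderRawSetOperad γ) alternatingSchröderIsSetOperad

  private
    module AS = Operad AS
    module D = Operad (DAs γ)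
    module S {n : ℕ} where
      open AS.Space {n} public
      open FormalSums (T._≟_ {n}) public using () renaming (mk≋ to mkS)
    module Q {n : ℕ} where
      open D.Space {n} public
    module A2 = PrefixSums (LeftModule.+ᴹ-abelianGroup (AS.space 2))
    module A3 = PrefixSums (LeftModule.+ᴹ-abelianGroup (AS.space 3))
    module D2 = PrefixSums (LeftModule.+ᴹ-abelianGroup (D.space 2))

  corollaˢ : Fin γ → AS.Op 2
  corollaˢ a = basis (contractTree (corolla Fin._≟_ a))

  module E⋆ = Evaluation AS (A2.difference corollaˢ)

  Φ : Homomorphism (Operad.rawOperad Free) AS.rawOperad
  Φ = bindHomomorphism (alternatingSchröderRawSetOperad γ) AS (idᴴ AS) (freeRawSetOperad Fin._≟_)
    E⋆.evaluate S.≈ᴹ-refl (E⋆.evaluate-comp Fin._≟_)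

  Φ-⋆ : ∀ a → to Φ (⋆ a) S.≈ᴹ A2.difference corollaˢ a
  Φ-⋆ a = S.≈ᴹ-trans (bind-basis T._≟_ E⋆.evaluate (corolla Fin._≟_ a)) (E⋆.eval-corolla a)

  Φ-◇ : ∀ a → to Φ (◇ a) S.≈ᴹ corollaˢ a
  Φ-◇ a = S.≈ᴹ-trans (prefixSum-homo (Freeᵍ 2) (LeftModule.+ᴹ-abelianGroup (AS.space 2))
    (isGroupHomomorphism Φ 2) ⋆ a)
    (S.≈ᴹ-trans (A2.prefixSum-cong Φ-⋆ a) (A2.prefixSum-difference corollaˢ a))

  Φ-associator : ∀ b → to Φ (associator b) S.≈ᴹ S.0ᴹ
  Φ-associator b = begin
    to Φ (associator b)
      ≈⟨ S.≈ᴹ-trans (+-homo Φ (◇ b ∘₂ ◇ b) _) (S.+ᴹ-congˡ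
           (GroupMorphisms.IsGroupHomomorphism.⁻¹-homo (isGroupHomomorphism Φ 3) (◇ b ∘₁ ◇ b))) ⟩
    to Φ (◇ b ∘₂ ◇ b) S.+ᴹ S.-ᴹ to Φ (◇ b ∘₁ ◇ b)
      ≈⟨ S.+ᴹ-cong (composite (suc zero)) (S.-ᴹ‿cong (composite zero)) ⟩
    basis (T.comp refl x (suc zero) x) S.+ᴹ S.-ᴹ basis (T.comp refl x zero x)
      ≡⟨ cong (λ y → basis (T.comp refl x (suc zero) x) S.+ᴹ S.-ᴹ basis y) (contractTree-associative b) ⟩
    basis (T.comp refl x (suc zero) x) S.+ᴹ S.-ᴹ basis (T.comp refl x (suc zero) x)
      ≈⟨ S.-ᴹ‿inverseʳ (basis (T.comp refl x (suc zero) x)) ⟩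
    S.0ᴹ ∎
    where
    open SetoidReasoning S.≈ᴹ-setoid
    x = contractTree (corolla Fin._≟_ b)
    composite : ∀ (i : Fin 2) → to Φ (Operad.comp Free {3} refl (◇ b) i (◇ b)) S.≈ᴹ basis (T.comp refl x i x)
    composite i = S.≈ᴹ-trans (comp-homo Φ refl (◇ b) i (◇ b))
      (S.≈ᴹ-trans (AS.comp-cong refl i (Φ-◇ b) (Φ-◇ b)) (bilinear-basis T._≟_ (λ x y → T.comp refl x i y) x x))

  Φ-associatorPart : ∀ s → to Φ (associatorPart s) S.≈ᴹ S.0ᴹ
  Φ-associatorPart s with shape s
  ... | left _ _  = S.≈ᴹ-refl
  ... | right u v with u Fin.≟ v
  ...   | no _  = S.≈ᴹ-refl
  ...   | yes _ = S.≈ᴹ-trans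
    (difference-homo (Freeᵍ 3) (LeftModule.+ᴹ-abelianGroup (AS.space 3)) (isGroupHomomorphism Φ 3) associator u)
    (A3.difference-ε Φ-associator u)

  -- The ideal defining DAs is generated by the whole annihilator, so `f` is first written as a
  -- combination of differences of associators, each of which `Φ` kills.
  Φ-dualRelation : ∀ {f} → dualRelation f → to Φ f S.≈ᴹ S.0ᴹ
  Φ-dualRelation {f} f⊥ = begin
    to Φ f                                      ≈⟨ to-cong Φ {x = f} (bind-associatorPart {f} f⊥) ⟩
    to Φ (bind associatorPart f)                ≈⟨ bind-assoc T._≟_ E⋆.evaluate associatorPart f ⟩
    bind (λ s → to Φ (associatorPart s)) f      ≈⟨ bind-cong T._≟_ Φ-associatorPart f ⟩
    bind (λ _ → []) f                           ≡⟨ bind-[] f ⟩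
    S.0ᴹ                                        ∎
    where
    open SetoidReasoning S.≈ᴹ-setoid
    bind-[] : ∀ {X Y : Set} (f : FormalSum X) → bind {Y = Y} (λ _ → []) f ≡ []
    bind-[] []      = refl
    bind-[] (_ ∷ f) = bind-[] f

  Φ̄ : Homomorphism D.rawOperad AS.rawOperad
  Φ̄ = fromQuotient Free dualRelation AS Φ (λ {f} → Φ-dualRelation {f})

  module E◇ = Evaluation (DAs γ) ◇

  ◇-associative : ∀ a → D.comp {3} refl (◇ a) zero (◇ a) Q.≈ᴹ D.comp refl (◇ a) (suc zero) (◇ a)
  ◇-associative a = Q.≈ᴹ-sym (mk~ (generator (associator-dualRelation a)))

  evaluateExpansion : ∀ {n} → T.Op n → D.Op n
  evaluateExpansion t = E◇.evaluate (expandTree t)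

  open Contraction (Fin._≟_ {γ})

  -- The expansion of a composite is the expansion of the contraction of a composite of expansions.
  -- By `expand-contract` this differs from the latter composite by associativity only, which
  -- evaluation at the associative `◇` does not see.
  evaluateExpansion-comp : ∀ {k n m} .(e : suc k ≡ n + m) (s : T.Op n) (i : Fin n) (t : T.Op m) →
    evaluateExpansion (T.comp e s i t) Q.≈ᴹ D.comp e (evaluateExpansion s) i (evaluateExpansion t)
  evaluateExpansion-comp e s i t = Q.≈ᴹ-trans
    (E◇.eval-∼ ◇-associative
      (∼-trans (∼-reflexive (cong (λ u → expand (AlternatingSchröderTree.tree u)) (trans
        (cong₂ (λ u v → T.comp e u i v) (sym (contractTree-expandTree s)) (sym (contractTree-expandTree t)))
        (sym (contractTree-comp e (expandTree s) i (expandTree t))))))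
        (expand-contract (tree (B.comp e (expandTree s) i (expandTree t)))))
      _ _)
    (E◇.evaluate-comp Fin._≟_ e (expandTree s) i (expandTree t))

  Ψ : Homomorphism AS.rawOperad D.rawOperad
  Ψ = bindHomomorphism (freeRawSetOperad Fin._≟_) (DAs γ) (projection Free dualRelation)
    (alternatingSchröderRawSetOperad γ) evaluateExpansion Q.≈ᴹ-refl evaluateExpansion-comp

  Ψ-basis : ∀ {n} (t : T.Op n) → to Ψ (basis t) Q.≈ᴹ evaluateExpansion t
  Ψ-basis t = to-cong (projection Free dualRelation) (bind-basis B._≟_ evaluateExpansion t)

  Ψ-difference : ∀ a → to Ψ (A2.difference corollaˢ a) Q.≈ᴹ ⋆ a
  Ψ-difference a = begin
    to Ψ (A2.difference corollaˢ a)
      ≈⟨ difference-homo (LeftModule.+ᴹ-abelianGroup (AS.space 2)) (LeftModule.+ᴹ-abelianGroup (D.space 2))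
           (isGroupHomomorphism Ψ 2) corollaˢ a ⟩
    D2.difference (λ a → to Ψ (corollaˢ a)) a
      ≈⟨ D2.difference-cong (λ a → Q.≈ᴹ-trans
           (Ψ-basis (contractTree (corolla Fin._≟_ a))) (E◇.eval-corolla a)) a ⟩
    D2.difference ◇ a
      ≈⟨ difference-homo (Freeᵍ 2) (LeftModule.+ᴹ-abelianGroup (D.space 2))
           (isGroupHomomorphism (projection Free dualRelation) 2) ◇ a ⟨
    F2.difference ◇ a
      ≈⟨ to-cong (projection Free dualRelation) (F2.difference-prefixSum ⋆ a) ⟩
    ⋆ a ∎
    where open SetoidReasoning Q.≈ᴹ-setoid

  -- Evaluation is natural, so `Ψ` moves it from the differences of corollas to the `⋆ a`, and in
  -- the free operad the evaluation of `t` at these is `t`.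
  Ψ-evaluate : ∀ {n} (t : B.Op n) → to Ψ (E⋆.evaluate t) Q.≈ᴹ basis t
  Ψ-evaluate (mkBinaryTree t p) = begin
    to Ψ (E⋆.eval t p)
      ≈⟨ eval-natural AS (DAs γ) Ψ (A2.difference corollaˢ) ⋆ Ψ-difference t p ⟩
    Evaluation.eval (DAs γ) ⋆ t p
      ≈⟨ eval-natural Free (DAs γ) (projection Free dualRelation) ⋆ ⋆ (λ _ → Q.≈ᴹ-refl) t p ⟨
    Evaluation.eval Free ⋆ t p
      ≈⟨ to-cong (projection Free dualRelation)
           (eval-basis Fin._≟_ (freeIsSetOperad Fin._≟_) (λ x → x) refl (λ _ _ _ _ → refl) t p) ⟩
    basis (mkBinaryTree t p) ∎
    where open SetoidReasoning Q.≈ᴹ-setoid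

  ΨΦ : ∀ {n} (f : D.Op n) → to Ψ (to Φ f) Q.≈ᴹ f
  ΨΦ f = begin
    to Ψ (to Φ f)
      ≈⟨ to-cong (projection Free dualRelation) (bind-assoc B._≟_ evaluateExpansion E⋆.evaluate f) ⟩
    bind (λ t → to Ψ (E⋆.evaluate t)) f
      ≈⟨ image-bind-cong (freeRawSetOperad Fin._≟_) (DAs γ) (projection Free dualRelation) Ψ-evaluate f ⟩
    bind basis f
      ≈⟨ to-cong (projection Free dualRelation) (bind-identity B._≟_ f) ⟩
    f ∎
    where open SetoidReasoning Q.≈ᴹ-setoid

  Φ-evaluateExpansion : ∀ {n} (t : T.Op n) → to Φ (evaluateExpansion t) S.≈ᴹ basis t
  Φ-evaluateExpansion t = begin
    -- `Φ` and `Φ̄` are the same function. The descended one is required because this evaluation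
    -- composes in the quotient.
    to Φ̄ (E◇.evaluate (expandTree t))
      ≈⟨ eval-natural (DAs γ) AS Φ̄ ◇ corollaˢ Φ-◇ (tree (expandTree t)) _ ⟩
    Evaluation.eval AS corollaˢ (tree (expandTree t)) _
      ≈⟨ eval-basis Fin._≟_ alternatingSchröderIsSetOperad contractTree refl contractTree-comp (tree (expandTree t)) _ ⟩
    basis (contractTree (expandTree t))
      ≡⟨ cong basis (contractTree-expandTree t) ⟩
    basis t ∎
    where open SetoidReasoning S.≈ᴹ-setoid

  ΦΨ : ∀ {n} (f : AS.Op n) → to Φ (to Ψ f) S.≈ᴹ f
  ΦΨ f = begin
    to Φ (to Ψ f)                              ≈⟨ bind-assoc T._≟_ E⋆.evaluate evaluateExpansion f ⟩
    bind (λ t → to Φ (evaluateExpansion t)) f  ≈⟨ bind-cong T._≟_ Φ-evaluateExpansion f ⟩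
    bind basis f                               ≈⟨ bind-identity T._≟_ f ⟩
    f                                          ∎
    where open SetoidReasoning S.≈ᴹ-setoid

  DAs≅AlternatingSchröder : D.rawOperad ≅ AS.rawOperad
  DAs≅AlternatingSchröder = record
    { to     = to Φ̄
    ; linear = λ n → record
      { isLeftModuleMonomorphism = record
        { isLeftModuleHomomorphism = record
          { +ᴹ-isGroupHomomorphism = isGroupHomomorphism Φ̄ n
          ; *ₗ-homo                = *-homo Φ̄
          }
        ; injective = λ {x} {y} p →
            Q.≈ᴹ-trans (Q.≈ᴹ-sym (ΨΦ x)) (Q.≈ᴹ-trans (to-cong Ψ p) (ΨΦ y))
        }
      ; surjective = λ y → to Ψ y , λ p → S.≈ᴹ-trans (to-cong Φ̄ p) (ΦΨ y)
      }
    ; unit   = unit-homo Φ̄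
    ; comp   = comp-homo Φ̄
    }

proposition5p1p5 : ∀ {c ℓ₁ ℓ₂} (F : HeytingField c ℓ₁ ℓ₂) → CharacteristicZero F → (γ : ℕ) →
    let open Linear (groundRing F) in
    IsOperad (alternatingSchröderRawOperad γ) ×
    Operad.rawOperad (DAs γ) ≅ alternatingSchröderRawOperad γ
proposition5p1p5 F _ γ = Linear.Operad.isOperad AS , DAs≅AlternatingSchröder
  where open DualAssociative (groundRing F) γ
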